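{- Let $r\geqslant 2$ be an integer. For every $\epsilon>0$ there is $q_0(r,\epsilon)$ such that for every prime power $q\geqslant q_0(r,\epsilon)$ with $r\mid q-1$ and every subset $Y\subseteq\mathbb{F}_q$ with $|Y|\leqslant(\tfrac12-\epsilon)\log_r q$, the set $\Gamma^{(r)}$ shatters $Y$. Consequently, $\liminf_{q\to\infty}\frac{m^{(r)}_q}{\log_2 q}\geqslant \frac{\log_r 2}{2}$, where $m_q^{(r)}$ is the largest integer such that every subset $Y\subseteq\mathbb{F}_q$ with $|Y|\leqslant m_q^{(r)}$ is shattered by $\Gamma^{(r)}$.
   Context: For a prime power $q$ and an integer $r\geqslant 2$ with $r\mid q-1$, let $\Gamma^{(r)}=\{x^r: x\in\mathbb{F}_q^\times\}$, the unique subgroup of $\mathbb{F}_q^\times$ of index $r$. For $x\in\mathbb{F}_q$ write $\Gamma^{(r)}+x=\{z+x:z\in\Gamma^{(r)}\}$. A set $Y=\{y_1,\dots,y_n\}\subseteq\mathbb{F}_q$ (with $n$ distinct elements) is shattered by $\Gamma^{(r)}$ if for every subset $A\subseteq Y$ (including $\emptyset$ and $Y$) there exists $x\in\mathbb{F}_q$ with $x\notin Y$ such that for all $j$, $y_j\in A$ if and only if $y_j\in\Gamma^{(r)}+x$. The limit inferior is over prime powers $q\to\infty$ with $r\mid q-1$. -}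

module Defs where

open import Level using (0ℓ)
open import Data.Nat using (ℕ; zero; suc; _≤_; _^_)
open import Data.Fin using (Fin)
open import Data.Fin.Subset using (Subset; _∈_; _∉_; _⊆_; ∣_∣)
open import Data.Product using (Σ; ∃; _×_; _,_)
open import Relation.Binary.PropositionalEquality using (_≡_)
open import Relation.Nullary using (¬_)
open import Function.Bundles using (_⇔_)
open import Algebra.Core using (Op₁; Op₂)
import Algebra.Structures as AS
open import Data.Nat.Primality using (Prime)

record FiniteField (q : ℕ) : Set where
  field
    _+_ _*_ : Op₂ (Fin q)
    -_      : Op₁ (Fin q)
    0# 1#   : Fin q
    isCommutativeRing : AS.IsCommutativeRing {A = Fin q} _≡_ _+_ _*_ -_ 0# 1#
    0≢1     : ¬ (0# ≡ 1#)
    inverse : (x : Fin q) → ¬ (x ≡ 0#) → ∃ λ y → (x * y) ≡ 1#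

  pow : Fin q → ℕ → Fin q
  pow x zero    = 1#
  pow x (suc n) = x * pow x n

module _ {q : ℕ} (F : FiniteField q) where
  open FiniteField F

  InΓ : ℕ → Fin q → Set
  InΓ r z = ∃ λ w → ¬ (w ≡ 0#) × pow w r ≡ z

  InΓ+ : ℕ → Fin q → Fin q → Set
  InΓ+ r x z = ∃ λ g → InΓ r g × z ≡ (g + x)

  Shattered : ℕ → Subset q → Set
  Shattered r Y = (A : Subset q) → A ⊆ Y →
    ∃ λ x → x ∉ Y × ((y : Fin q) → y ∈ Y → (y ∈ A ⇔ InΓ+ r x y))

  IsM : ℕ → ℕ → Set
  IsM r m = ((Y : Subset q) → ∣ Y ∣ ≤ m → Shattered r Y)
          × ¬ ((Y : Subset q) → ∣ Y ∣ ≤ suc m → Shattered r Y)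

IsPrimePower : ℕ → Set
IsPrimePower q = ∃ λ p → ∃ λ k → Prime p × 1 ≤ k × q ≡ p ^ k

{-# OPTIONS --safe #-}
module Submission where

-- Put c = (q-1)/r.  The coset of z modulo r-th powers is determined by the r-th root of
-- unity z^c, so Y is shattered once every pattern of values of (y - x)^c, y ∈ Y, occurs.
-- Expanding the indicator of a pattern over exponents e ∈ [0,r)^Y gives r^|Y| terms: the
-- one with e = 0 contributes about q, and each other one must be O(|Y| √q).  To stay
-- within the integers, complex characters are replaced by an integral function on the
-- r-th roots of unity that sums to zero over every coset of a nontrivial subgroup.
--
-- The square-root cancellation is proved by Stepanov's method.  Reduce e by its gcd with r
-- to f = ∏ (y - x)^ε and an order N.  The polynomial P = ∑ h_ij(x) f^(i(q-1)/N) (a₀-x)^(qj),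
-- with i < N, can be made to vanish to order M at every x with f(x)^((q-1)/N) = t, because
-- this amounts to few linear conditions on the h_ij.  Counting zeros of P then gives
-- at most q/N + O(|Y| √q) such x for each t, and summing over t gives equidistribution.
--
-- That P ≠ 0 is the irreducibility of f T^N - f(a₀) over F(x) in a quantitative form: a
-- factor of degree k < N would have, by the Newton polygons at the zeros of f, N | k ε for
-- all ε, contradicting that the ε and N have no common divisor.

-- Upper bounds alone suffice. The weight `w` has natural values, mean `K` in the sense used, and
-- `K - 1` at 1. A pattern that never occurs would make the sum over all r^|Y| exponents exactly
-- r^|Y| K at each point, whereas e = 0 contributes only `K - 1` there; the other terms would have
-- to make up this deficit of one per point, and their upper bounds forbid it. Two obstacles shape
-- the Stepanov part. Iterated derivatives are useless from order p on in characteristic p, so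
-- vanishing to order M is read off an expansion in powers of x - a. And f^(i(q-1)/N) has degree of
-- order q, too much for a count of conditions. But modulo (x - a)^M, after multiplication by
-- f(a)^(M-1), it is f(a)^(i(q-1)/N) = t^i, a constant, times a form of degree M - 1 in f(a) and
-- f(x) - f(a). With ε = a/b, the condition |Y| ≤ (1/2 - ε) log_r q reads r^(2b|Y|) ≤ q^(b-2a).

open import Defs
open import Level using (0ℓ)
open import Function using (_∘_; id)
open import Function.Bundles using (mk⇔)
open import Algebra.Bundles using (CommutativeRing; RawRing)
import Algebra.Solver.Ring as RingSolver
import Algebra.Solver.Ring.AlmostCommutativeRing as ACR
import Algebra.Properties.Ring as RingProps
import Algebra.Properties.Semiring.Mult as SemiringMult
import Algebra.Properties.Semiring.Sum as SemiringSum
import Algebra.Properties.CommutativeSemiring.Exp as ExpProps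
open import Data.Bool using (true; false)
open import Data.Empty using (⊥; ⊥-elim)
open import Data.Fin as Fin using (Fin)
import Data.Fin.Properties as Finₚ
open import Data.Fin.Subset using (Subset; ∣_∣) renaming (_∈_ to _∈ₛ_)
import Data.Fin.Subset.Properties as Subsetₚ
open import Data.List using (List; []; _∷_; _++_; map; length; lookup; filter; foldr; tabulate; allFin; upTo; applyUpTo)
open import Data.List.Properties using (length-map; length-++; length-tabulate; length-applyUpTo; map-applyUpTo; applyUpTo-∷ʳ; map-cong; map-id; map-∘; filter-notAll)
open import Data.List.Membership.DecPropositional using () renaming (_∈?_ to ∈?)
open import Data.List.Membership.Propositional using (_∈_; _∉_; find; lose)
open import Data.List.Membership.Propositional.Properties using (∈-filter⁺; ∈-filter⁻; ∈-allFin; ∈-map⁺; ∈-map⁻; ∈-++⁺ˡ; ∈-++⁺ʳ; ∈-upTo⁻; ∈-applyUpTo⁻)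
open import Data.List.Membership.Propositional.Properties.WithK using (unique∧set⇒bag)
open import Data.List.Relation.Binary.BagAndSetEquality using (∼bag⇒↭)
open import Data.List.Relation.Binary.Permutation.Propositional as Perm using (_↭_)
open import Data.List.Relation.Binary.Permutation.Propositional.Properties using (↭-length; ∷↭∷ʳ; map⁺)
open import Data.List.Relation.Unary.All as All using (All; []; _∷_)
import Data.List.Relation.Unary.All.Properties as Allₚ
open import Data.List.Relation.Unary.AllPairs as AllPairs using (AllPairs; []; _∷_)
import Data.List.Relation.Unary.AllPairs.Properties as AllPairsₚ
open import Data.List.Relation.Unary.Any as Any using (here; there; any?)
open import Data.List.Relation.Unary.Any.Properties using (lookup-index)
open import Data.List.Relation.Unary.Unique.Propositional using (Unique)
import Data.List.Relation.Unary.Unique.Propositional.Properties as Uniqueₚ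
open import Data.Maybe using (Maybe; just; nothing)
open import Data.Nat as ℕ using (ℕ; zero; suc; _≤_; _<_; z≤n; s≤s; _!)
import Data.Nat.ListAction as ℕL
open import Data.Nat.Properties as ℕₚ using (≤-trans; <⇒≤; ≤-reflexive; ≤-refl; <⇒≱; <⇒≢; ≤-<-trans; <-≤-trans; <-trans; +-mono-≤; +-monoˡ-≤; +-monoʳ-≤; *-mono-≤; *-monoˡ-≤; *-monoʳ-≤; m+[n∸m]≡n; m≤m+n; m≤n+m; m≤n⇒m<n∨m≡n; ≰⇒>; m^n≢0; n<1+n; ^-monoʳ-≤; ^-monoˡ-≤; m∸n≤m)
open import Data.Nat.Combinatorics using (_C_; nCn≡1; nCk≡nC[n∸k]; nCk+nC[k+1]≡[n+1]C[k+1])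
open import Data.Nat.Combinatorics.Specification using (k>n⇒nCk≡0)
open import Data.Nat.Coprimality using (prime⇒coprime; coprime-Bézout)
open import Data.Nat.Divisibility using (_∣_; divides; _∣?_; ∣-refl; ∣-trans; ∣⇒≤; m∣m*n; n∣m*n; ∣m+n∣m⇒∣n; *-cancelʳ-∣; *-monoˡ-∣)
open import Data.Nat.DivMod using (_/_; _%_; m≡m%n+[m/n]*n; m%n<n; m/n*n≡m; m/n*n≤m; m/n≤m; m*n/n≡m; /-monoˡ-≤)
open import Data.Nat.GCD using (module Bézout; gcd; gcd[m,n]∣m; gcd[m,n]∣n; gcd-greatest; c*gcd[m,n]≡gcd[cm,cn])
open import Data.Nat.Primality using (Prime; prime?; euclidsLemma; prime⇒nonZero; prime⇒nonTrivial)
open import Data.Nat.Primality.Factorisation using (factorise; PrimeFactorisation)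
open import Data.Nat.Solver using (module +-*-Solver)
open import Data.Product using (∃; _×_; _,_; proj₁; proj₂)
open import Data.Sum using (_⊎_; inj₁; inj₂; [_,_]′)
open import Data.Vec using (here; there) renaming ([] to []ᵥ; _∷_ to _∷ᵥ_)
open import Relation.Binary.Definitions using (tri<; tri≈; tri>)
open import Relation.Binary.PropositionalEquality as ≡ using (_≡_; _≢_)
import Relation.Binary.Reasoning.Setoid as SetoidReasoning
open import Relation.Nullary using (¬_; Dec; yes; no)
open import Relation.Nullary.Decidable using (¬?; _×-dec_; decidable-stable)

-- Coefficients of the solver are formal differences of naturals, so that
-- identities involving subtraction can be decided in every commutative ring.
module Solver (R : CommutativeRing 0ℓ 0ℓ) where
  open CommutativeRing R hiding (zero)
  open SemiringMult semiring using (×-homo-+; ×1-homo-*) renaming (_×_ to _·_)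
  open RingProps ring using (-‿distribˡ-*; -‿distribʳ-*; -‿involutive; -‿+-comm; -0#≈0#)
  open SetoidReasoning setoid
  open import Algebra.Properties.CommutativeSemigroup +-commutativeSemigroup using (interchange)

  private
    ⟦_⟧ : ℕ × ℕ → Carrier
    ⟦ a , b ⟧ = a · 1# + - (b · 1#)

    +-homo : ∀ u v → ⟦ proj₁ u ℕ.+ proj₁ v , proj₂ u ℕ.+ proj₂ v ⟧ ≈ ⟦ u ⟧ + ⟦ v ⟧
    +-homo (a , b) (c , d) = begin
      (a ℕ.+ c) · 1# + - ((b ℕ.+ d) · 1#)           ≈⟨ +-cong (×-homo-+ 1# a c) (-‿cong (×-homo-+ 1# b d)) ⟩
      (a · 1# + c · 1#) + - (b · 1# + d · 1#)       ≈⟨ +-congˡ (sym (-‿+-comm _ _)) ⟩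
      (a · 1# + c · 1#) + (- (b · 1#) + - (d · 1#)) ≈⟨ interchange _ _ _ _ ⟩
      ⟦ a , b ⟧ + ⟦ c , d ⟧                         ∎

    *-homo : ∀ u v → ⟦ proj₁ u ℕ.* proj₁ v ℕ.+ proj₂ u ℕ.* proj₂ v , proj₁ u ℕ.* proj₂ v ℕ.+ proj₂ u ℕ.* proj₁ v ⟧ ≈ ⟦ u ⟧ * ⟦ v ⟧
    *-homo (a , b) (c , d) = begin
      (a ℕ.* c ℕ.+ b ℕ.* d) · 1# + - ((a ℕ.* d ℕ.+ b ℕ.* c) · 1#)
        ≈⟨ +-cong (×-homo-+ 1# (a ℕ.* c) _) (-‿cong (×-homo-+ 1# (a ℕ.* d) _)) ⟩
      ((a ℕ.* c) · 1# + (b ℕ.* d) · 1#) + - ((a ℕ.* d) · 1# + (b ℕ.* c) · 1#)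
        ≈⟨ +-cong (+-cong (×1-homo-* a c) (×1-homo-* b d)) (-‿cong (+-cong (×1-homo-* a d) (×1-homo-* b c))) ⟩
      (x * z + y * w) + - (x * w + y * z)       ≈⟨ +-congˡ (sym (-‿+-comm _ _)) ⟩
      (x * z + y * w) + (- (x * w) + - (y * z)) ≈⟨ interchange _ _ _ _ ⟩
      (x * z + - (x * w)) + (y * w + - (y * z)) ≈⟨ +-congˡ (+-comm _ _) ⟩
      (x * z + - (x * w)) + (- (y * z) + y * w)
        ≈⟨ +-cong (+-congˡ (-‿distribʳ-* x w)) (+-cong (-‿distribˡ-* y z) lem) ⟩
      (x * z + x * - w) + (- y * z + - y * - w) ≈⟨ +-cong (sym (distribˡ _ _ _)) (sym (distribˡ _ _ _)) ⟩
      x * (z + - w) + - y * (z + - w)           ≈⟨ sym (distribʳ _ _ _) ⟩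
      ⟦ a , b ⟧ * ⟦ c , d ⟧                     ∎
      where
        x = a · 1#
        y = b · 1#
        z = c · 1#
        w = d · 1#
        lem : y * w ≈ - y * - w
        lem = trans (sym (-‿involutive _)) (trans (-‿cong (-‿distribˡ-* y w)) (-‿distribʳ-* (- y) w))

    -‿homo : ∀ u → ⟦ proj₂ u , proj₁ u ⟧ ≈ - ⟦ u ⟧
    -‿homo (a , b) = begin
      b · 1# + - (a · 1#)     ≈⟨ +-comm _ _ ⟩
      - (a · 1#) + b · 1#     ≈⟨ +-congˡ (sym (-‿involutive _)) ⟩
      - (a · 1#) + - - (b · 1#) ≈⟨ -‿+-comm _ _ ⟩
      - ⟦ a , b ⟧             ∎

    dec : ∀ u v → Maybe (⟦ u ⟧ ≈ ⟦ v ⟧)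
    dec (a , b) (c , d) with (a ℕ.+ d) ℕ.≟ (c ℕ.+ b)
    ... | no _   = nothing
    ... | yes eq = just (begin
      x + - y                   ≈⟨ +-congʳ (trans (sym (+-identityʳ x)) (+-congˡ (sym (-‿inverseʳ w)))) ⟩
      (x + (w + - w)) + - y     ≈⟨ +-congʳ (sym (+-assoc x w (- w))) ⟩
      ((x + w) + - w) + - y     ≈⟨ +-congʳ (+-congʳ h) ⟩
      ((z + y) + - w) + - y     ≈⟨ +-congʳ (trans (+-assoc _ _ _) (trans (+-congˡ (+-comm _ _)) (sym (+-assoc _ _ _)))) ⟩
      ((z + - w) + y) + - y     ≈⟨ trans (+-assoc _ _ _) (trans (+-congˡ (-‿inverseʳ y)) (+-identityʳ _)) ⟩
      z + - w                   ∎)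
      where
        x = a · 1#
        y = b · 1#
        z = c · 1#
        w = d · 1#
        h : x + w ≈ z + y
        h = trans (sym (×-homo-+ 1# a d)) (trans (reflexive (≡.cong (_· 1#) eq)) (×-homo-+ 1# c b))

    differences : RawRing 0ℓ 0ℓ
    differences = record
      { Carrier = ℕ × ℕ ; _≈_ = _≡_
      ; _+_ = λ u v → proj₁ u ℕ.+ proj₁ v , proj₂ u ℕ.+ proj₂ v
      ; _*_ = λ u v → proj₁ u ℕ.* proj₁ v ℕ.+ proj₂ u ℕ.* proj₂ v , proj₁ u ℕ.* proj₂ v ℕ.+ proj₂ u ℕ.* proj₁ v
      ; -_ = λ u → proj₂ u , proj₁ u ; 0# = 0 , 0 ; 1# = 1 , 0 }

    morphism : differences ACR.-Raw-AlmostCommutative⟶ ACR.fromCommutativeRing R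
    morphism = record
      { ⟦_⟧ = ⟦_⟧ ; +-homo = +-homo ; *-homo = *-homo ; -‿homo = -‿homo
      ; 0-homo = trans (+-identityˡ _) -0#≈0#
      ; 1-homo = trans (+-cong (+-identityʳ 1#) -0#≈0#) (+-identityʳ 1#) }

  open RingSolver differences (ACR.fromCommutativeRing R) morphism dec public
    using (solve; _:=_; _:+_; _:*_; _:-_; :-_)

-- Polynomials

module Poly (R : CommutativeRing 0ℓ 0ℓ) where
  open CommutativeRing R hiding (zero) renaming (Carrier to A)
  open SetoidReasoning setoid
  open Solver R
  open RingProps ring using (-0#≈0#)

  -- The Cauchy product of coefficient sequences. The ring laws are proved for sequences, where no
  -- lengths intervene, and `coef-conv` carries them over to lists.
  conv : (ℕ → A) → (ℕ → A) → ℕ → A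
  conv f g zero    = f 0 * g 0
  conv f g (suc n) = f 0 * g (suc n) + conv (f ∘ suc) g n

  conv-cong : ∀ {f f′ g g′} → (∀ n → f n ≈ f′ n) → (∀ n → g n ≈ g′ n) → ∀ n → conv f g n ≈ conv f′ g′ n
  conv-cong p q zero    = *-cong (p 0) (q 0)
  conv-cong p q (suc n) = +-cong (*-cong (p 0) (q (suc n))) (conv-cong (p ∘ suc) q n)

  conv-zeroˡ : ∀ g n → conv (λ _ → 0#) g n ≈ 0#
  conv-zeroˡ g zero    = zeroˡ _
  conv-zeroˡ g (suc n) = trans (+-cong (zeroˡ _) (conv-zeroˡ g n)) (+-identityˡ _)

  conv-distribʳ : ∀ f g h n → conv (λ k → f k + g k) h n ≈ conv f h n + conv g h n
  conv-distribʳ f g h zero    = distribʳ _ _ _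
  conv-distribʳ f g h (suc n) = trans (+-congˡ (conv-distribʳ (f ∘ suc) (g ∘ suc) h n))
    (solve 5 (λ a b c d e → (a :+ b) :* c :+ (d :+ e) := (a :* c :+ d) :+ (b :* c :+ e)) refl _ _ _ _ _)

  conv-scale : ∀ c f g n → conv (λ k → c * f k) g n ≈ c * conv f g n
  conv-scale c f g zero    = *-assoc _ _ _
  conv-scale c f g (suc n) = trans (+-congˡ (conv-scale c (f ∘ suc) g n))
    (solve 4 (λ a b d e → (a :* b) :* d :+ a :* e := a :* (b :* d :+ e)) refl _ _ _ _)

  conv-assoc : ∀ f g h n → conv (conv f g) h n ≈ conv f (conv g h) n
  conv-assoc f g h zero    = *-assoc _ _ _
  conv-assoc f g h (suc n) = begin
    (f 0 * g 0) * h (suc n) + conv (λ k → f 0 * g (suc k) + conv (f ∘ suc) g k) h n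
      ≈⟨ +-congˡ (conv-distribʳ _ _ h n) ⟩
    (f 0 * g 0) * h (suc n) + (conv (λ k → f 0 * g (suc k)) h n + conv (conv (f ∘ suc) g) h n)
      ≈⟨ +-congˡ (+-cong (conv-scale _ _ h n) (conv-assoc (f ∘ suc) g h n)) ⟩
    (f 0 * g 0) * h (suc n) + (f 0 * conv (g ∘ suc) h n + conv (f ∘ suc) (conv g h) n)
      ≈⟨ solve 5 (λ a b c d e → (a :* b) :* c :+ (a :* d :+ e) := a :* (b :* c :+ d) :+ e) refl _ _ _ _ _ ⟩
    f 0 * (g 0 * h (suc n) + conv (g ∘ suc) h n) + conv (f ∘ suc) (conv g h) n ∎

  -- Peels off `g` instead of `f`, which turns the recursion into that of `conv g f`.
  conv-sucʳ : ∀ f g n → conv f g (suc n) ≈ f (suc n) * g 0 + conv f (g ∘ suc) n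
  conv-sucʳ f g zero    = +-comm _ _
  conv-sucʳ f g (suc n) = trans (+-congˡ (conv-sucʳ (f ∘ suc) g n))
    (solve 3 (λ a b c → a :+ (b :+ c) := b :+ (a :+ c)) refl _ _ _)

  conv-comm : ∀ f g n → conv f g n ≈ conv g f n
  conv-comm f g zero    = *-comm _ _
  conv-comm f g (suc n) = trans (+-cong (*-comm _ _) (conv-comm (f ∘ suc) g n)) (sym (conv-sucʳ g f n))

  -- Coefficients in increasing order, trailing zeros allowed. Hence equality compares coefficients,
  -- and degrees are only ever bounded from above.
  Pol : Set
  Pol = List A

  coef : Pol → ℕ → A
  coef []      _       = 0#
  coef (c ∷ p) zero    = c
  coef (c ∷ p) (suc n) = coef p n

  coef-length : ∀ p n → length p ≤ n → coef p n ≈ 0#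
  coef-length []      n       l       = refl
  coef-length (c ∷ p) (suc n) (s≤s l) = coef-length p n l

  infix 4 _≋_
  record _≋_ (p q : Pol) : Set where
    constructor mk≋
    field at : ∀ n → coef p n ≈ coef q n
  open _≋_ public

  infixl 6 _⊕_
  _⊕_ : Pol → Pol → Pol
  []      ⊕ q       = q
  (c ∷ p) ⊕ []      = c ∷ p
  (c ∷ p) ⊕ (d ∷ q) = (c + d) ∷ (p ⊕ q)

  infixl 7 _⊛_
  _⊛_ : Pol → Pol → Pol
  []      ⊛ q = []
  (c ∷ p) ⊛ q = map (c *_) q ⊕ (0# ∷ (p ⊛ q))

  coef-⊕ : ∀ p q n → coef (p ⊕ q) n ≈ coef p n + coef q n
  coef-⊕ []      q       n       = sym (+-identityˡ _)
  coef-⊕ (c ∷ p) []      n       = sym (+-identityʳ _)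
  coef-⊕ (c ∷ p) (d ∷ q) zero    = refl
  coef-⊕ (c ∷ p) (d ∷ q) (suc n) = coef-⊕ p q n

  coef-scale : ∀ c p n → coef (map (c *_) p) n ≈ c * coef p n
  coef-scale c []      n       = sym (zeroʳ c)
  coef-scale c (d ∷ p) zero    = refl
  coef-scale c (d ∷ p) (suc n) = coef-scale c p n

  coef-neg : ∀ p n → coef (map (λ c → - c) p) n ≈ - coef p n
  coef-neg []      n       = sym -0#≈0#
  coef-neg (d ∷ p) zero    = refl
  coef-neg (d ∷ p) (suc n) = coef-neg p n

  coef-conv : ∀ p q n → coef (p ⊛ q) n ≈ conv (coef p) (coef q) n
  coef-conv []      q n       = sym (conv-zeroˡ _ n)
  coef-conv (c ∷ p) q zero    = trans (coef-⊕ (map (c *_) q) _ 0) (trans (+-congʳ (coef-scale c q 0)) (+-identityʳ _))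
  coef-conv (c ∷ p) q (suc n) = trans (coef-⊕ (map (c *_) q) _ (suc n)) (+-cong (coef-scale c q (suc n)) (coef-conv p q n))

  polyRing : CommutativeRing 0ℓ 0ℓ
  polyRing = record
    { Carrier = Pol ; _≈_ = _≋_ ; _+_ = _⊕_ ; _*_ = _⊛_ ; -_ = map (λ c → - c) ; 0# = [] ; 1# = 1# ∷ []
    ; isCommutativeRing = record
      { isRing = record
        { +-isAbelianGroup = record
          { isGroup = record
            { isMonoid = record
              { isSemigroup = record
                { isMagma = record
                  { isEquivalence = record
                    { refl = mk≋ λ n → refl
                    ; sym = λ e → mk≋ λ n → sym (at e n)
                    ; trans = λ e f → mk≋ λ n → trans (at e n) (at f n) }
                  ; ∙-cong = λ {p} {p′} {q} {q′} e f → mk≋ λ n →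
                      trans (coef-⊕ p q n) (trans (+-cong (at e n) (at f n)) (sym (coef-⊕ p′ q′ n))) }
                ; assoc = λ p q s → mk≋ λ n → begin
                    coef (p ⊕ q ⊕ s) n              ≈⟨ trans (coef-⊕ (p ⊕ q) s n) (+-congʳ (coef-⊕ p q n)) ⟩
                    coef p n + coef q n + coef s n   ≈⟨ +-assoc _ _ _ ⟩
                    coef p n + (coef q n + coef s n) ≈⟨ trans (coef-⊕ p (q ⊕ s) n) (+-congˡ (coef-⊕ q s n)) ⟨
                    coef (p ⊕ (q ⊕ s)) n            ∎ }
              ; identity = (λ p → mk≋ λ n → refl)
                         , (λ p → mk≋ λ n → trans (coef-⊕ p [] n) (+-identityʳ _)) }
            ; inverse = (λ p → mk≋ λ n → trans (coef-⊕ (map (λ c → - c) p) p n) (trans (+-congʳ (coef-neg p n)) (-‿inverseˡ _)))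
                      , (λ p → mk≋ λ n → trans (coef-⊕ p (map (λ c → - c) p) n) (trans (+-congˡ (coef-neg p n)) (-‿inverseʳ _)))
            ; ⁻¹-cong = λ {p} {q} e → mk≋ λ n → trans (coef-neg p n) (trans (-‿cong (at e n)) (sym (coef-neg q n))) }
          ; comm = λ p q → mk≋ λ n → trans (coef-⊕ p q n) (trans (+-comm _ _) (sym (coef-⊕ q p n))) }
        ; *-cong = λ {p} {p′} {q} {q′} e f → mk≋ λ n →
            trans (coef-conv p q n) (trans (conv-cong (at e) (at f) n) (sym (coef-conv p′ q′ n)))
        ; *-assoc = λ p q s → mk≋ λ n → begin
            coef (p ⊛ q ⊛ s) n                         ≈⟨ trans (coef-conv (p ⊛ q) s n) (conv-cong (coef-conv p q) (λ _ → refl) n) ⟩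
            conv (conv (coef p) (coef q)) (coef s) n   ≈⟨ conv-assoc _ _ _ n ⟩
            conv (coef p) (conv (coef q) (coef s)) n   ≈⟨ trans (coef-conv p (q ⊛ s) n) (conv-cong (λ _ → refl) (coef-conv q s) n) ⟨
            coef (p ⊛ (q ⊛ s)) n                       ∎
        ; *-identity = one*ˡ , λ p → mk≋ λ n → trans (at (comm* p (1# ∷ [])) n) (at (one*ˡ p) n)
        ; distrib = (λ p q s → mk≋ λ n → trans (at (comm* p (q ⊕ s)) n)
                       (trans (at (dist q s p) n)
                         (trans (coef-⊕ (q ⊛ p) (s ⊛ p) n)
                           (trans (+-cong (at (comm* q p) n) (at (comm* s p) n)) (sym (coef-⊕ (p ⊛ q) (p ⊛ s) n))))))
                  , λ p q s → dist q s p }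
      ; *-comm = comm* } }
    where
      comm* : ∀ p q → p ⊛ q ≋ q ⊛ p
      comm* p q = mk≋ λ n → trans (coef-conv p q n) (trans (conv-comm _ _ n) (sym (coef-conv q p n)))
      one*ˡ : ∀ p → (1# ∷ []) ⊛ p ≋ p
      one*ˡ p = mk≋ λ n → trans (coef-⊕ (map (1# *_) p) (0# ∷ []) n)
        (trans (+-cong (trans (coef-scale 1# p n) (*-identityˡ _)) (z n)) (+-identityʳ _))
        where z : ∀ n → coef (0# ∷ []) n ≈ 0#
              z zero    = refl
              z (suc n) = refl
      dist : ∀ p q s → (p ⊕ q) ⊛ s ≋ p ⊛ s ⊕ q ⊛ s
      dist p q s = mk≋ λ n → begin
        coef ((p ⊕ q) ⊛ s) n                              ≈⟨ coef-conv (p ⊕ q) s n ⟩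
        conv (coef (p ⊕ q)) (coef s) n                    ≈⟨ conv-cong (coef-⊕ p q) (λ _ → refl) n ⟩
        conv (λ k → coef p k + coef q k) (coef s) n       ≈⟨ conv-distribʳ _ _ _ n ⟩
        conv (coef p) (coef s) n + conv (coef q) (coef s) n ≈⟨ +-cong (coef-conv p s n) (coef-conv q s n) ⟨
        coef (p ⊛ s) n + coef (q ⊛ s) n                   ≈⟨ coef-⊕ (p ⊛ s) (q ⊛ s) n ⟨
        coef (p ⊛ s ⊕ q ⊛ s) n                            ∎

-- Ring homomorphisms

record RingHom (R S : CommutativeRing 0ℓ 0ℓ) : Set where
  private
    module R = CommutativeRing R
    module S = CommutativeRing S
  field
    fun    : R.Carrier → S.Carrier
    cong   : ∀ {x y} → x R.≈ y → fun x S.≈ fun y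
    +-homo : ∀ x y → fun (x R.+ y) S.≈ fun x S.+ fun y
    *-homo : ∀ x y → fun (x R.* y) S.≈ fun x S.* fun y
    0-homo : fun R.0# S.≈ S.0#
    1-homo : fun R.1# S.≈ S.1#
    neg-homo : ∀ x → fun (R.- x) S.≈ S.- fun x

idHom : ∀ R → RingHom R R
idHom R = record
  { fun = id ; cong = id ; +-homo = λ _ _ → refl ; *-homo = λ _ _ → refl
  ; 0-homo = refl ; 1-homo = refl ; neg-homo = λ _ → refl }
  where open CommutativeRing R

_∘ʰ_ : ∀ {R S T} → RingHom S T → RingHom R S → RingHom R T
_∘ʰ_ {T = T} g f = record
  { fun = G.fun ∘ F.fun ; cong = G.cong ∘ F.cong
  ; +-homo = λ x y → trans (G.cong (F.+-homo x y)) (G.+-homo _ _)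
  ; *-homo = λ x y → trans (G.cong (F.*-homo x y)) (G.*-homo _ _)
  ; 0-homo = trans (G.cong F.0-homo) G.0-homo
  ; 1-homo = trans (G.cong F.1-homo) G.1-homo
  ; neg-homo = λ x → trans (G.cong (F.neg-homo x)) (G.neg-homo _) }
  where module F = RingHom f
        module G = RingHom g
        open CommutativeRing T

constHom : ∀ R → RingHom R (Poly.polyRing R)
constHom R = record
  { fun = λ c → c ∷ []
  ; cong = λ e → mk≋ λ { zero → e ; (suc n) → refl }
  ; +-homo = λ x y → CommutativeRing.refl polyRing
  ; *-homo = λ x y → mk≋ λ { zero → sym (+-identityʳ _) ; (suc n) → refl }
  ; 0-homo = mk≋ λ { zero → refl ; (suc n) → refl }
  ; 1-homo = CommutativeRing.refl polyRing
  ; neg-homo = λ _ → CommutativeRing.refl polyRing }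
  where open Poly R
        open CommutativeRing R hiding (zero)

-- Divisibility, congruences and truncated binomial powers in a commutative ring

module RingTools (R : CommutativeRing 0ℓ 0ℓ) where
  open CommutativeRing R hiding (zero) renaming (Carrier to A)
  open SetoidReasoning setoid
  open Solver R
  open ExpProps commutativeSemiring public using (_^_; ^-congˡ; ^-congʳ; ^-homo-*; ^-assocʳ; ^-distrib-*)
  open SemiringMult semiring public using () renaming (_×_ to _·_)
  open SemiringMult semiring using (×-homo-+)

  infix 4 _∣ᵣ_
  infixr 4 _,_
  record _∣ᵣ_ (a b : A) : Set where
    constructor _,_
    field
      quotient : A
      equality : b ≈ a * quotient

  ∣ᵣ-resp : ∀ {a b c} → b ≈ c → a ∣ᵣ b → a ∣ᵣ c
  ∣ᵣ-resp e (k , p) = k , trans (sym e) p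

  ∣ᵣ-trans : ∀ {a b c} → a ∣ᵣ b → b ∣ᵣ c → a ∣ᵣ c
  ∣ᵣ-trans {a} (k , p) (l , q) = k * l , trans q (trans (*-congʳ p) (*-assoc a k l))

  ∣ᵣ-0 : ∀ {a} → a ∣ᵣ 0#
  ∣ᵣ-0 {a} = 0# , sym (zeroʳ a)

  ∣ᵣ-+ : ∀ {a b c} → a ∣ᵣ b → a ∣ᵣ c → a ∣ᵣ b + c
  ∣ᵣ-+ {a} (k , p) (l , q) = k + l , trans (+-cong p q) (sym (distribˡ a k l))

  ∣ᵣ-*ˡ : ∀ {a b} c → a ∣ᵣ b → a ∣ᵣ c * b
  ∣ᵣ-*ˡ {a} c (k , p) = c * k , trans (*-congˡ p) (solve 3 (λ a c k → c :* (a :* k) := a :* (c :* k)) refl a c k)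

  ∣ᵣ-neg : ∀ {a b} → a ∣ᵣ b → a ∣ᵣ - b
  ∣ᵣ-neg {a} (k , p) = - k , trans (-‿cong p) (solve 2 (λ a k → :- (a :* k) := a :* (:- k)) refl a k)

  ∣ᵣ-^-≤ : ∀ a {m n} → m ≤ n → a ^ m ∣ᵣ a ^ n
  ∣ᵣ-^-≤ a {m} {n} m≤n = a ^ (n ℕ.∸ m) , trans (reflexive (≡.cong (a ^_) (≡.sym (m+[n∸m]≡n m≤n)))) (^-homo-* a m (n ℕ.∸ m))

  ∣ᵣ-* : ∀ {a b c d} → a ∣ᵣ b → c ∣ᵣ d → a * c ∣ᵣ b * d
  ∣ᵣ-* {a} {c = c} (k , p) (l , q) = k * l , trans (*-cong p q)
    (solve 4 (λ a k c l → (a :* k) :* (c :* l) := (a :* c) :* (k :* l)) refl a k c l)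

  ∣ᵣ-^ : ∀ {a b} n → a ∣ᵣ b → a ^ n ∣ᵣ b ^ n
  ∣ᵣ-^ {a} n (k , p) = k ^ n , trans (^-congˡ n p) (^-distrib-* a k n)

  record Mod (d a b : A) : Set where
    constructor mkMod
    field difference : d ∣ᵣ a - b

  mod-refl : ∀ {d a b} → a ≈ b → Mod d a b
  mod-refl {d} {a} {b} e = mkMod (0# , trans (+-congʳ e) (trans (-‿inverseʳ b) (sym (zeroʳ d))))

  mod-trans : ∀ {d a b c} → Mod d a b → Mod d b c → Mod d a c
  mod-trans {d} {a} {b} {c} (mkMod p) (mkMod q) = mkMod (∣ᵣ-resp (solve 3 (λ a b c → (a :- b) :+ (b :- c) := a :- c) refl a b c) (∣ᵣ-+ p q))

  mod-+ : ∀ {d a b a′ b′} → Mod d a b → Mod d a′ b′ → Mod d (a + a′) (b + b′)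
  mod-+ {d} {a} {b} {a′} {b′} (mkMod p) (mkMod q) = mkMod (∣ᵣ-resp
    (solve 4 (λ a b c e → (a :- b) :+ (c :- e) := (a :+ c) :- (b :+ e)) refl a b a′ b′) (∣ᵣ-+ p q))

  mod-* : ∀ {d a b a′ b′} → Mod d a b → Mod d a′ b′ → Mod d (a * a′) (b * b′)
  mod-* {d} {a} {b} {a′} {b′} (mkMod p) (mkMod q) = mkMod (∣ᵣ-resp
    (solve 4 (λ a b c e → c :* (a :- b) :+ b :* (c :- e) := (a :* c) :- (b :* e)) refl a b a′ b′)
    (∣ᵣ-+ (∣ᵣ-*ˡ a′ p) (∣ᵣ-*ˡ b q)))

  mod-^ : ∀ {d a b} n → Mod d a b → Mod d (a ^ n) (b ^ n)
  mod-^ zero    p = mod-refl refl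
  mod-^ (suc n) p = mod-* p (mod-^ n p)

  mod-∣ : ∀ {d a b} → Mod d a b → d ∣ᵣ b → d ∣ᵣ a
  mod-∣ {d} {a} {b} (mkMod p) q = ∣ᵣ-resp (solve 2 (λ a b → (a :- b) :+ b := a) refl a b) (∣ᵣ-+ p q)

  mod-weaken : ∀ {d e a b} → d ∣ᵣ e → Mod e a b → Mod d a b
  mod-weaken d∣e (mkMod p) = mkMod (∣ᵣ-trans d∣e p)

  -- The terms of degree ≤ m in δ of γᵐ (1 + δ/γ)ⁿ: a form of degree m, however large n is.
  trunc : A → A → ℕ → ℕ → A
  trunc γ δ zero    n = 1#
  trunc γ δ (suc m) n = γ * trunc γ δ m n + (n C suc m) · 1# * δ ^ suc m

  private
    nC0 : ∀ n → n C 0 ≡ 1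
    nC0 n = ≡.trans (nCk≡nC[n∸k] {0} {n} z≤n) (nCn≡1 n)

  -- Pascal's rule. Multiplication by δ pushes a single term past the truncation, the one in
  -- `δ ^ suc m`.
  trunc-suc : ∀ γ δ m n → (γ + δ) * trunc γ δ m n ≈ γ * trunc γ δ m (suc n) + (n C m) · 1# * δ ^ suc m
  trunc-suc γ δ zero n = begin
    (γ + δ) * 1#                 ≈⟨ distribʳ 1# γ δ ⟩
    γ * 1# + δ * 1#              ≈⟨ +-congˡ (sym (*-identityˡ _)) ⟩
    γ * 1# + 1# * (δ * 1#)       ≈⟨ +-congˡ (*-congʳ (trans (reflexive (≡.cong (_· 1#) (nC0 n))) (+-identityʳ 1#))) ⟨
    γ * 1# + (n C 0) · 1# * (δ * 1#) ∎
  trunc-suc γ δ (suc m) n = begin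
    (γ + δ) * (γ * t + b * d)
      ≈⟨ solve 5 (λ γ δ t b d → (γ :+ δ) :* (γ :* t :+ b :* d) := γ :* ((γ :+ δ) :* t) :+ γ :* (b :* d) :+ b :* (δ :* d)) refl γ δ t b d ⟩
    γ * ((γ + δ) * t) + γ * (b * d) + b * (δ * d)
      ≈⟨ +-congʳ (+-congʳ (*-congˡ (trunc-suc γ δ m n))) ⟩
    γ * (γ * t′ + a * d) + γ * (b * d) + b * (δ * d)
      ≈⟨ solve 6 (λ γ t a d b e → γ :* (γ :* t :+ a :* d) :+ γ :* (b :* d) :+ e := γ :* (γ :* t :+ (a :+ b) :* d) :+ e) refl γ t′ a d b (b * (δ * d)) ⟩
    γ * (γ * t′ + (a + b) * d) + b * (δ * d)
      ≈⟨ +-congʳ (*-congˡ (+-congˡ (*-congʳ pascal))) ⟩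
    γ * (γ * t′ + (suc n C suc m) · 1# * d) + b * (δ * d) ∎
    where
      t  = trunc γ δ m n
      t′ = trunc γ δ m (suc n)
      d  = δ ^ suc m
      a  = (n C m) · 1#
      b  = (n C suc m) · 1#
      pascal : a + b ≈ (suc n C suc m) · 1#
      pascal = trans (sym (×-homo-+ 1# (n C m) _)) (reflexive (≡.cong (_· 1#) (nCk+nC[k+1]≡[n+1]C[k+1] n m)))

  trunc-0 : ∀ γ δ m → trunc γ δ m 0 ≈ γ ^ m
  trunc-0 γ δ zero    = refl
  trunc-0 γ δ (suc m) = trans (+-cong (*-congˡ (trunc-0 γ δ m))
    (trans (*-congʳ (reflexive (≡.cong (_· 1#) (k>n⇒nCk≡0 {0} {suc m} (s≤s z≤n))))) (zeroˡ _))) (+-identityʳ _)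

  -- Induction on n: each factor γ + δ costs an error divisible by `δ ^ suc m`. The factor `γ ^ m`
  -- clears the denominators of (1 + δ/γ)ⁿ, so that γ need not be invertible.
  trunc-mod : ∀ γ δ m n → Mod (δ ^ suc m) (γ ^ m * (γ + δ) ^ n) (γ ^ n * trunc γ δ m n)
  trunc-mod γ δ m zero    = mod-refl (trans (*-identityʳ _) (trans (sym (trunc-0 γ δ m)) (sym (*-identityˡ _))))
  trunc-mod γ δ m (suc n) = mod-trans
    (mod-refl (solve 3 (λ u v w → u :* (v :* w) := v :* (u :* w)) refl (γ ^ m) (γ + δ) ((γ + δ) ^ n)))
    (mod-trans (mod-* (mod-refl {a = γ + δ} refl) (trunc-mod γ δ m n))
      (mkMod (γ ^ n * c , (begin
        (γ + δ) * (γ ^ n * t) - γ * γ ^ n * t′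
          ≈⟨ +-congʳ (solve 3 (λ u v w → u :* (v :* w) := v :* (u :* w)) refl (γ + δ) (γ ^ n) t) ⟩
        γ ^ n * ((γ + δ) * t) - γ * γ ^ n * t′
          ≈⟨ +-congʳ (*-congˡ (trunc-suc γ δ m n)) ⟩
        γ ^ n * (γ * t′ + c * δ ^ suc m) - γ * γ ^ n * t′
          ≈⟨ solve 5 (λ g γ t c d → g :* (γ :* t :+ c :* d) :- γ :* g :* t := d :* (g :* c)) refl (γ ^ n) γ t′ c (δ ^ suc m) ⟩
        δ ^ suc m * (γ ^ n * c) ∎))))
    where
      t  = trunc γ δ m n
      t′ = trunc γ δ m (suc n)
      c  = (n C m) · 1#

module HomTools {R S : CommutativeRing 0ℓ 0ℓ} (f : RingHom R S) where
  private
    module R = CommutativeRing R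
    module S = CommutativeRing S
    module RT = RingTools R
    module ST = RingTools S
  open RingHom f
  open S using (_≈_; refl; trans)

  ^-homo : ∀ x n → fun (x RT.^ n) ≈ fun x ST.^ n
  ^-homo x zero    = 1-homo
  ^-homo x (suc n) = trans (*-homo x (x RT.^ n)) (S.*-congˡ (^-homo x n))

  ·-homo : ∀ n → fun (n RT.· R.1#) ≈ n ST.· S.1#
  ·-homo zero    = 0-homo
  ·-homo (suc n) = trans (+-homo R.1# (n RT.· R.1#)) (S.+-cong 1-homo (·-homo n))

  trunc-homo : ∀ γ δ m n → fun (RT.trunc γ δ m n) ≈ ST.trunc (fun γ) (fun δ) m n
  trunc-homo γ δ zero    n = 1-homo
  trunc-homo γ δ (suc m) n = trans (+-homo _ _) (S.+-cong
    (trans (*-homo _ _) (S.*-congˡ (trunc-homo γ δ m n)))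
    (trans (*-homo _ _) (S.*-cong (·-homo (n C suc m)) (^-homo δ (suc m)))))

-- Evaluation of polynomials

module Eval {R S : CommutativeRing 0ℓ 0ℓ} (f : RingHom R S) (s : CommutativeRing.Carrier S) where
  private
    module R = CommutativeRing R
  open CommutativeRing S hiding (zero)
  open Solver S
  open RingHom f renaming (fun to φ)
  open Poly R

  ev : Pol → Carrier
  ev []      = 0#
  ev (c ∷ p) = φ c + s * ev p

  ev-⊕ : ∀ p q → ev (p ⊕ q) ≈ ev p + ev q
  ev-⊕ []      q       = sym (+-identityˡ _)
  ev-⊕ (c ∷ p) []      = sym (+-identityʳ _)
  ev-⊕ (c ∷ p) (d ∷ q) = trans (+-cong (+-homo c d) (*-congˡ (ev-⊕ p q)))
    (solve 5 (λ c d s p q → (c :+ d) :+ s :* (p :+ q) := (c :+ s :* p) :+ (d :+ s :* q)) refl _ _ _ _ _)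

  ev-scale : ∀ c p → ev (map (c R.*_) p) ≈ φ c * ev p
  ev-scale c []      = sym (zeroʳ _)
  ev-scale c (d ∷ p) = trans (+-cong (*-homo c d) (*-congˡ (ev-scale c p)))
    (solve 4 (λ c d s p → c :* d :+ s :* (c :* p) := c :* (d :+ s :* p)) refl _ _ _ _)

  ev-⊛ : ∀ p q → ev (p ⊛ q) ≈ ev p * ev q
  ev-⊛ []      q = sym (zeroˡ _)
  ev-⊛ (c ∷ p) q = trans (ev-⊕ (map (c R.*_) q) (R.0# ∷ (p ⊛ q)))
    (trans (+-cong (ev-scale c q) (trans (+-cong 0-homo (*-congˡ (ev-⊛ p q))) (+-identityˡ _)))
      (solve 4 (λ c q s p → c :* q :+ s :* (p :* q) := (c :+ s :* p) :* q) refl _ _ _ _))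

  ev-neg : ∀ p → ev (map (λ c → R.- c) p) ≈ - ev p
  ev-neg []      = sym (RingProps.-0#≈0# ring)
  ev-neg (c ∷ p) = trans (+-cong (neg-homo c) (*-congˡ (ev-neg p)))
    (solve 3 (λ c s p → :- c :+ s :* (:- p) := :- (c :+ s :* p)) refl _ _ _)

  ev-zero : ∀ p → (∀ n → coef p n R.≈ R.0#) → ev p ≈ 0#
  ev-zero []      h = refl
  ev-zero (c ∷ p) h = trans (+-cong (trans (cong (h 0)) 0-homo) (trans (*-congˡ (ev-zero p (h ∘ suc))) (zeroʳ s))) (+-identityˡ _)

  ev-cong′ : ∀ p q → (∀ n → coef p n R.≈ coef q n) → ev p ≈ ev q
  ev-cong′ []      q       h = sym (ev-zero q (R.sym ∘ h))
  ev-cong′ (c ∷ p) []      h = ev-zero (c ∷ p) h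
  ev-cong′ (c ∷ p) (d ∷ q) h = +-cong (cong (h 0)) (*-congˡ (ev-cong′ p q (h ∘ suc)))

  evHom : RingHom polyRing S
  evHom = record
    { fun = ev ; cong = λ {p} {q} e → ev-cong′ p q (at e) ; +-homo = ev-⊕ ; *-homo = ev-⊛
    ; 0-homo = refl ; 1-homo = trans (+-cong 1-homo (zeroʳ s)) (+-identityʳ 1#) ; neg-homo = ev-neg }

  ev-const : ∀ c → ev (c ∷ []) ≈ φ c
  ev-const c = trans (+-congˡ (zeroʳ s)) (+-identityʳ _)

  ev-var : ev (R.0# ∷ R.1# ∷ []) ≈ s
  ev-var = trans (+-cong 0-homo (*-congˡ (ev-const R.1#))) (trans (+-identityˡ _) (trans (*-congˡ 1-homo) (*-identityʳ s)))

-- Degree bounds and pseudo-division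

module Degree (R : CommutativeRing 0ℓ 0ℓ) where
  open CommutativeRing R hiding (zero) renaming (Carrier to A)
  open SetoidReasoning setoid
  open Solver R
  open RingTools R using (_^_)
  open Poly R
  private
    module PR = CommutativeRing polyRing
    module PT = RingTools polyRing

  Vanish> : ℕ → (ℕ → A) → Set
  Vanish> d f = ∀ n → d < n → f n ≈ 0#

  Deg≤ : ℕ → Pol → Set
  Deg≤ d p = Vanish> d (coef p)

  conv-all : (D : A → Set) → (∀ {x y} → x ≈ y → D x → D y) → (∀ {x y} → D x → D y → D (x + y)) →
    ∀ f g n → (∀ a b → a ℕ.+ b ≡ n → D (f a * g b)) → D (conv f g n)
  conv-all D resp add f g zero    h = h 0 0 ≡.refl
  conv-all D resp add f g (suc n) h = add (h 0 (suc n) ≡.refl)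
    (conv-all D resp add (f ∘ suc) g n (λ a b e → h (suc a) b (≡.cong suc e)))

  -- Singles out one product of a Cauchy sum modulo a set closed under addition. With zero alone as
  -- the set this yields leading coefficients; with the multiples of a power of a linear form it
  -- yields the valuations of the Newton polygon.
  conv-isolate : (D : A → Set) → (∀ {x y} → x ≈ y → D x → D y) → D 0# → (∀ {x y} → D x → D y → D (x + y)) →
    ∀ f g i j → (∀ a b → a ℕ.+ b ≡ i ℕ.+ j → a ≢ i → D (f a * g b)) →
    ∃ λ e → D e × conv f g (i ℕ.+ j) ≈ f i * g j + e
  conv-isolate D resp D0 add f g zero    zero    h = 0# , D0 , sym (+-identityʳ _)
  conv-isolate D resp D0 add f g zero    (suc j) h = conv (f ∘ suc) g j ,
    conv-all D resp add (f ∘ suc) g j (λ a b e → h (suc a) b (≡.cong suc e) (λ ())) , refl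
  conv-isolate D resp D0 add f g (suc i) j h
    with e , De , eq ← conv-isolate D resp D0 add (f ∘ suc) g i j
           (λ a b e n → h (suc a) b (≡.cong suc e) (n ∘ ℕₚ.suc-injective))
    = f 0 * g (suc (i ℕ.+ j)) + e , add (h 0 _ ≡.refl (λ ())) De ,
      trans (+-congˡ eq) (solve 3 (λ a b c → a :+ (b :+ c) := b :+ (a :+ c)) refl _ _ _)

  Deg≤-cong : ∀ {d p q} → p ≋ q → Deg≤ d p → Deg≤ d q
  Deg≤-cong e h n d<n = trans (sym (at e n)) (h n d<n)

  Deg≤-mono : ∀ {d e p} → d ≤ e → Deg≤ d p → Deg≤ e p
  Deg≤-mono d≤e h n e<n = h n (≤-<-trans d≤e e<n)

  Deg≤-⊕ : ∀ {d} p q → Deg≤ d p → Deg≤ d q → Deg≤ d (p ⊕ q)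
  Deg≤-⊕ p q h k n d<n = trans (coef-⊕ p q n) (trans (+-cong (h n d<n) (k n d<n)) (+-identityˡ _))

  Deg≤-neg : ∀ {d} p → Deg≤ d p → Deg≤ d (PR.- p)
  Deg≤-neg p h n d<n = trans (coef-neg p n) (trans (-‿cong (h n d<n)) (RingProps.-0#≈0# ring))

  Deg≤-[] : ∀ {d} → Deg≤ d []
  Deg≤-[] n _ = refl

  Deg≤-const : ∀ {d} c → Deg≤ d (c ∷ [])
  Deg≤-const c (suc n) _ = refl

  private
    small : ∀ {d e f g} → Vanish> d f → Vanish> e g → ∀ a b → (d < a ⊎ e < b) → f a * g b ≈ 0#
    small h k a b (inj₁ l) = trans (*-congʳ (h a l)) (zeroˡ _)
    small h k a b (inj₂ l) = trans (*-congˡ (k b l)) (zeroʳ _)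

    split> : ∀ {d e a b} → d ℕ.+ e < a ℕ.+ b → d < a ⊎ e < b
    split> {d} {e} {a} {b} l with ℕₚ.≤-<-connex a d | ℕₚ.≤-<-connex b e
    ... | inj₂ p | _      = inj₁ p
    ... | _      | inj₂ p = inj₂ p
    ... | inj₁ p | inj₁ r = ⊥-elim (<⇒≱ l (+-mono-≤ p r))

    split≡ : ∀ {d e a b} → a ℕ.+ b ≡ d ℕ.+ e → a ≢ d → d < a ⊎ e < b
    split≡ {d} {e} {a} {b} s n with ℕₚ.≤-<-connex a d | ℕₚ.≤-<-connex b e
    ... | inj₂ p | _      = inj₁ p
    ... | _      | inj₂ p = inj₂ p
    ... | inj₁ p | inj₁ r = ⊥-elim (<⇒≢ (ℕₚ.+-mono-<-≤ (ℕₚ.≤∧≢⇒< p n) r) s)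

    zresp : ∀ {x y} → x ≈ y → x ≈ 0# → y ≈ 0#
    zresp e h = trans (sym e) h

    zadd : ∀ {x y} → x ≈ 0# → y ≈ 0# → x + y ≈ 0#
    zadd h k = trans (+-cong h k) (+-identityˡ _)

  Deg≤-⊛ : ∀ {d e} p q → Deg≤ d p → Deg≤ e q → Deg≤ (d ℕ.+ e) (p ⊛ q)
  Deg≤-⊛ p q h k n l = trans (coef-conv p q n) (conv-all (_≈ 0#) zresp zadd (coef p) (coef q) n
    (λ a b e → small h k a b (split> (≡.subst (_ <_) (≡.sym e) l))))

  coef-top : ∀ {d e} p q → Deg≤ d p → Deg≤ e q → coef (p ⊛ q) (d ℕ.+ e) ≈ coef p d * coef q e
  coef-top {d} {e} p q h k
    with x , x≈0 , eq ← conv-isolate (_≈ 0#) zresp refl zadd (coef p) (coef q) d e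
      (λ a b s n → small h k a b (split≡ s n))
    = trans (coef-conv p q _) (trans eq (trans (+-congˡ x≈0) (+-identityʳ _)))

  Deg≤-^ : ∀ {d} p n → Deg≤ d p → Deg≤ (n ℕ.* d) (p PT.^ n)
  Deg≤-^ p zero    h = Deg≤-const 1#
  Deg≤-^ p (suc n) h = Deg≤-⊛ p (p PT.^ n) h (Deg≤-^ p n h)

  coef-const⊛ : ∀ c p n → coef ((c ∷ []) ⊛ p) n ≈ c * coef p n
  coef-const⊛ c p n = trans (coef-⊕ (map (c *_) p) (0# ∷ []) n) (trans (+-cong (coef-scale c p n) (z n)) (+-identityʳ _))
    where z : ∀ n → coef (0# ∷ []) n ≈ 0#
          z zero    = refl
          z (suc n) = refl

  coef-const^⊛ : ∀ c p n m → coef ((c ∷ []) PT.^ m ⊛ p) n ≈ c ^ m * coef p n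
  coef-const^⊛ c p n m = trans (at (PR.*-congʳ {p} (PR.sym (HomTools.^-homo (constHom R) c m))) n) (coef-const⊛ (c ^ m) p n)

  mono : A → ℕ → Pol
  mono a zero    = a ∷ []
  mono a (suc s) = 0# ∷ mono a s

  coef-mono : ∀ a s → coef (mono a s) s ≈ a
  coef-mono a zero    = refl
  coef-mono a (suc s) = coef-mono a s

  coef-mono-≢ : ∀ a s n → n ≢ s → coef (mono a s) n ≈ 0#
  coef-mono-≢ a zero    zero    h = ⊥-elim (h ≡.refl)
  coef-mono-≢ a zero    (suc n) h = refl
  coef-mono-≢ a (suc s) zero    h = refl
  coef-mono-≢ a (suc s) (suc n) h = coef-mono-≢ a s n (h ∘ ≡.cong suc)

  Deg≤-mono′ : ∀ a s → Deg≤ s (mono a s)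
  Deg≤-mono′ a s n l = coef-mono-≢ a s n (<⇒≢ l ∘ ≡.sym)

-- The bookkeeping of sizes that pseudo-division needs of its coefficients. The size in view is the
-- degree in x, for polynomials in T over F[x]; `CD d` then bounds the degrees of all coefficients
-- at once.
record Filtration (R : CommutativeRing 0ℓ 0ℓ) : Set₁ where
  open CommutativeRing R hiding (zero)
  field
    D     : ℕ → Carrier → Set
    resp  : ∀ {d x y} → x ≈ y → D d x → D d y
    weak  : ∀ {d e x} → d ≤ e → D d x → D e x
    add   : ∀ {d x y} → D d x → D d y → D d (x + y)
    mul   : ∀ {d e x y} → D d x → D e y → D (d ℕ.+ e) (x * y)
    neg   : ∀ {d x} → D d x → D d (- x)
    nul   : ∀ {d} → D d 0#

degFiltration : ∀ R → Filtration (Poly.polyRing R)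
degFiltration R = record
  { D = Deg≤ ; resp = Deg≤-cong ; weak = λ {_} {_} {p} → Deg≤-mono {p = p}
  ; add = λ {_} {p} {q} → Deg≤-⊕ p q ; mul = λ {_} {_} {p} {q} → Deg≤-⊛ p q
  ; neg = λ {_} {p} → Deg≤-neg p ; nul = Deg≤-[] }
  where open Degree R

module Coefficientwise {R : CommutativeRing 0ℓ 0ℓ} (𝓕 : Filtration R) where
  open CommutativeRing R hiding (zero) renaming (Carrier to A)
  open SetoidReasoning setoid
  open Solver R
  open RingTools R using (_^_)
  open Poly R
  open Degree R
  open Filtration 𝓕
  private
    module PR = CommutativeRing polyRing
    module PT = RingTools polyRing
    module PS = Solver polyRing

  CD : ℕ → Pol → Set
  CD d p = ∀ n → D d (coef p n)

  CD-weak : ∀ {d e} p → d ≤ e → CD d p → CD e p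
  CD-weak p l h n = weak l (h n)

  CD-⊕ : ∀ {d} p q → CD d p → CD d q → CD d (p ⊕ q)
  CD-⊕ p q h k n = resp (sym (coef-⊕ p q n)) (add (h n) (k n))

  CD-neg : ∀ {d} p → CD d p → CD d (PR.- p)
  CD-neg p h n = resp (sym (coef-neg p n)) (neg (h n))

  CD-⊛ : ∀ {d e} p q → CD d p → CD e q → CD (d ℕ.+ e) (p ⊛ q)
  CD-⊛ p q h k n = resp (sym (coef-conv p q n))
    (conv-all (D _) resp add (coef p) (coef q) n (λ a b _ → mul (h a) (k b)))

  CD-[] : ∀ {d} → CD d []
  CD-[] n = nul

  CD-const : ∀ {d} c → D d c → CD d (c ∷ [])
  CD-const c h zero    = h
  CD-const c h (suc n) = nul

  CD-mono : ∀ {d} a s → D d a → CD d (mono a s)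
  CD-mono a zero    h         = CD-const a h
  CD-mono a (suc s) h zero    = nul
  CD-mono a (suc s) h (suc n) = CD-mono a s h n

  -- Division without inverting the leading coefficient h of `H`: each step multiplies `P` by h
  -- before it cancels the top term, and this adds `e` to the size of the coefficients. There are
  -- `suc s` steps, whence the power of h and the bound on `S`.
  pseudoDivision : ∀ k {e} (H : Pol) → Deg≤ (suc k) H → CD e H →
    ∀ s {d} (P : Pol) → Deg≤ (suc k ℕ.+ s) P → CD d P →
    ∃ λ Q → ∃ λ S → (coef H (suc k) ∷ []) PT.^ suc s ⊛ P ≋ H ⊛ Q ⊕ S
      × Deg≤ s Q × Deg≤ k S × CD (suc s ℕ.* e ℕ.+ d) S
  pseudoDivision k {e} H degH cdH s {d} P degP cdP = go s P₁ eq₁ degP₁ cdP₁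
    where
      h = coef H (suc k) ∷ []
      a = coef P (suc k ℕ.+ s)
      P₁ = h ⊛ P PR.- mono a s ⊛ H
      eq₁ : h ⊛ P ≋ H ⊛ mono a s ⊕ P₁
      eq₁ = PS.solve 3 (λ u m H → u PS.:= H PS.:* m PS.:+ (u PS.:- m PS.:* H)) PR.refl (h ⊛ P) (mono a s) H
      degP₁ : ∀ n → suc k ℕ.+ s ≤ n → coef P₁ n ≈ 0#
      degP₁ n l with m≤n⇒m<n∨m≡n l
      ... | inj₁ lt = Deg≤-⊕ (h ⊛ P) (PR.- (mono a s ⊛ H)) (Deg≤-⊛ {0} h P (Deg≤-const _) degP)
              (Deg≤-neg (mono a s ⊛ H) (≡.subst (λ x → Deg≤ x (mono a s ⊛ H)) (ℕₚ.+-comm s (suc k))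
                (Deg≤-⊛ (mono a s) H (Deg≤-mono′ a s) degH))) n lt
      ... | inj₂ ≡.refl = begin
        coef P₁ (suc k ℕ.+ s)
          ≈⟨ trans (coef-⊕ (h ⊛ P) _ _) (+-cong (coef-const⊛ _ P _) (coef-neg (mono a s ⊛ H) _)) ⟩
        coef H (suc k) * a - coef (mono a s ⊛ H) (suc k ℕ.+ s)
          ≡⟨ ≡.cong (λ x → coef H (suc k) * a - coef (mono a s ⊛ H) x) (ℕₚ.+-comm (suc k) s) ⟩
        coef H (suc k) * a - coef (mono a s ⊛ H) (s ℕ.+ suc k)
          ≈⟨ +-congˡ (-‿cong (trans (coef-top (mono a s) H (Deg≤-mono′ a s) degH) (*-congʳ (coef-mono a s)))) ⟩
        coef H (suc k) * a - a * coef H (suc k)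
          ≈⟨ solve 2 (λ x y → x :* y :- y :* x := x :- x) refl (coef H (suc k)) a ⟩
        coef H (suc k) - coef H (suc k)
          ≈⟨ -‿inverseʳ _ ⟩
        0# ∎
      cdP₁ : CD (e ℕ.+ d) P₁
      cdP₁ = CD-⊕ (h ⊛ P) _ (CD-⊛ h P (CD-const _ (cdH (suc k))) cdP)
        (CD-neg (mono a s ⊛ H) (≡.subst (λ x → CD x (mono a s ⊛ H)) (ℕₚ.+-comm d e) (CD-⊛ (mono a s) H (CD-mono a s (cdP _)) cdH)))
      go : ∀ s P₁ → h ⊛ P ≋ H ⊛ mono a s ⊕ P₁ → (∀ n → suc k ℕ.+ s ≤ n → coef P₁ n ≈ 0#) → CD (e ℕ.+ d) P₁ →
        ∃ λ Q → ∃ λ S → h PT.^ suc s ⊛ P ≋ H ⊛ Q ⊕ S × Deg≤ s Q × Deg≤ k S × CD (suc s ℕ.* e ℕ.+ d) S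
      go zero P₁ eq dg cd = mono a 0 , P₁ , PR.trans (PR.*-congʳ {P} (PR.*-identityʳ h)) eq , Deg≤-mono′ a 0
        , (λ n l → dg n (≡.subst (_≤ n) (≡.sym (ℕₚ.+-identityʳ (suc k))) l))
        , ≡.subst (λ x → CD (x ℕ.+ d) P₁) (≡.sym (ℕₚ.+-identityʳ e)) cd
      go (suc s) P₁ eq dg cd
        with Q , S , eq′ , dQ , dS , cdS ← pseudoDivision k H degH cdH s P₁
               (λ n l → dg n (≡.subst (_≤ n) (≡.sym (ℕₚ.+-suc (suc k) s)) l)) cd
        = h PT.^ suc s ⊛ mono a (suc s) ⊕ Q , S
        , PR.trans (PS.solve 3 (λ u v w → (u PS.:* v) PS.:* w PS.:= v PS.:* (u PS.:* w)) PR.refl h (h PT.^ suc s) P)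
          (PR.trans (PR.*-congˡ {h PT.^ suc s} eq)
          (PR.trans (PS.solve 4 (λ u H m p → u PS.:* (H PS.:* m PS.:+ p) PS.:= H PS.:* (u PS.:* m) PS.:+ u PS.:* p) PR.refl (h PT.^ suc s) H (mono a (suc s)) P₁)
          (PR.trans (PR.+-congˡ {H ⊛ (h PT.^ suc s ⊛ mono a (suc s))} eq′)
            (PS.solve 4 (λ H x Q S → H PS.:* x PS.:+ (H PS.:* Q PS.:+ S) PS.:= H PS.:* (x PS.:+ Q) PS.:+ S) PR.refl H (h PT.^ suc s ⊛ mono a (suc s)) Q S))))
        , Deg≤-⊕ (h PT.^ suc s ⊛ mono a (suc s)) Q
            (≡.subst (λ x → Deg≤ x (h PT.^ suc s ⊛ mono a (suc s))) (≡.cong (ℕ._+ suc s) (ℕₚ.*-zeroʳ (suc s)))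
              (Deg≤-⊛ (h PT.^ suc s) (mono a (suc s)) (Deg≤-^ h (suc s) (Deg≤-const _)) (Deg≤-mono′ a (suc s))))
            (Deg≤-mono {p = Q} (ℕₚ.n≤1+n s) dQ)
        , dS
        , ≡.subst (λ x → CD x S) (≡.trans (≡.sym (ℕₚ.+-assoc (suc s ℕ.* e) e d)) (≡.cong (ℕ._+ d) (ℕₚ.+-comm (suc s ℕ.* e) e))) cdS

-- Finite sums

module RingSum (R : CommutativeRing 0ℓ 0ℓ) where
  open CommutativeRing R hiding (zero) renaming (Carrier to A)
  open SemiringSum semiring public using (sum)
  open RingTools R using (Mod; mod-refl; mod-+)

  sum-cong : ∀ n (f g : Fin n → A) → (∀ i → f i ≈ g i) → sum f ≈ sum g
  sum-cong n f g = SemiringSum.sum-cong-≋ semiring {n} {f} {g}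

  sum-closed : (D : A → Set) → D 0# → (∀ {x y} → D x → D y → D (x + y)) → ∀ n (f : Fin n → A) → (∀ i → D (f i)) → D (sum f)
  sum-closed D z add zero    f h = z
  sum-closed D z add (suc n) f h = add (h Fin.zero) (sum-closed D z add n (f ∘ Fin.suc) (h ∘ Fin.suc))

  sum-mod : ∀ {d} n (f g : Fin n → A) → (∀ i → Mod d (f i) (g i)) → Mod d (sum f) (sum g)
  sum-mod zero    f g h = mod-refl refl
  sum-mod (suc n) f g h = mod-+ (h Fin.zero) (sum-mod n (f ∘ Fin.suc) (g ∘ Fin.suc) (h ∘ Fin.suc))

  *-sumˡ : ∀ c n (f : Fin n → A) → c * sum f ≈ sum (λ i → c * f i)
  *-sumˡ c zero    f = zeroʳ c
  *-sumˡ c (suc n) f = trans (distribˡ c _ _) (+-congˡ (*-sumˡ c n (f ∘ Fin.suc)))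

  sum-split : ∀ m n (f : Fin (m ℕ.+ n) → A) → sum f ≈ sum (λ i → f (i Fin.↑ˡ n)) + sum (λ j → f (m Fin.↑ʳ j))
  sum-split zero    n f = sym (+-identityˡ _)
  sum-split (suc m) n f = trans (+-congˡ (sum-split m n (f ∘ Fin.suc))) (sym (+-assoc _ _ _))

  sum-combine : ∀ m n (f : Fin (m ℕ.* n) → A) → sum f ≈ sum (λ i → sum (λ j → f (Fin.combine {m} {n} i j)))
  sum-combine zero    n f = refl
  sum-combine (suc m) n f = trans (sum-split n (m ℕ.* n) f) (+-congˡ (sum-combine m n (λ s → f (n Fin.↑ʳ s))))

module HomSum {R S : CommutativeRing 0ℓ 0ℓ} (h : RingHom R S) where
  open RingHom h
  private
    module R = RingSum R
    module S = RingSum S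
  open CommutativeRing S hiding (zero)

  sum-homo : ∀ n f → fun (R.sum {n} f) ≈ S.sum {n} (fun ∘ f)
  sum-homo zero    f = 0-homo
  sum-homo (suc n) f = trans (+-homo _ _) (+-congˡ (sum-homo n (f ∘ Fin.suc)))

module PolySum (R : CommutativeRing 0ℓ 0ℓ) where
  open CommutativeRing R hiding (zero) renaming (Carrier to A)
  open Poly R
  open RingSum R
  private module P = RingSum polyRing

  coef-sum : ∀ n (f : Fin n → Pol) k → coef (P.sum f) k ≈ sum (λ i → coef (f i) k)
  coef-sum zero    f k = refl
  coef-sum (suc n) f k = trans (coef-⊕ (f Fin.zero) _ k) (+-congˡ (coef-sum n (f ∘ Fin.suc) k))

  coef-tabulate : ∀ {n} (f : Fin n → A) i → coef (tabulate f) (Fin.toℕ i) ≡ f i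
  coef-tabulate f Fin.zero    = ≡.refl
  coef-tabulate f (Fin.suc i) = coef-tabulate (f ∘ Fin.suc) i

module EvalSum {R S : CommutativeRing 0ℓ 0ℓ} (h : RingHom R S) (s : CommutativeRing.Carrier S) where
  open CommutativeRing S hiding (zero)
  open RingHom h
  open Eval h s using (ev)
  open RingSum S
  open RingTools S using (_^_; _∣ᵣ_; _,_; ∣ᵣ-0; ∣ᵣ-resp; ∣ᵣ-*)

  ev-low : ∀ n p → (∀ k → k < n → CommutativeRing._≈_ R (Poly.coef R p k) (CommutativeRing.0# R)) → s ^ n ∣ᵣ ev p
  ev-low zero    p       h = ev p , sym (*-identityˡ _)
  ev-low (suc n) []      h = ∣ᵣ-0
  ev-low (suc n) (c ∷ p) h = ∣ᵣ-resp (trans (sym (+-identityˡ _)) (+-congʳ (sym (trans (cong (h 0 (s≤s z≤n))) 0-homo))))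
    (∣ᵣ-* (1# , sym (*-identityʳ s)) (ev-low n p (λ k l → h (suc k) (s≤s l))))

  ev-tabulate : ∀ n f → ev (tabulate {n = n} f) ≈ sum (λ i → s ^ Fin.toℕ i * fun (f i))
  ev-tabulate zero    f = refl
  ev-tabulate (suc n) f = +-cong (sym (*-identityˡ _)) (trans (*-congˡ (ev-tabulate n (f ∘ Fin.suc)))
    (trans (*-sumˡ s n _) (sum-cong n _ (λ i → s * s ^ Fin.toℕ i * fun (f (Fin.suc i))) (λ i → sym (*-assoc s (s ^ Fin.toℕ i) (fun (f (Fin.suc i))))))))

-- Polynomials over an integral domain: linear factors and valuations

module DomainPoly (R : CommutativeRing 0ℓ 0ℓ)
    (_≟_ : ∀ x y → Dec (CommutativeRing._≈_ R x y))
    (1≉0 : ¬ CommutativeRing._≈_ R (CommutativeRing.1# R) (CommutativeRing.0# R))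
    (integral : ∀ x y → CommutativeRing._≈_ R (CommutativeRing._*_ R x y) (CommutativeRing.0# R) →
      CommutativeRing._≈_ R x (CommutativeRing.0# R) ⊎ CommutativeRing._≈_ R y (CommutativeRing.0# R)) where
  open CommutativeRing R hiding (zero) renaming (Carrier to A)
  open SetoidReasoning setoid
  open Solver R
  open Poly R public
  open Degree R public
  module PR = CommutativeRing polyRing
  module PT = RingTools polyRing
  module PS = Solver polyRing
  open PT using (_∣ᵣ_; _,_)

  infixl 8 _^ₚ_
  _^ₚ_ : Pol → ℕ → Pol
  _^ₚ_ = PT._^_

  evalAt : A → RingHom polyRing R
  evalAt a = Eval.evHom (idHom R) a

  infix 9 _⟨_⟩
  _⟨_⟩ : Pol → A → A
  p ⟨ a ⟩ = RingHom.fun (evalAt a) p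

  var : Pol
  var = 0# ∷ 1# ∷ []

  -- The sign is that of y - x, the element whose coset decides whether y lies in Γ + x.
  lin : A → Pol
  lin a = (a ∷ []) PR.- var

  lin-eval : ∀ a b → lin a ⟨ b ⟩ ≈ a - b
  lin-eval a b = trans (+-homo (a ∷ []) (PR.- var)) (+-cong (Eval.ev-const (idHom R) b a)
    (trans (neg-homo var) (-‿cong (Eval.ev-var (idHom R) b))))
    where open RingHom (evalAt b)

  cons≋ : ∀ c p → c ∷ p ≋ (c ∷ []) ⊕ var ⊛ p
  cons≋ c p = mk≋ λ
    { zero → sym (trans (coef-⊕ (c ∷ []) (var ⊛ p) 0) (trans (+-congˡ (trans (coef-conv var p 0) (zeroˡ _))) (+-identityʳ c)))
    ; (suc n) → sym (trans (coef-⊕ (c ∷ []) (var ⊛ p) (suc n)) (trans (+-identityˡ _)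
        (trans (coef-conv var p (suc n)) (trans (+-cong (zeroˡ _) (sh n)) (+-identityˡ _))))) }
    where
      sh : ∀ n → conv (coef var ∘ suc) (coef p) n ≈ coef p n
      sh zero    = *-identityˡ _
      sh (suc n) = trans (+-cong (*-identityˡ _) (conv-zeroˡ (coef p) n)) (+-identityʳ _)

  factor : ∀ p a → ∃ λ q → p ≋ lin a ⊛ q ⊕ (p ⟨ a ⟩ ∷ [])
  factor []      a = [] , mk≋ λ n → sym (trans (coef-⊕ (lin a ⊛ []) (0# ∷ []) n)
    (trans (+-cong (at (PR.zeroʳ (lin a)) n) (at (RingHom.0-homo (constHom R)) n)) (+-identityˡ _)))
  factor (c ∷ p) a with q , e ← factor p a = var ⊛ q PR.- r , PR.trans (cons≋ c p) (PR.trans (PR.+-congˡ {c ∷ []} (PR.*-congˡ {var} e))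
      (PR.trans (PS.solve 5 (λ c x a q r → c PS.:+ x PS.:* ((a PS.:- x) PS.:* q PS.:+ r) PS.:=
                       (a PS.:- x) PS.:* (x PS.:* q PS.:- r) PS.:+ (c PS.:+ a PS.:* r)) PR.refl (c ∷ []) var (a ∷ []) q r)
        (PR.+-congˡ {lin a ⊛ (var ⊛ q PR.- r)} (PR.sym (PR.trans (+-homo c (a * (p ⟨ a ⟩))) (PR.+-congˡ {c ∷ []} (*-homo a (p ⟨ a ⟩))))))))
    where r = p ⟨ a ⟩ ∷ []
          open RingHom (constHom R)

  root⇒∣ : ∀ p a → p ⟨ a ⟩ ≈ 0# → lin a ∣ᵣ p
  root⇒∣ p a h with q , e ← factor p a = q ,
    PR.trans e (PR.trans (PR.+-congˡ {lin a ⊛ q} (PR.trans (cong h) 0-homo)) (PR.+-identityʳ _))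
    where open RingHom (constHom R)

  ∣⇒root : ∀ p a → lin a ∣ᵣ p → p ⟨ a ⟩ ≈ 0#
  ∣⇒root p a (q , e) = trans (RingHom.cong (evalAt a) e) (trans (RingHom.*-homo (evalAt a) (lin a) q)
    (trans (*-congʳ (trans (lin-eval a a) (-‿inverseʳ a))) (zeroˡ _)))

  coef-lin : ∀ a q n → coef (lin a ⊛ q) (suc n) ≈ a * coef q (suc n) - coef q n
  coef-lin a q n = begin
    coef (lin a ⊛ q) (suc n) ≈⟨ at eq (suc n) ⟩
    coef ((a ∷ []) ⊛ q PR.- var ⊛ q) (suc n) ≈⟨ coef-⊕ ((a ∷ []) ⊛ q) _ (suc n) ⟩
    coef ((a ∷ []) ⊛ q) (suc n) + coef (PR.- (var ⊛ q)) (suc n)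
      ≈⟨ +-cong (coef-const⊛ a q (suc n)) (trans (coef-neg (var ⊛ q) (suc n)) (-‿cong sh)) ⟩
    a * coef q (suc n) - coef q n ∎
    where
      eq : lin a ⊛ q ≋ (a ∷ []) ⊛ q PR.- var ⊛ q
      eq = PS.solve 3 (λ a x q → (a PS.:- x) PS.:* q PS.:= a PS.:* q PS.:- x PS.:* q) PR.refl (a ∷ []) var q
      sh : coef (var ⊛ q) (suc n) ≈ coef q n
      sh = trans (sym (+-identityˡ _)) (trans (sym (coef-⊕ (0# ∷ []) (var ⊛ q) (suc n))) (sym (at (cons≋ 0# q) (suc n))))

  -- Downward induction from the length of the list. The leading coefficient of `lin a` is -1, so
  -- the coefficient of `q` in degree n is determined by those of `q` and of `lin a ⊛ q` in degree n
  -- + 1.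
  lin-down : ∀ a q d → (∀ n → d ≤ n → coef (lin a ⊛ q) (suc n) ≈ 0#) → ∀ n → d ≤ n → coef q n ≈ 0#
  lin-down a q d h n = go (length q) n (m≤n+m (length q) n)
    where
      go : ∀ m n → length q ≤ n ℕ.+ m → d ≤ n → coef q n ≈ 0#
      go zero    n l d≤n = coef-length q n (≡.subst (length q ≤_) (ℕₚ.+-identityʳ n) l)
      go (suc m) n l d≤n = begin
        coef q n
          ≈⟨ solve 2 (λ x y → y := x :- (x :- y)) refl (a * coef q (suc n)) (coef q n) ⟩
        a * coef q (suc n) - (a * coef q (suc n) - coef q n)
          ≈⟨ +-cong (*-congˡ (go m (suc n) (≡.subst (length q ≤_) (ℕₚ.+-suc n m) l) (ℕₚ.m≤n⇒m≤1+n d≤n)))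
                    (-‿cong (trans (sym (coef-lin a q n)) (h n d≤n))) ⟩
        a * 0# - 0#   ≈⟨ trans (+-congʳ (zeroʳ a)) (-‿inverseʳ 0#) ⟩
        0# ∎

  lin-cancel0 : ∀ a q → lin a ⊛ q ≋ [] → q ≋ []
  lin-cancel0 a q e = mk≋ λ n → lin-down a q 0 (λ n _ → at e (suc n)) n z≤n

  lin^-cancel0 : ∀ a m q → lin a ^ₚ m ⊛ q ≋ [] → q ≋ []
  lin^-cancel0 a zero    q e = PR.trans (PR.sym (PR.*-identityˡ q)) e
  lin^-cancel0 a (suc m) q e = lin^-cancel0 a m q (lin-cancel0 a _ (PR.trans (PR.sym (PR.*-assoc (lin a) (lin a ^ₚ m) q)) e))

  private
    diff0 : ∀ {p q} → p PR.- q ≋ [] → p ≋ q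
    diff0 {p} {q} e = PR.trans (PS.solve 2 (λ p q → p PS.:= (p PS.:- q) PS.:+ q) PR.refl p q) (PR.+-congʳ {q} e)

  lin^-cancel : ∀ a m p q → lin a ^ₚ m ⊛ p ≋ lin a ^ₚ m ⊛ q → p ≋ q
  lin^-cancel a m p q e = diff0 (lin^-cancel0 a m (p PR.- q)
    (PR.trans (PS.solve 3 (λ l p q → l PS.:* (p PS.:- q) PS.:= l PS.:* p PS.:- l PS.:* q) PR.refl (lin a ^ₚ m) p q)
      (PR.trans (PR.+-congʳ {PR.- (lin a ^ₚ m ⊛ q)} e) (PR.-‿inverseʳ (lin a ^ₚ m ⊛ q)))))

  zero? : ∀ p → Dec (p ≋ [])
  zero? []      = yes PR.refl
  zero? (c ∷ p) with c ≟ 0# | zero? p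
  ... | no ¬c | _     = no λ e → ¬c (at e 0)
  ... | _     | no ¬p = no λ e → ¬p (mk≋ λ n → at e (suc n))
  ... | yes z | yes e = yes (mk≋ λ { zero → z ; (suc n) → at e n })

  lin^-deg : ∀ a m {d} q → ¬ q ≋ [] → Deg≤ d (lin a ^ₚ m ⊛ q) → m ≤ d × Deg≤ (d ℕ.∸ m) q
  lin^-deg a zero    q nz h = z≤n , Deg≤-cong (PR.*-identityˡ q) h
  lin^-deg a (suc m) {zero}  q nz h = ⊥-elim (nz (lin^-cancel0 a m q (mk≋ λ n → lin-down a (lin a ^ₚ m ⊛ q) 0
    (λ n _ → Deg≤-cong (PR.*-assoc (lin a) (lin a ^ₚ m) q) h (suc n) (s≤s z≤n)) n z≤n)))
  lin^-deg a (suc m) {suc d} q nz h =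
    let p , r = lin^-deg a m {d} q nz (lin-down a (lin a ^ₚ m ⊛ q) (suc d)
          (λ n l → Deg≤-cong (PR.*-assoc (lin a) (lin a ^ₚ m) q) h (suc n) (s≤s l)))
    in s≤s p , r

  private
    coprime-root : ∀ {a b} → ¬ a ≈ b → ∀ p → lin b ∣ᵣ lin a ⊛ p → p ⟨ b ⟩ ≈ 0#
    coprime-root {a} {b} a≉b p d = [ (λ z → ⊥-elim (a≉b (trans (solve 2 (λ a b → a := (a :- b) :+ b) refl a b) (trans (+-congʳ z) (+-identityˡ b))))) , id ]′
      (integral (a - b) (p ⟨ b ⟩) (trans (sym (trans (RingHom.*-homo (evalAt b) (lin a) p) (*-congʳ (lin-eval a b)))) (∣⇒root (lin a ⊛ p) b d)))

    lin-shift : ∀ a m u → lin a ^ₚ 1 ⊛ (lin a ^ₚ m ⊛ u) ≋ lin a ^ₚ suc m ⊛ u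
    lin-shift a m u = PR.trans (PR.*-congʳ {lin a ^ₚ m ⊛ u} (PR.*-identityʳ (lin a))) (PR.sym (PR.*-assoc (lin a) (lin a ^ₚ m) u))

    swap : ∀ u v w → u ⊛ (v ⊛ w) ≋ v ⊛ (u ⊛ w)
    swap u v w = PS.solve 3 (λ a b p → a PS.:* (b PS.:* p) PS.:= b PS.:* (a PS.:* p)) PR.refl u v w

  -- Evaluation at b: there `lin a` is a - b, not zero, so `p` has the root b, and one factor
  -- `lin b` can be cancelled on both sides.
  lin-coprime : ∀ {a b} → ¬ a ≈ b → ∀ m p → lin b ^ₚ m ∣ᵣ lin a ⊛ p → lin b ^ₚ m ∣ᵣ p
  lin-coprime         a≉b zero    p _ = p , PR.sym (PR.*-identityˡ p)
  lin-coprime {a} {b} a≉b (suc m) p (k , e) =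
    let e₁ : lin a ⊛ p ≋ lin b ⊛ (lin b ^ₚ m ⊛ k)
        e₁ = PR.trans e (PR.*-assoc (lin b) (lin b ^ₚ m) k)
        p′ , pe = root⇒∣ p b (coprime-root a≉b p (lin b ^ₚ m ⊛ k , e₁))
        e₂ : lin b ⊛ (lin a ⊛ p′) ≋ lin b ⊛ (lin b ^ₚ m ⊛ k)
        e₂ = PR.trans (swap (lin b) (lin a) p′) (PR.trans (PR.*-congˡ {lin a} (PR.sym pe)) e₁)
        u = PR.*-identityʳ (lin b)
        k′ , e′ = lin-coprime a≉b m p′ (k , lin^-cancel b 1 (lin a ⊛ p′) (lin b ^ₚ m ⊛ k)
          (PR.trans (PR.*-congʳ {lin a ⊛ p′} u) (PR.trans e₂ (PR.*-congʳ {lin b ^ₚ m ⊛ k} (PR.sym u)))))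
    in k′ , PR.trans pe (PR.trans (PR.*-congˡ {lin b} e′) (PR.sym (PR.*-assoc (lin b) (lin b ^ₚ m) k′)))

  lin^-coprime : ∀ {a b} → ¬ a ≈ b → ∀ l m p → lin b ^ₚ m ∣ᵣ lin a ^ₚ l ⊛ p → lin b ^ₚ m ∣ᵣ p
  lin^-coprime a≉b zero    m p h = PT.∣ᵣ-resp (PR.*-identityˡ p) h
  lin^-coprime {a} a≉b (suc l) m p h = lin^-coprime a≉b l m p
    (lin-coprime a≉b m _ (PT.∣ᵣ-resp (PR.*-assoc (lin a) (lin a ^ₚ l) p) h))

  -- A factor `lin a ^ₚ m` is split off; the powers for the other points still divide the cofactor,
  -- because distinct linear forms are coprime.
  root-count : ∀ m (as : List A) → AllPairs (λ a b → ¬ a ≈ b) as → ∀ {d} p → ¬ p ≋ [] → Deg≤ d p →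
    All (λ a → lin a ^ₚ m ∣ᵣ p) as → length as ℕ.* m ≤ d
  root-count m []       _         p nz h []              = z≤n
  root-count m (a ∷ as) (ne ∷ nes) {d} p nz h ((p′ , e) ∷ ds) =
    ≡.subst (m ℕ.+ length as ℕ.* m ≤_) (m+[n∸m]≡n m≤d) (+-monoʳ-≤ m
      (root-count m as nes p′ nz′ h′ (All.zipWith (λ {b} (n , dv) → lin^-coprime n m m p′ (PT.∣ᵣ-resp e dv)) (ne , ds))))
    where
      nz′ : ¬ p′ ≋ []
      nz′ z = nz (PR.trans e (PR.trans (PR.*-congˡ {lin a ^ₚ m} z) (PR.zeroʳ (lin a ^ₚ m))))
      both = lin^-deg a m p′ nz′ (Deg≤-cong e h)
      m≤d = proj₁ both
      h′ = proj₂ both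

  -- The order of vanishing at y, kept as a relation because the zero polynomial has none.
  record Val (y : A) (o : ℕ) (p : Pol) : Set where
    constructor mkVal
    field
      cofactor   : Pol
      factorises : p ≋ lin y ^ₚ o ⊛ cofactor
      nonvanishing : ¬ cofactor ⟨ y ⟩ ≈ 0#

  val : ∀ y p → ¬ p ≋ [] → ∃ λ o → Val y o p
  val y p = go (length p) p (λ n l → coef-length p n (<⇒≤ l))
    where
      go : ∀ d p → Deg≤ d p → ¬ p ≋ [] → ∃ λ o → Val y o p
      go d p h nz with (p ⟨ y ⟩) ≟ 0#
      ... | no ¬z = 0 , mkVal p (PR.sym (PR.*-identityˡ p)) ¬z
      ... | yes z with root⇒∣ p y z
      ... | q , e with lin^-deg y 1 q (λ qz → nz (PR.trans e (PR.trans (PR.*-congˡ {lin y} qz) (PR.zeroʳ (lin y)))))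
                         (Deg≤-cong (PR.trans e (PR.*-congʳ {q} (PR.sym (PR.*-identityʳ (lin y))))) h)
      go (suc d) p h nz | yes z | q , e | s≤s _ , h′ with go d q h′ (λ qz → nz (PR.trans e (PR.trans (PR.*-congˡ {lin y} qz) (PR.zeroʳ (lin y)))))
      ... | o , mkVal u e′ nu = suc o , mkVal u (PR.trans e (PR.trans (PR.*-congˡ {lin y} e′) (PR.sym (PR.*-assoc (lin y) (lin y ^ₚ o) u)))) nu

  val-resp : ∀ {y o p q} → p ≋ q → Val y o p → Val y o q
  val-resp e (mkVal u eq n) = mkVal u (PR.trans (PR.sym e) eq) n

  val-∣ : ∀ {y o p} → Val y o p → lin y ^ₚ o ∣ᵣ p
  val-∣ (mkVal u e _) = u , e

  val-≥ : ∀ {y} o o′ {p} → Val y o p → lin y ^ₚ o′ ∣ᵣ p → o′ ≤ o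
  val-≥ o       zero     v d = z≤n
  val-≥ {y} zero (suc o′) {p} (mkVal u e n) (k , e′) = ⊥-elim (n (trans
    (RingHom.cong (evalAt y) (PR.trans (PR.sym (PR.*-identityˡ u)) (PR.sym e)))
    (∣⇒root p y (lin y ^ₚ o′ ⊛ k , PR.trans e′ (PR.*-assoc (lin y) (lin y ^ₚ o′) k)))))
  val-≥ {y} (suc o) (suc o′) {p} (mkVal u e n) (k , e′) = s≤s (val-≥ o o′ {lin y ^ₚ o ⊛ u} (mkVal u PR.refl n)
    (k , lin^-cancel y 1 (lin y ^ₚ o ⊛ u) (lin y ^ₚ o′ ⊛ k)
      (PR.trans (lin-shift y o u) (PR.trans (PR.trans (PR.sym e) e′) (PR.sym (lin-shift y o′ k))))))

  val-unique : ∀ {y o o′ p} → Val y o p → Val y o′ p → o ≡ o′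
  val-unique {o = o} {o′} v w = ℕₚ.≤-antisym (val-≥ o′ o w (val-∣ v)) (val-≥ o o′ v (val-∣ w))

  val-⊛ : ∀ {y o o′ p q} → Val y o p → Val y o′ q → Val y (o ℕ.+ o′) (p ⊛ q)
  val-⊛ {y} {o} {o′} {p} {q} (mkVal u e n) (mkVal v f n′) = mkVal (u ⊛ v)
    (PR.trans (PR.*-cong {p} {_} {q} e f) (PR.trans
        (PS.solve 4 (λ a u b v → (a PS.:* u) PS.:* (b PS.:* v) PS.:= (a PS.:* b) PS.:* (u PS.:* v)) PR.refl (lin y ^ₚ o) u (lin y ^ₚ o′) v)
        (PR.*-congʳ {u ⊛ v} (PR.sym (PT.^-homo-* (lin y) o o′)))))
    (λ z → [ n , n′ ]′ (integral _ _ (trans (sym (RingHom.*-homo (evalAt y) u v)) z)))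

  val-nonzero : ∀ {y o p} → Val y o p → ¬ p ≋ []
  val-nonzero {y} {o} {p} (mkVal u e n) z = n (RingHom.cong (evalAt y) (lin^-cancel0 y o u (PR.trans (PR.sym e) z)))

  val-+ : ∀ {y o} p q → Val y o p → lin y ^ₚ suc o ∣ᵣ q → Val y o (p ⊕ q)
  val-+ {y} {o} p q (mkVal u e n) (k , f) = mkVal (u ⊕ lin y ⊛ k)
    (PR.trans (PR.+-cong {p} {_} {q} e f)
        (PS.solve 4 (λ l a u k → a PS.:* u PS.:+ (l PS.:* a) PS.:* k PS.:= a PS.:* (u PS.:+ l PS.:* k)) PR.refl (lin y) (lin y ^ₚ o) u k))
    (λ z → n (trans (sym (+-identityʳ _)) (trans (+-congˡ (sym (∣⇒root (lin y ⊛ k) y (k , PR.refl))))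
        (trans (sym (RingHom.+-homo (evalAt y) u (lin y ⊛ k))) z))))

  -- Valuations at a single point suffice: they add, and only nonzero polynomials have one.
  ⊛-integral : ∀ p q → ¬ p ≋ [] → ¬ q ≋ [] → ¬ p ⊛ q ≋ []
  ⊛-integral p q np nq = val-nonzero (val-⊛ {p = p} {q} (proj₂ (val 0# p np)) (proj₂ (val 0# q nq)))

  ^ₚ-nonzero : ∀ p n → ¬ p ≋ [] → ¬ p ^ₚ n ≋ []
  ^ₚ-nonzero p zero    np e = 1≉0 (at e 0)
  ^ₚ-nonzero p (suc n) np = ⊛-integral p (p ^ₚ n) np (^ₚ-nonzero p n np)

-- Newton polygons

-- The leftmost minimum; strictness to its left is what prevents initial terms of a product from
-- cancelling.
firstMin : ∀ (f : ℕ → ℕ) k → ∃ λ i → i ≤ k × (∀ j → j ≤ k → f i ≤ f j) × (∀ j → j < i → f i < f j)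
firstMin f zero = 0 , z≤n , (λ { zero z≤n → ≤-refl }) , λ _ ()
firstMin f (suc k) with firstMin f k
... | i , i≤k , mn , st with f i ℕ.≤? f (suc k)
...   | yes le = i , ℕₚ.m≤n⇒m≤1+n i≤k , (λ j l → [ (λ { (s≤s l′) → mn j l′ }) , (λ { ≡.refl → le }) ]′ (m≤n⇒m<n∨m≡n l)) , st
...   | no ¬le = suc k , ≤-refl
        , (λ j l → [ (λ { (s≤s l′) → <⇒≤ (lt j l′) }) , (λ { ≡.refl → ≤-refl }) ]′ (m≤n⇒m<n∨m≡n l))
        , λ { j (s≤s l) → lt j l }
  where
    lt : ∀ j → j ≤ k → f (suc k) < f j
    lt j l = <-≤-trans (≰⇒> ¬le) (mn j l)

module NewtonPolygon (R : CommutativeRing 0ℓ 0ℓ)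
    (_≟_ : ∀ x y → Dec (CommutativeRing._≈_ R x y))
    (1≉0 : ¬ CommutativeRing._≈_ R (CommutativeRing.1# R) (CommutativeRing.0# R))
    (integral : ∀ x y → CommutativeRing._≈_ R (CommutativeRing._*_ R x y) (CommutativeRing.0# R) →
      CommutativeRing._≈_ R x (CommutativeRing.0# R) ⊎ CommutativeRing._≈_ R y (CommutativeRing.0# R)) where
  open CommutativeRing R hiding (zero) renaming (Carrier to A)
  open DomainPoly R _≟_ 1≉0 integral
  open PT using (_∣ᵣ_; _,_)
  private
    module T  = Poly polyRing
    module TD = Degree polyRing

  module _ (y : A) (N : ℕ) (0<N : 0 < N) (ε : ℕ) where

    private
      -- With c = (k - j) ε for the coefficient of T^j, this is, up to a constant, N times the
      -- height above a line of slope ε / N; all points of an edge of that slope weigh the same. A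
      -- zero coefficient should weigh infinity, but `suc top` is enough, since `top` is the weight
      -- of the leading coefficient.
      weight : ∀ p → Dec (p ≋ []) → ℕ → ℕ → ℕ
      weight p (yes _) top c = suc top
      weight p (no nz) top c = N ℕ.* proj₁ (val y p nz) ℕ.+ c

      weight-eq : ∀ p d top c {o} → Val y o p → weight p d top c ≡ N ℕ.* o ℕ.+ c
      weight-eq p (yes z) top c v = ⊥-elim (val-nonzero v z)
      weight-eq p (no nz) top c v = ≡.cong (λ o → N ℕ.* o ℕ.+ c) (val-unique (proj₂ (val y p nz)) v)

      weight-nz : ∀ p d top c → weight p d top c ≤ top → ¬ p ≋ []
      weight-nz p (yes _) top c l = ⊥-elim (ℕₚ.<-irrefl ≡.refl l)
      weight-nz p (no nz) top c l = nz

    -- The left end of the edge of slope ε / N, or the vertex in its place when there is no such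
    -- edge.
    record Initial (H : T.Pol) (k : ℕ) : Set where
      field
        i o w : ℕ
        i≤k   : i ≤ k
        val-i : Val y o (T.coef H i)
        w≡    : w ≡ N ℕ.* o ℕ.+ (k ℕ.∸ i) ℕ.* ε
        min   : ∀ j {p} → j ≤ k → Val y p (T.coef H j) → w ≤ N ℕ.* p ℕ.+ (k ℕ.∸ j) ℕ.* ε
        first : ∀ j {p} → j < i → Val y p (T.coef H j) → w < N ℕ.* p ℕ.+ (k ℕ.∸ j) ℕ.* ε

    initial : ∀ H k → ¬ T.coef H k ≋ [] → Initial H k
    initial H k nz = record
      { i = i ; o = proj₁ vi ; w = f i ; i≤k = i≤k ; val-i = proj₂ vi ; w≡ = fe i (proj₂ vi)
      ; min = λ j l v → ≡.subst (f i ≤_) (fe j v) (mn j l)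
      ; first = λ j l v → ≡.subst (f i <_) (fe j v) (st j l) }
      where
        vk = val y (T.coef H k) nz
        top = N ℕ.* proj₁ vk
        f : ℕ → ℕ
        f j = weight (T.coef H j) (zero? (T.coef H j)) top ((k ℕ.∸ j) ℕ.* ε)
        fe : ∀ j {p} → Val y p (T.coef H j) → f j ≡ N ℕ.* p ℕ.+ (k ℕ.∸ j) ℕ.* ε
        fe j = weight-eq (T.coef H j) (zero? (T.coef H j)) top _
        m = firstMin f k
        i = proj₁ m
        i≤k = proj₁ (proj₂ m)
        mn = proj₁ (proj₂ (proj₂ m))
        st = proj₂ (proj₂ (proj₂ m))
        fk≡ : f k ≡ top
        fk≡ = ≡.trans (fe k (proj₂ vk)) (≡.trans (≡.cong (λ x → top ℕ.+ x ℕ.* ε) (ℕₚ.n∸n≡0 k)) (ℕₚ.+-identityʳ top))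
        vi = val y (T.coef H i) (weight-nz _ (zero? (T.coef H i)) top _ (≡.subst (f i ≤_) fk≡ (mn k ≤-refl)))

    private
      ∸-+ : ∀ {a b k s} → a ≤ k → b ≤ s → (k ℕ.∸ a) ℕ.+ (s ℕ.∸ b) ≡ (k ℕ.+ s) ℕ.∸ (a ℕ.+ b)
      ∸-+ {a} {b} {k} {s} l m = ≡.sym (≡.trans (≡.cong (ℕ._∸ (a ℕ.+ b)) (≡.cong₂ ℕ._+_ (≡.sym (m+[n∸m]≡n l)) (≡.sym (m+[n∸m]≡n m))))
        (≡.trans (≡.cong (ℕ._∸ (a ℕ.+ b)) (S.solve 4 (λ a x b y → (a S.:+ x) S.:+ (b S.:+ y) S.:= (a S.:+ b) S.:+ (x S.:+ y)) ≡.refl a (k ℕ.∸ a) b (s ℕ.∸ b)))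
          (ℕₚ.m+n∸m≡n (a ℕ.+ b) _)))
        where module S = +-*-Solver

      weight-+ : ∀ {a b k s} o p → a ≤ k → b ≤ s →
        (N ℕ.* o ℕ.+ (k ℕ.∸ a) ℕ.* ε) ℕ.+ (N ℕ.* p ℕ.+ (s ℕ.∸ b) ℕ.* ε) ≡ N ℕ.* (o ℕ.+ p) ℕ.+ ((k ℕ.+ s) ℕ.∸ (a ℕ.+ b)) ℕ.* ε
      weight-+ {a} {b} {k} {s} o p l m = ≡.trans
        (S.solve 6 (λ N o x e p z → (N S.:* o S.:+ x S.:* e) S.:+ (N S.:* p S.:+ z S.:* e) S.:= N S.:* (o S.:+ p) S.:+ (x S.:+ z) S.:* e) ≡.refl N o (k ℕ.∸ a) ε p (s ℕ.∸ b))
        (≡.cong (λ x → N ℕ.* (o ℕ.+ p) ℕ.+ x ℕ.* ε) (∸-+ l m))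
        where module S = +-*-Solver

      squeeze : ∀ {a b c d} → a ≤ c → b ≤ d → c ℕ.+ d ≡ a ℕ.+ b → c ≡ a
      squeeze {a} {b} {c} {d} l m e with m≤n⇒m<n∨m≡n l
      ... | inj₂ eq = ≡.sym eq
      ... | inj₁ lt = ⊥-elim (<⇒≢ (ℕₚ.+-mono-<-≤ lt m) (≡.sym e))

    module _ {k s} {H Q : T.Pol} (degH : TD.Deg≤ k H) (degQ : TD.Deg≤ s Q)
             (IH : Initial H k) (IQ : Initial Q s) where
      private
        module H = Initial IH
        module Q = Initial IQ

        o = H.o ℕ.+ Q.o

        -- In any other pair with the same index sum, one index lies to the left of the initial one
        -- and so has strictly greater weight. The contributions of ε agree on both sides and
        -- cancel.
        heavier : ∀ a b → a ℕ.+ b ≡ H.i ℕ.+ Q.i → a ≢ H.i → a ≤ k → b ≤ s → ∀ {u v} →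
          Val y u (T.coef H a) → Val y v (T.coef Q b) → suc o ≤ u ℕ.+ v
        heavier a b e n a≤k b≤s {u} {v} va vb = ℕₚ.*-cancelˡ-< N _ _ (ℕₚ.+-cancelʳ-< c _ _ lt)
          where
            c = ((k ℕ.+ s) ℕ.∸ (a ℕ.+ b)) ℕ.* ε
            wt : H.w ℕ.+ Q.w < (N ℕ.* u ℕ.+ (k ℕ.∸ a) ℕ.* ε) ℕ.+ (N ℕ.* v ℕ.+ (s ℕ.∸ b) ℕ.* ε)
            wt with ℕₚ.<-cmp a H.i
            ... | tri< l _ _ = ℕₚ.+-mono-<-≤ (H.first a l va) (Q.min b b≤s vb)
            ... | tri≈ _ q _ = ⊥-elim (n q)
            ... | tri> _ _ g = ℕₚ.+-mono-≤-< (H.min a a≤k va) (Q.first b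
                    (ℕₚ.+-cancelˡ-< H.i _ _ (≡.subst (H.i ℕ.+ b <_) e (ℕₚ.+-monoˡ-< b g))) vb)
            lt : N ℕ.* o ℕ.+ c < N ℕ.* (u ℕ.+ v) ℕ.+ c
            lt = ≡.subst₂ _<_
              (≡.trans (≡.cong₂ ℕ._+_ H.w≡ Q.w≡) (≡.trans (weight-+ H.o Q.o H.i≤k Q.i≤k) (≡.cong (λ x → N ℕ.* o ℕ.+ ((k ℕ.+ s) ℕ.∸ x) ℕ.* ε) (≡.sym e))))
              (weight-+ u v a≤k b≤s) wt

        zero-∣ˡ : ∀ {l} p q → p ≋ [] → l ∣ᵣ p ⊛ q
        zero-∣ˡ p q z = PT.∣ᵣ-resp (PR.sym (PR.*-congʳ {q} z)) PT.∣ᵣ-0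

        zero-∣ʳ : ∀ {l} p q → q ≋ [] → l ∣ᵣ p ⊛ q
        zero-∣ʳ p q z = PT.∣ᵣ-resp (PR.sym (PR.trans (PR.*-congˡ {p} z) (PR.zeroʳ p))) PT.∣ᵣ-0

        others : ∀ a b → a ℕ.+ b ≡ H.i ℕ.+ Q.i → a ≢ H.i → lin y ^ₚ suc o ∣ᵣ T.coef H a ⊛ T.coef Q b
        others a b e n with a ℕ.≤? k | b ℕ.≤? s
        ... | no ¬l | _ = zero-∣ˡ _ (T.coef Q b) (degH a (≰⇒> ¬l))
        ... | yes _ | no ¬l = zero-∣ʳ (T.coef H a) _ (degQ b (≰⇒> ¬l))
        ... | yes l | yes m = both (zero? (T.coef H a)) (zero? (T.coef Q b))
          where
            both : Dec (T.coef H a ≋ []) → Dec (T.coef Q b ≋ []) → lin y ^ₚ suc o ∣ᵣ T.coef H a ⊛ T.coef Q b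
            both (yes z) _ = zero-∣ˡ _ (T.coef Q b) z
            both _ (yes z) = zero-∣ʳ (T.coef H a) _ z
            both (no za) (no zb) =
              let u , va = val y _ za
                  v , vb = val y _ zb
              in PT.∣ᵣ-trans (PT.∣ᵣ-^-≤ (lin y) (heavier a b e n l m va vb))
                   (val-∣ (val-⊛ {p = T.coef H a} {T.coef Q b} va vb))

      -- All other summands of this coefficient vanish to higher order at y, so the product of the
      -- two initial terms survives.
      val-initial : Val y o (T.coef (H T.⊛ Q) (H.i ℕ.+ Q.i))
      val-initial =
        let e , de , eq = TD.conv-isolate (lin y ^ₚ suc o ∣ᵣ_) PT.∣ᵣ-resp PT.∣ᵣ-0 PT.∣ᵣ-+ (T.coef H) (T.coef Q) H.i Q.i others
        in val-resp (PR.sym (PR.trans (T.coef-conv H Q _) eq))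
             (val-+ (T.coef H H.i ⊛ T.coef Q Q.i) e (val-⊛ {p = T.coef H H.i} {T.coef Q Q.i} H.val-i Q.val-i) de)

    -- Both ends of H ⊛ Q lie on the same edge of the Newton polygon, of slope ε / N,
    -- hence so do both ends of H; the edge of H has integral height k ε / N.
    newton : ∀ {k s} (H Q : T.Pol) → TD.Deg≤ k H → TD.Deg≤ s Q → k ℕ.+ s ≡ N →
      (∀ n → n ≢ 0 → n ≢ N → T.coef (H T.⊛ Q) n ≋ []) → ∀ {o} →
      Val y o (T.coef (H T.⊛ Q) 0) → Val y (o ℕ.+ ε) (T.coef (H T.⊛ Q) N) → N ∣ k ℕ.* ε
    newton {k} {s} H Q degH degQ ks mid {o} v0 vN =
      ∣m+n∣m⇒∣n (≡.subst (N ∣_) (≡.trans (≡.sym (ℕₚ.+-identityʳ _)) (≡.trans Hk (≡.sym H0))) (m∣m*n (proj₁ vhk))) (m∣m*n (proj₁ vh0))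
      where
        c0 : T.coef (H T.⊛ Q) 0 ≋ T.coef H 0 ⊛ T.coef Q 0
        c0 = T.coef-conv H Q 0
        cN : T.coef (H T.⊛ Q) N ≋ T.coef H k ⊛ T.coef Q s
        cN = ≡.subst (λ x → T.coef (H T.⊛ Q) x ≋ T.coef H k ⊛ T.coef Q s) ks (TD.coef-top H Q degH degQ)
        nzˡ : ∀ {o p q u} → Val y o u → u ≋ p ⊛ q → ¬ p ≋ []
        nzˡ {p = p} {q} v e z = val-nonzero v (PR.trans e (PR.*-congʳ {q} z))
        nzʳ : ∀ {o p q u} → Val y o u → u ≋ p ⊛ q → ¬ q ≋ []
        nzʳ {p = p} {q} v e z = val-nonzero v (PR.trans e (PR.trans (PR.*-congˡ {p} z) (PR.zeroʳ p)))
        vh0 = val y (T.coef H 0) (nzˡ v0 c0)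
        vq0 = val y (T.coef Q 0) (nzʳ {p = T.coef H 0} v0 c0)
        vhk = val y (T.coef H k) (nzˡ vN cN)
        vqs = val y (T.coef Q s) (nzʳ {p = T.coef H k} vN cN)
        IH = initial H k (nzˡ vN cN)
        IQ = initial Q s (nzʳ {p = T.coef H k} vN cN)
        module I = Initial IH
        module J = Initial IQ
        total = N ℕ.* (o ℕ.+ ε)
        vn = val-initial degH degQ IH IQ

        -- Only the exponents 0 and N carry nonzero coefficients, and these two have equal weight.
        at-edge : ∀ n {p} → Val y p (T.coef (H T.⊛ Q) n) → N ℕ.* p ℕ.+ (N ℕ.∸ n) ℕ.* ε ≡ total
        at-edge n {p} v with n ℕ.≟ 0 | n ℕ.≟ N
        ... | yes ≡.refl | _ = ≡.trans (≡.cong (λ x → N ℕ.* x ℕ.+ N ℕ.* ε) (val-unique v v0)) (≡.sym (ℕₚ.*-distribˡ-+ N o ε))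
        ... | no _ | yes ≡.refl = ≡.trans (≡.cong₂ (λ x z → N ℕ.* x ℕ.+ z ℕ.* ε) (val-unique v vN) (ℕₚ.n∸n≡0 N)) (ℕₚ.+-identityʳ _)
        ... | no n0 | no nN = ⊥-elim (val-nonzero v (mid n n0 nN))

        -- The coefficient found by `val-initial` is nonzero, hence on the edge, and its weight is
        -- the sum of the two minima.
        sum-min : I.w ℕ.+ J.w ≡ total
        sum-min = ≡.trans (≡.cong₂ ℕ._+_ I.w≡ J.w≡) (≡.trans (weight-+ I.o J.o I.i≤k J.i≤k)
          (≡.trans (≡.cong (λ x → N ℕ.* (I.o ℕ.+ J.o) ℕ.+ (x ℕ.∸ (I.i ℕ.+ J.i)) ℕ.* ε) ks) (at-edge _ vn)))

        -- The constant terms of `H` and `Q` weigh at least the two minima and together exactly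
        -- their sum, so each is minimal. `Hk` is the same argument at the leading terms; the
        -- difference of the two equations is N | k ε.
        H0 : N ℕ.* proj₁ vh0 ℕ.+ k ℕ.* ε ≡ I.w
        H0 = squeeze (I.min 0 z≤n (proj₂ vh0)) (J.min 0 z≤n (proj₂ vq0))
          (≡.trans (weight-+ {0} {0} {k} {s} (proj₁ vh0) (proj₁ vq0) z≤n z≤n)
            (≡.trans (≡.cong (λ x → N ℕ.* (proj₁ vh0 ℕ.+ proj₁ vq0) ℕ.+ x ℕ.* ε) ks)
              (≡.trans (at-edge 0 (val-resp (PR.sym c0) (val-⊛ {p = T.coef H 0} {T.coef Q 0} (proj₂ vh0) (proj₂ vq0)))) (≡.sym sum-min))))

        Hk : N ℕ.* proj₁ vhk ℕ.+ 0 ≡ I.w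
        Hk = ≡.trans (≡.cong (λ x → N ℕ.* proj₁ vhk ℕ.+ x ℕ.* ε) (≡.sym (ℕₚ.n∸n≡0 k)))
          (squeeze (I.min k ≤-refl (proj₂ vhk)) (J.min s ≤-refl (proj₂ vqs))
          (≡.trans (weight-+ {k} {s} {k} {s} (proj₁ vhk) (proj₁ vqs) ≤-refl ≤-refl)
            (≡.trans (≡.cong (λ x → N ℕ.* (proj₁ vhk ℕ.+ proj₁ vqs) ℕ.+ (x ℕ.∸ x) ℕ.* ε) ks)
              (≡.trans (at-edge N (val-resp (PR.sym cN) (val-⊛ {p = T.coef H k} {T.coef Q s} (proj₂ vhk) (proj₂ vqs)))) (≡.sym sum-min)))))

open ≡ using (refl; sym; trans; cong; cong₂; subst; subst₂)

-- Finite fields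

module _ {A : Set} where

  unique-↭ : ∀ {xs ys : List A} → Unique xs → Unique ys → (∀ {z} → z ∈ xs → z ∈ ys) → (∀ {z} → z ∈ ys → z ∈ xs) → xs ↭ ys
  unique-↭ u v f g = ∼bag⇒↭ (unique∧set⇒bag u v (mk⇔ f g))

  ∑ : List A → (A → ℕ) → ℕ
  ∑ []       f = 0
  ∑ (x ∷ xs) f = f x ℕ.+ ∑ xs f

  ∑-cong : ∀ xs {f g : A → ℕ} → (∀ x → x ∈ xs → f x ≡ g x) → ∑ xs f ≡ ∑ xs g
  ∑-cong []       h = refl
  ∑-cong (x ∷ xs) h = cong₂ ℕ._+_ (h x (here refl)) (∑-cong xs (λ y → h y ∘ there))

  ∑-mono : ∀ xs {f g : A → ℕ} → (∀ x → x ∈ xs → f x ≤ g x) → ∑ xs f ≤ ∑ xs g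
  ∑-mono []       h = z≤n
  ∑-mono (x ∷ xs) h = +-mono-≤ (h x (here refl)) (∑-mono xs (λ y → h y ∘ there))

  ∑-const : ∀ xs c → ∑ xs (λ _ → c) ≡ length xs ℕ.* c
  ∑-const []       c = refl
  ∑-const (x ∷ xs) c = cong (c ℕ.+_) (∑-const xs c)

  private
    interchange : ∀ a b c d → (a ℕ.+ b) ℕ.+ (c ℕ.+ d) ≡ (a ℕ.+ c) ℕ.+ (b ℕ.+ d)
    interchange = S.solve 4 (λ a b c d → (a S.:+ b) S.:+ (c S.:+ d) S.:= (a S.:+ c) S.:+ (b S.:+ d)) refl
      where module S = +-*-Solver

  ∑-+ : ∀ xs (f g : A → ℕ) → ∑ xs (λ x → f x ℕ.+ g x) ≡ ∑ xs f ℕ.+ ∑ xs g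
  ∑-+ []       f g = refl
  ∑-+ (x ∷ xs) f g = trans (cong (f x ℕ.+ g x ℕ.+_) (∑-+ xs f g)) (interchange (f x) (g x) (∑ xs f) (∑ xs g))

  ∑-*ˡ : ∀ xs c (f : A → ℕ) → ∑ xs (λ x → c ℕ.* f x) ≡ c ℕ.* ∑ xs f
  ∑-*ˡ []       c f = sym (ℕₚ.*-zeroʳ c)
  ∑-*ˡ (x ∷ xs) c f = trans (cong (c ℕ.* f x ℕ.+_) (∑-*ˡ xs c f)) (sym (ℕₚ.*-distribˡ-+ c (f x) _))

  ∑-↭ : ∀ {xs ys} (f : A → ℕ) → xs ↭ ys → ∑ xs f ≡ ∑ ys f
  ∑-↭ f Perm.refl        = refl
  ∑-↭ f (Perm.prep x p)  = cong (f x ℕ.+_) (∑-↭ f p)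
  ∑-↭ f (Perm.swap x y p) = trans (cong (λ s → f x ℕ.+ (f y ℕ.+ s)) (∑-↭ f p))
    (S.solve 3 (λ a b c → a S.:+ (b S.:+ c) S.:= b S.:+ (a S.:+ c)) refl (f x) (f y) _)
    where module S = +-*-Solver
  ∑-↭ f (Perm.trans p q) = trans (∑-↭ f p) (∑-↭ f q)

∑-map : ∀ {A B : Set} (g : A → B) xs f → ∑ (map g xs) f ≡ ∑ xs (f ∘ g)
∑-map g []       f = refl
∑-map g (x ∷ xs) f = cong (f (g x) ℕ.+_) (∑-map g xs f)

∑-swap : ∀ {A B : Set} xs ys (f : A → B → ℕ) → ∑ xs (λ x → ∑ ys (f x)) ≡ ∑ ys (λ y → ∑ xs (λ x → f x y))
∑-swap []       ys f = sym (trans (∑-const ys 0) (ℕₚ.*-zeroʳ (length ys)))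
∑-swap (x ∷ xs) ys f = trans (cong (∑ ys (f x) ℕ.+_) (∑-swap xs ys f)) (sym (∑-+ ys (f x) _))

module Fibres {A : Set} {n : ℕ} (χ : A → Fin n) where

  fibre : List A → Fin n → List A
  fibre xs t = filter (λ x → χ x Fin.≟ t) xs

  private
    extend : ∀ (ψ : Fin n → ℕ) x xs t → length (fibre (x ∷ xs) t) ℕ.* ψ t ≡ length (fibre (x ∷ []) t) ℕ.* ψ t ℕ.+ length (fibre xs t) ℕ.* ψ t
    extend ψ x xs t with χ x Fin.≟ t
    ... | yes _ = cong (ℕ._+ length (fibre xs t) ℕ.* ψ t) (sym (ℕₚ.+-identityʳ (ψ t)))
    ... | no _  = refl

    absent : ∀ (ψ : Fin n → ℕ) x ts → χ x ∉ ts → ∑ ts (λ t → length (fibre (x ∷ []) t) ℕ.* ψ t) ≡ 0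
    absent ψ x []       h = refl
    absent ψ x (t ∷ ts) h with χ x Fin.≟ t
    ... | yes e = ⊥-elim (h (here e))
    ... | no _  = absent ψ x ts (h ∘ there)

    single : ∀ (ψ : Fin n → ℕ) x ts → Unique ts → χ x ∈ ts → ∑ ts (λ t → length (fibre (x ∷ []) t) ℕ.* ψ t) ≡ ψ (χ x)
    single ψ x (t ∷ ts) (u ∷ us) m with χ x Fin.≟ t
    single ψ x (t ∷ ts) (u ∷ us) m | yes refl = trans (cong₂ ℕ._+_ (ℕₚ.+-identityʳ (ψ t)) (absent ψ x ts (λ k → All.lookup u k refl))) (ℕₚ.+-identityʳ (ψ t))
    single ψ x (t ∷ ts) (u ∷ us) (here e)  | no ne = ⊥-elim (ne e)
    single ψ x (t ∷ ts) (u ∷ us) (there k) | no ne = single ψ x ts us k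

  ∑-fibres : ∀ (ψ : Fin n → ℕ) xs ts → Unique ts → (∀ x → x ∈ xs → χ x ∈ ts) →
    ∑ xs (ψ ∘ χ) ≡ ∑ ts (λ t → length (fibre xs t) ℕ.* ψ t)
  ∑-fibres ψ []       ts u h = sym (trans (∑-const ts 0) (ℕₚ.*-zeroʳ (length ts)))
  ∑-fibres ψ (x ∷ xs) ts u h = trans
    (cong₂ ℕ._+_ (sym (single ψ x ts u (h x (here refl)))) (∑-fibres ψ xs ts u (λ y → h y ∘ there)))
    (trans (sym (∑-+ ts _ _)) (∑-cong ts (λ t _ → sym (extend ψ x xs t))))

module Field {q : ℕ} (F : FiniteField q) where
  open FiniteField F using (isCommutativeRing; 0≢1; inverse; pow) public

  𝔽 : CommutativeRing 0ℓ 0ℓ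
  𝔽 = record { isCommutativeRing = isCommutativeRing }

  open CommutativeRing 𝔽 using (_+_; _*_; -_; _-_; 0#; 1#; *-comm; *-assoc; *-identityˡ; *-identityʳ; zeroˡ; zeroʳ; +-identityˡ; +-identityʳ; -‿inverseʳ) public
  open RingTools 𝔽 using (_^_; ^-homo-*; ^-assocʳ; ^-distrib-*) public
  open Solver 𝔽 using (solve; _:=_; _:+_; _:*_; _:-_; :-_)

  infix 4 _≟_
  _≟_ : ∀ (x y : Fin q) → Dec (x ≡ y)
  _≟_ = Fin._≟_

  1≢0 : ¬ 1# ≡ 0#
  1≢0 = 0≢1 ∘ sym

  pow≡^ : ∀ x n → pow x n ≡ x ^ n
  pow≡^ x zero    = refl
  pow≡^ x (suc n) = cong (x *_) (pow≡^ x n)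

  *-cancelˡ : ∀ {x y z} → ¬ x ≡ 0# → x * y ≡ x * z → y ≡ z
  *-cancelˡ {x} {y} {z} nz e with i , xi ← inverse x nz = begin
    y           ≡⟨ undo y ⟨
    i * (x * y) ≡⟨ cong (i *_) e ⟩
    i * (x * z) ≡⟨ undo z ⟩
    z           ∎
    where
      open ≡.≡-Reasoning
      undo : ∀ w → i * (x * w) ≡ w
      undo w = trans (sym (*-assoc i x w)) (trans (cong (_* w) (trans (*-comm i x) xi)) (*-identityˡ w))

  integral : ∀ x y → x * y ≡ 0# → x ≡ 0# ⊎ y ≡ 0#
  integral x y e with x ≟ 0#
  ... | yes z = inj₁ z
  ... | no nz = inj₂ (*-cancelˡ nz (trans e (sym (zeroʳ x))))

  *-nonzero : ∀ {x y} → ¬ x ≡ 0# → ¬ y ≡ 0# → ¬ x * y ≡ 0#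
  *-nonzero nx ny e = [ nx , ny ]′ (integral _ _ e)

  ^-nonzero : ∀ {x} n → ¬ x ≡ 0# → ¬ x ^ n ≡ 0#
  ^-nonzero zero    nx = 1≢0
  ^-nonzero (suc n) nx = *-nonzero nx (^-nonzero n nx)

  1^ : ∀ n → 1# ^ n ≡ 1#
  1^ zero    = refl
  1^ (suc n) = trans (*-identityˡ _) (1^ n)

  ^-root⇒nonzero : ∀ {x} n → 0 < n → x ^ n ≡ 1# → ¬ x ≡ 0#
  ^-root⇒nonzero {x} (suc n) _ e z = 0≢1 (trans (sym (zeroˡ (x ^ n))) (trans (cong (_* x ^ n) (sym z)) e))

  -- `length units` serves as q - 1 in exponents and avoids truncated subtraction.
  units : List (Fin q)
  units = filter (λ x → ¬? (x ≟ 0#)) (allFin q)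

  units-unique : Unique units
  units-unique = Uniqueₚ.filter⁺ _ (Uniqueₚ.allFin⁺ q)

  ∈-units : ∀ {x} → ¬ x ≡ 0# → x ∈ units
  ∈-units nz = ∈-filter⁺ _ (∈-allFin _) nz

  units-∈ : ∀ {x} → x ∈ units → ¬ x ≡ 0#
  units-∈ m = proj₂ (∈-filter⁻ (λ x → ¬? (x ≟ 0#)) {xs = allFin q} m)

  length-allFin : length (allFin q) ≡ q
  length-allFin = length-tabulate id

  length-units : suc (length units) ≡ q
  length-units = trans (↭-length {xs = 0# ∷ units} {allFin q} (unique-↭ (All.tabulate (λ m e → units-∈ m (sym e)) ∷ units-unique) (Uniqueₚ.allFin⁺ q)
    (λ _ → ∈-allFin _) (λ {z} _ → mem z))) length-allFin
    where
      mem : ∀ z → z ∈ 0# ∷ units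
      mem z with z ≟ 0#
      ... | yes e = here e
      ... | no ne = there (∈-units ne)

  product : List (Fin q) → Fin q
  product = foldr _*_ 1#

  product-↭ : ∀ {xs ys} → xs ↭ ys → product xs ≡ product ys
  product-↭ Perm.refl        = refl
  product-↭ (Perm.prep x p)  = cong (x *_) (product-↭ p)
  product-↭ (Perm.swap x y p) = trans (cong (λ s → x * (y * s)) (product-↭ p))
    (solve 3 (λ a b c → a :* (b :* c) := b :* (a :* c)) refl x y _)
  product-↭ (Perm.trans p r) = trans (product-↭ p) (product-↭ r)

  product-map : ∀ x us → product (map (x *_) us) ≡ x ^ length us * product us
  product-map x []       = sym (*-identityˡ 1#)
  product-map x (u ∷ us) = trans (cong (x * u *_) (product-map x us))
    (solve 4 (λ x u p r → (x :* u) :* (p :* r) := (x :* p) :* (u :* r)) refl x u _ _)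

  product-nonzero : ∀ us → (∀ {u} → u ∈ us → ¬ u ≡ 0#) → ¬ product us ≡ 0#
  product-nonzero []       h = 1≢0
  product-nonzero (u ∷ us) h = *-nonzero (h (here refl)) (product-nonzero us (h ∘ there))

  -- Multiplication by x permutes the units, so their product absorbs the factor x^(q-1).
  fermat : ∀ {x} → ¬ x ≡ 0# → x ^ length units ≡ 1#
  fermat {x} nz = *-cancelˡ (product-nonzero units units-∈) (begin
    product units * x ^ length units ≡⟨ *-comm _ _ ⟩
    x ^ length units * product units ≡⟨ product-map x units ⟨
    product (map (x *_) units)       ≡⟨ product-↭ perm ⟩
    product units                    ≡⟨ *-identityʳ _ ⟨
    product units * 1#               ∎)
    where
      open ≡.≡-Reasoning
      i = proj₁ (inverse x nz)
      xi = proj₂ (inverse x nz)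
      fwd : ∀ {z} → z ∈ map (x *_) units → z ∈ units
      fwd m with u , mu , refl ← ∈-map⁻ (x *_) m = ∈-units (*-nonzero nz (units-∈ mu))
      back : ∀ {z} → z ∈ units → z ∈ map (x *_) units
      back {z} m = subst (_∈ map (x *_) units) xiz (∈-map⁺ (x *_) (∈-units {i * z} niz))
        where
          xiz : x * (i * z) ≡ z
          xiz = trans (sym (*-assoc x i z)) (trans (cong (_* z) xi) (*-identityˡ z))
          niz : ¬ i * z ≡ 0#
          niz e = units-∈ m (trans (sym xiz) (trans (cong (x *_) e) (zeroʳ x)))
      perm : map (x *_) units ↭ units
      perm = unique-↭ (Uniqueₚ.map⁺ (*-cancelˡ nz) units-unique) units-unique fwd back

  x^q≡x : ∀ x → x ^ q ≡ x
  x^q≡x x with x ≟ 0#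
  ... | no nz = trans (cong (x ^_) (sym length-units)) (trans (cong (x *_) (fermat nz)) (*-identityʳ x))
  ... | yes refl = trans (cong (0# ^_) (sym length-units)) (zeroˡ _)

  open DomainPoly 𝔽 _≟_ 1≢0 integral public

  Deg≤-var : Deg≤ 1 var
  Deg≤-var (suc (suc n)) _ = refl
  Deg≤-var (suc zero) (s≤s ())

  Deg≤-lin : ∀ a → Deg≤ 1 (lin a)
  Deg≤-lin a = Deg≤-⊕ (a ∷ []) (PR.- var) (Deg≤-const a) (Deg≤-neg var Deg≤-var)

  private
    top^ : ∀ p n → Deg≤ 1 p → coef (p ^ₚ n) (n ℕ.* 1) ≡ coef p 1 ^ n
    top^ p zero    h = refl
    top^ p (suc n) h = trans (coef-top p (p ^ₚ n) h (Deg≤-^ p n h)) (cong (coef p 1 *_) (top^ p n h))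

  -- Both sides agree at the q points of the field and have the same leading coefficient.
  lin^q : ∀ a → lin a ^ₚ q ≋ (a ∷ []) PR.- var ^ₚ q
  lin^q a = PR.trans (PS.solve 2 (λ u v → u PS.:= (u PS.:- v) PS.:+ v) PR.refl (lin a ^ₚ q) b)
    (PR.+-congʳ {b} D≋0)
    where
      b = (a ∷ []) PR.- var ^ₚ q
      D = lin a ^ₚ q PR.- b
      n = length units
      q≡ : q ≡ suc n
      q≡ = sym length-units
      degq : ∀ p → Deg≤ 1 p → Deg≤ q (p ^ₚ q)
      degq p h = subst (λ x → Deg≤ x (p ^ₚ q)) (ℕₚ.*-identityʳ q) (Deg≤-^ p q h)
      topq : ∀ p → Deg≤ 1 p → coef (p ^ₚ q) q ≡ coef p 1
      topq p h = trans (cong (coef (p ^ₚ q)) (sym (ℕₚ.*-identityʳ q))) (trans (top^ p q h) (x^q≡x _))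
      degb : Deg≤ q b
      degb = Deg≤-⊕ (a ∷ []) (PR.- (var ^ₚ q)) (Deg≤-const a) (Deg≤-neg (var ^ₚ q) (degq var Deg≤-var))
      const-top : ∀ {m} → q ≡ suc m → coef (a ∷ []) q ≡ 0#
      const-top e = cong (coef (a ∷ [])) e
      topD : coef D q ≡ 0#
      topD = begin
        coef D q
          ≡⟨ trans (coef-⊕ (lin a ^ₚ q) (PR.- b) q) (cong₂ _+_ (topq (lin a) (Deg≤-lin a)) (coef-neg b q)) ⟩
        - 1# + - coef b q
          ≡⟨ cong (λ x → - 1# + - x) (trans (coef-⊕ (a ∷ []) (PR.- (var ^ₚ q)) q)
               (cong₂ _+_ (const-top q≡) (trans (coef-neg (var ^ₚ q) q) (cong -_ (topq var Deg≤-var))))) ⟩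
        - 1# + - (0# + - 1#)
          ≡⟨ trans (cong (λ x → - 1# + - x) (+-identityˡ _)) (-‿inverseʳ _) ⟩
        0# ∎
        where open ≡.≡-Reasoning
      degD : Deg≤ n D
      degD m l with m≤n⇒m<n∨m≡n l
      ... | inj₁ lt = Deg≤-⊕ (lin a ^ₚ q) (PR.- b) (degq (lin a) (Deg≤-lin a)) (Deg≤-neg b degb) m (subst (_< m) length-units lt)
      ... | inj₂ refl = trans (cong (coef D) length-units) topD
      root : ∀ x → D ⟨ x ⟩ ≡ 0#
      root x = begin
        D ⟨ x ⟩ ≡⟨ trans (+-homo (lin a ^ₚ q) (PR.- b)) (cong₂ _+_ (^-homo (lin a) q) (neg-homo b)) ⟩
        lin a ⟨ x ⟩ ^ q - b ⟨ x ⟩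
          ≡⟨ cong₂ _-_ (trans (x^q≡x _) (lin-eval a x))
               (trans (+-homo (a ∷ []) (PR.- (var ^ₚ q))) (cong₂ _+_ (Eval.ev-const (idHom 𝔽) x a)
                 (trans (neg-homo (var ^ₚ q)) (cong -_ (trans (^-homo var q) (trans (x^q≡x _) (Eval.ev-var (idHom 𝔽) x))))))) ⟩
        (a - x) - (a - x) ≡⟨ -‿inverseʳ _ ⟩
        0# ∎
        where open ≡.≡-Reasoning
              open RingHom (evalAt x) hiding (cong)
              open HomTools (evalAt x)
      D≋0 : D ≋ []
      D≋0 with zero? D
      ... | yes z = z
      ... | no nz = ⊥-elim (ℕₚ.<-irrefl refl (subst (_≤ n) (trans (ℕₚ.*-identityʳ _) (trans length-allFin q≡))
        (root-count 1 (allFin q) (Uniqueₚ.allFin⁺ q) D nz degD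
          (All.tabulate λ {x} _ → PT.∣ᵣ-resp PR.refl (proj x (root⇒∣ D x (root x)))))))
        where
          proj : ∀ x → lin x PT.∣ᵣ D → lin x ^ₚ 1 PT.∣ᵣ D
          proj x (k PT., e) = k PT., PR.trans e (PR.*-congʳ {k} (PR.sym (PR.*-identityʳ (lin x))))

  roots-of-unity-count : ∀ d → 0 < d → ∀ xs → Unique xs → (∀ {x} → x ∈ xs → x ^ d ≡ 1#) → length xs ≤ d
  roots-of-unity-count d@(suc _) 0<d xs u h = subst (_≤ d) (ℕₚ.*-identityʳ _)
    (root-count 1 xs u D nz deg (All.tabulate λ {x} m → proj x (root⇒∣ D x (root x (h m)))))
    where
      D = var ^ₚ d PR.- (1# ∷ [])
      deg : Deg≤ d D
      deg = Deg≤-⊕ (var ^ₚ d) (PR.- (1# ∷ [])) (subst (λ x → Deg≤ x (var ^ₚ d)) (ℕₚ.*-identityʳ d) (Deg≤-^ var d Deg≤-var))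
        (Deg≤-neg (1# ∷ []) (Deg≤-const 1#))
      nz : ¬ D ≋ []
      nz e = 1≢0 (trans (sym top) (at e d))
        where
          top : coef D d ≡ 1#
          top = trans (coef-⊕ (var ^ₚ d) (PR.- (1# ∷ [])) d) (trans (+-identityʳ _)
            (trans (cong (coef (var ^ₚ d)) (sym (ℕₚ.*-identityʳ d))) (trans (top^ var d Deg≤-var) (1^ d))))
      root : ∀ x → x ^ d ≡ 1# → D ⟨ x ⟩ ≡ 0#
      root x e = trans (+-homo (var ^ₚ d) (PR.- (1# ∷ []))) (trans
        (cong₂ _+_ (trans (^-homo var d) (trans (cong (_^ d) (Eval.ev-var (idHom 𝔽) x)) e))
          (trans (neg-homo (1# ∷ [])) (cong -_ (Eval.ev-const (idHom 𝔽) x 1#)))) (-‿inverseʳ 1#))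
        where open RingHom (evalAt x) hiding (cong)
              open HomTools (evalAt x)
      proj : ∀ x → lin x PT.∣ᵣ D → lin x ^ₚ 1 PT.∣ᵣ D
      proj x (k PT., e) = k PT., PR.trans e (PR.*-congʳ {k} (PR.sym (PR.*-identityʳ (lin x))))

-- Independence of the powers of f^((q-1)/N)

module Irreducibility {q : ℕ} (F : FiniteField q) where
  open Field F
  module T  = Poly polyRing
  module TD = Degree polyRing
  module TR = CommutativeRing T.polyRing
  module TT = RingTools T.polyRing
  open PT using (_∣ᵣ_; _,_; Mod; mkMod)
  open Coefficientwise (degFiltration 𝔽) using (CD; CD-weak; CD-⊕; CD-neg; CD-const; CD-mono; pseudoDivision)
  open NewtonPolygon 𝔽 _≟_ 1≢0 integral using (newton)

  κ : Fin q → Pol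
  κ c = c ∷ []

  Points : Set
  Points = List (Fin q × ℕ)

  gpoly : Points → Pol
  gpoly []             = κ 1#
  gpoly ((y , ε) ∷ gs) = lin y ^ₚ ε ⊛ gpoly gs

  gval : Points → Fin q → Fin q
  gval []             a = 1#
  gval ((y , ε) ∷ gs) a = (y - a) ^ ε * gval gs a

  size : Points → ℕ
  size gs = ∑ gs proj₂

  gpoly-eval : ∀ gs a → gpoly gs ⟨ a ⟩ ≡ gval gs a
  gpoly-eval []             a = RingHom.1-homo (evalAt a)
  gpoly-eval ((y , ε) ∷ gs) a = trans (RingHom.*-homo (evalAt a) (lin y ^ₚ ε) (gpoly gs))
    (cong₂ _*_ (trans (HomTools.^-homo (evalAt a) (lin y) ε) (cong (_^ ε) (lin-eval y a))) (gpoly-eval gs a))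

  Deg≤-gpoly : ∀ gs → Deg≤ (size gs) (gpoly gs)
  Deg≤-gpoly []             = Deg≤-const 1#
  Deg≤-gpoly ((y , ε) ∷ gs) = Deg≤-⊛ (lin y ^ₚ ε) (gpoly gs)
    (subst (λ x → Deg≤ x (lin y ^ₚ ε)) (ℕₚ.*-identityʳ ε) (Deg≤-^ (lin y) ε (Deg≤-lin y))) (Deg≤-gpoly gs)

  y-a≢0 : ∀ {y a} → ¬ y ≡ a → ¬ y - a ≡ 0#
  y-a≢0 {y} {a} n e = n (trans (solve 2 (λ y a → y := (y :- a) :+ a) refl y a) (trans (cong (_+ a) e) (+-identityˡ a)))
    where open Solver 𝔽

  gval-nonzero : ∀ gs a → All (λ p → ¬ proj₁ p ≡ a) gs → ¬ gval gs a ≡ 0#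
  gval-nonzero []             a []       = 1≢0
  gval-nonzero ((y , ε) ∷ gs) a (n ∷ ns) = *-nonzero (^-nonzero ε (y-a≢0 n)) (gval-nonzero gs a ns)

  Distinct : Points → Set
  Distinct = AllPairs (λ p r → ¬ proj₁ p ≡ proj₁ r)

  val-gpoly : ∀ {gs y ε} → Distinct gs → (y , ε) ∈ gs → Val y ε (gpoly gs)
  val-gpoly {(y , ε) ∷ gs} (n ∷ _) (here refl) = mkVal (gpoly gs) PR.refl
    (λ z → gval-nonzero gs y (All.map (λ f e → f (sym e)) n) (trans (sym (gpoly-eval gs y)) z))
  val-gpoly {(y′ , ε′) ∷ gs} {y} (n ∷ ds) (there m) = val-⊛ {p = lin y′ ^ₚ ε′} {gpoly gs}
    (mkVal (lin y′ ^ₚ ε′) (PR.sym (PR.*-identityˡ _)) (λ z → ^-nonzero ε′ (y-a≢0 (All.lookup n m))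
      (trans (sym (trans (HomTools.^-homo (evalAt y) (lin y′) ε′) (cong (_^ ε′) (lin-eval y′ y)))) z)))
    (val-gpoly ds m)

  -- By `lin^q` both (y - x)^q and (a - x)^q are a constant minus x^q; they differ by y - a.
  lin^q-mod : ∀ y a → Mod (lin a ^ₚ q) (lin y ^ₚ q) (κ (y - a))
  lin^q-mod y a = mkMod (κ 1# , PR.trans (PR.+-cong {lin y ^ₚ q} (lin^q y) (PR.-‿cong (PR.trans (RingHom.+-homo (constHom 𝔽) y (- a))
      (PR.+-congˡ {κ y} (RingHom.neg-homo (constHom 𝔽) a)))))
    (PR.trans (PS.solve 3 (λ y v a → (y PS.:- v) PS.:- (y PS.:+ (PS.:- a)) PS.:= a PS.:- v) PR.refl (κ y) (var ^ₚ q) (κ a))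
      (PR.trans (PR.sym (lin^q a)) (PR.sym (PR.*-identityʳ (lin a ^ₚ q))))))

  gpoly^q-mod : ∀ gs a → Mod (lin a ^ₚ q) (gpoly gs ^ₚ q) (κ (gval gs a))
  gpoly^q-mod []             a = PT.mod-refl (PR.trans (PR.sym (HomTools.^-homo (constHom 𝔽) 1# q)) (RingHom.cong (constHom 𝔽) (1^ q)))
  gpoly^q-mod ((y , ε) ∷ gs) a = PT.mod-trans (PT.mod-refl e₁)
    (PT.mod-trans (PT.mod-* (PT.mod-^ ε (lin^q-mod y a)) (gpoly^q-mod gs a)) (PT.mod-refl e₂))
    where
      e₁ : (lin y ^ₚ ε ⊛ gpoly gs) ^ₚ q ≋ (lin y ^ₚ q) ^ₚ ε ⊛ gpoly gs ^ₚ q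
      e₁ = PR.trans (PT.^-distrib-* (lin y ^ₚ ε) (gpoly gs) q) (PR.*-congʳ {gpoly gs ^ₚ q}
        (PR.trans (PT.^-assocʳ (lin y) ε q) (PR.trans (PT.^-congʳ (lin y) (ℕₚ.*-comm ε q)) (PR.sym (PT.^-assocʳ (lin y) q ε)))))
      e₂ : κ (y - a) ^ₚ ε ⊛ κ (gval gs a) ≋ κ ((y - a) ^ ε * gval gs a)
      e₂ = PR.sym (PR.trans (RingHom.*-homo (constHom 𝔽) ((y - a) ^ ε) (gval gs a))
        (PR.*-congʳ {κ (gval gs a)} (HomTools.^-homo (constHom 𝔽) (y - a) ε)))

  -- `prim` expresses that N and the exponents have no common divisor, in the form in which it is
  -- applied. The base point `a₀` avoids the zeros of g, so that `g₀` is a nonzero constant and has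
  -- valuation 0 everywhere.
  module Kummer (N c : ℕ) (0<N : 0 < N) (Nc : suc (c ℕ.* N) ≡ q)
           (gs : Points) (distinct : Distinct gs)
           (prim : ∀ k → (∀ {y ε} → (y , ε) ∈ gs → N ∣ k ℕ.* ε) → N ∣ k)
           (a₀ : Fin q) (a₀∉ : All (λ p → ¬ proj₁ p ≡ a₀) gs) where

    g Y X : Pol
    g = gpoly gs
    Y = g ^ₚ c
    X = lin a₀ ^ₚ q

    m : ℕ
    m = size gs

    g₀ : Fin q
    g₀ = gval gs a₀

    open Eval (idHom polyRing) Y using () renaming (ev to evY) public
    open RingHom (Eval.evHom (idHom polyRing) Y) using () renaming (cong to evY-cong; +-homo to evY-+; *-homo to evY-*; neg-homo to evY-neg)

    -- Y = g^((q-1)/N) is a root of g Tᴺ - g₀ modulo X = (a₀ - x)^q, because g^q ≡ g(a₀).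
    kummer : T.Pol
    kummer = TD.mono g N T.⊕ (PR.- κ g₀ ∷ [])

    evY-mono : ∀ a s → evY (TD.mono a s) ≋ Y ^ₚ s ⊛ a
    evY-mono a zero    = PR.trans (Eval.ev-const (idHom polyRing) Y a) (PR.sym (PR.*-identityˡ a))
    evY-mono a (suc s) = PR.trans (PR.*-congˡ {Y} (evY-mono a s)) (PR.sym (PR.*-assoc Y (Y ^ₚ s) a))

    X∣kummer : X ∣ᵣ evY kummer
    X∣kummer = PT.∣ᵣ-resp (PR.sym (PR.trans (evY-+ (TD.mono g N) (PR.- κ g₀ ∷ []))
      (PR.+-cong {evY (TD.mono g N)} (PR.trans (evY-mono g N) (PR.trans (PR.*-comm (Y ^ₚ N) g)
        (PR.trans (PR.*-congˡ {g} (PT.^-assocʳ g c N)) (PT.^-congʳ g Nc))))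
        (Eval.ev-const (idHom polyRing) Y (PR.- κ g₀))))) (Mod.difference (gpoly^q-mod gs a₀))

    coef-kummer-0 : T.coef kummer 0 ≋ PR.- κ g₀
    coef-kummer-0 = PR.trans (T.coef-⊕ (TD.mono g N) (PR.- κ g₀ ∷ []) 0)
      (PR.+-congʳ {PR.- κ g₀} (TD.coef-mono-≢ g N 0 (<⇒≢ 0<N)))

    private
      lower : ∀ n → n ≢ 0 → T.coef (PR.- κ g₀ ∷ []) n ≋ []
      lower zero    h = ⊥-elim (h refl)
      lower (suc n) h = PR.refl

      N≢0 : N ≢ 0
      N≢0 e = <⇒≢ 0<N (sym e)

    coef-kummer-N : T.coef kummer N ≋ g
    coef-kummer-N = PR.trans (T.coef-⊕ (TD.mono g N) (PR.- κ g₀ ∷ []) N)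
      (PR.trans (PR.+-cong {T.coef (TD.mono g N) N} (TD.coef-mono g N) (lower N N≢0)) (PR.+-identityʳ g))

    coef-kummer-mid : ∀ n → n ≢ 0 → n ≢ N → T.coef kummer n ≋ []
    coef-kummer-mid n n0 nN = PR.trans (T.coef-⊕ (TD.mono g N) (PR.- κ g₀ ∷ []) n)
      (PR.+-cong {T.coef (TD.mono g N) n} (TD.coef-mono-≢ g N n nN) (lower n n0))

    Deg≤-kummer : TD.Deg≤ N kummer
    Deg≤-kummer n l = coef-kummer-mid n (λ { refl → ℕₚ.n≮0 l }) (<⇒≢ l ∘ sym)

    CD-kummer : CD m kummer
    CD-kummer = CD-⊕ (TD.mono g N) (PR.- κ g₀ ∷ []) (CD-mono g N (Deg≤-gpoly gs))
      (CD-const (PR.- κ g₀) (Deg≤-neg (κ g₀) (Deg≤-const g₀)))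

    -- The degree in x reached after k pseudo-divisions, each of which takes d to at most N d + m.
    -- While it stays below q, the degree of `X`, a constant in T that is divisible by `X` must
    -- vanish.
    lim : ℕ → ℕ → ℕ
    lim zero    d = d
    lim (suc k) d = lim k (N ℕ.* d ℕ.+ m)

    lim-mono : ∀ k {d e} → d ≤ e → lim k d ≤ lim k e
    lim-mono zero    l = l
    lim-mono (suc k) l = lim-mono k (+-monoˡ-≤ m (*-monoʳ-≤ N l))

    private
      d≤Nd : ∀ d → d ≤ N ℕ.* d
      d≤Nd d = subst (_≤ N ℕ.* d) (ℕₚ.*-identityˡ d) (*-monoˡ-≤ d 0<N)

      val-κ : ∀ {y o p} c → ¬ c ≡ 0# → Val y o p → Val y o (p ⊛ κ c)
      val-κ {y} {o} {p} c nz v = subst (λ o → Val y o (p ⊛ κ c)) (ℕₚ.+-identityʳ o) (val-⊛ {p = p} {κ c} v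
        (mkVal (κ c) (PR.sym (PR.*-identityˡ (κ c))) (λ z → nz (trans (sym (Eval.ev-const (idHom 𝔽) y c)) z))))

      -g₀≢0 : ¬ - g₀ ≡ 0#
      -g₀≢0 e = gval-nonzero gs a₀ a₀∉ (trans (sym (-‿involutive g₀)) (trans (cong -_ e) -0#≈0#))
        where open RingProps (CommutativeRing.ring 𝔽)

      dvd-rest : ∀ H Q S p → X ∣ᵣ evY H → X ∣ᵣ evY p → p T.≋ H T.⊛ Q T.⊕ S → X ∣ᵣ evY S
      dvd-rest H Q S p dH dp e = PT.∣ᵣ-resp
        (PR.trans (PR.+-congʳ {PR.- (evY Q ⊛ evY H)} (PR.trans (evY-cong e) (PR.trans (evY-+ (H T.⊛ Q) S) (PR.+-congʳ {evY S} (evY-* H Q)))))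
          (PS.solve 3 (λ h q s → (h PS.:* q PS.:+ s) PS.:- q PS.:* h PS.:= s) PR.refl (evY H) (evY Q) (evY S)))
        (PT.∣ᵣ-+ dp (PT.∣ᵣ-neg (PT.∣ᵣ-*ˡ (evY Q) dH)))

      -- With remainder zero, `H` is a factor of degree `suc k` of `kummer` up to a power of its
      -- leading coefficient. The Newton polygons give N | (suc k) ε at every zero, hence N | suc k,
      -- which is too small.
      absurd : ∀ k s H Q → suc k < N → suc k ℕ.+ s ≡ N → ¬ T.coef H (suc k) ≋ [] → TD.Deg≤ (suc k) H → TD.Deg≤ s Q →
        (T.coef H (suc k) ∷ []) TT.^ suc s T.⊛ kummer T.≋ H T.⊛ Q → ⊥
      absurd k s H Q k<N ks nz dH dQ e = <⇒≱ k<N (∣⇒≤ (prim (suc k) edge))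
        where
          h = T.coef H (suc k)
          hs = h ^ₚ suc s
          coefs : ∀ n → T.coef (H T.⊛ Q) n ≋ hs ⊛ T.coef kummer n
          coefs n = PR.trans (PR.sym (T.at e n)) (TD.coef-const^⊛ h kummer n (suc s))
          -- The factor `hs` shifts all valuations equally; the constant coefficient of `kummer` is
          -- a nonzero scalar, and the leading one, `g`, has order ε at y.
          edge : ∀ {y ε} → (y , ε) ∈ gs → N ∣ suc k ℕ.* ε
          edge {y} {ε} mem = newton y N 0<N ε H Q dH dQ ks
            (λ n n0 nN → PR.trans (coefs n) (PR.trans (PR.*-congˡ {hs} (coef-kummer-mid n n0 nN)) (PR.zeroʳ hs)))
            (val-resp (PR.sym (PR.trans (coefs 0) (PR.*-congˡ {hs} (PR.trans coef-kummer-0 (PR.sym (RingHom.neg-homo (constHom 𝔽) g₀))))))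
              (val-κ (- g₀) -g₀≢0 (proj₂ vh)))
            (val-resp (PR.sym (PR.trans (coefs N) (PR.*-congˡ {hs} coef-kummer-N)))
              (val-⊛ {p = hs} {g} (proj₂ vh) (val-gpoly distinct mem)))
            where vh = val y hs (^ₚ-nonzero h (suc s) nz)

    -- Euclid's algorithm against `kummer`: `X` divides H(Y) and kummer(Y), hence S(Y) for the
    -- remainder `S`, which has lower degree in T and vanishes by induction; but then `H` divides
    -- `kummer` in the sense excluded by `absurd`.
    irreducible : ∀ k d → k < N → lim k d < q → ∀ H → TD.Deg≤ k H → CD d H → X ∣ᵣ evY H → H T.≋ []
    irreducible zero d k<N lt H dH cH (u , e) = decide (zero? h)
      where
        h = T.coef H 0
        H≋h : H T.≋ (h ∷ [])
        H≋h = T.mk≋ λ { zero → PR.refl ; (suc n) → dH (suc n) (s≤s z≤n) }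
        evh : h ≋ X ⊛ u
        evh = PR.trans (PR.sym (PR.trans (evY-cong H≋h) (Eval.ev-const (idHom polyRing) Y h))) e
        decide : Dec (h ≋ []) → H T.≋ []
        decide (yes z) = TR.trans H≋h (T.mk≋ λ { zero → z ; (suc n) → PR.refl })
        decide (no nz) = ⊥-elim (<⇒≱ lt (proj₁ (lin^-deg a₀ q {d} u
          (λ z → nz (PR.trans evh (PR.trans (PR.*-congˡ {X} z) (PR.zeroʳ X)))) (Deg≤-cong evh (cH 0)))))
    irreducible (suc k) d k<N lt H dH cH div = decide (zero? (T.coef H (suc k)))
      where
        s = N ℕ.∸ suc k
        ks : suc k ℕ.+ s ≡ N
        ks = m+[n∸m]≡n (<⇒≤ k<N)
        decide : Dec (T.coef H (suc k) ≋ []) → H T.≋ []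
        decide (yes z) = irreducible k d (<-trans (n<1+n k) k<N)
          (≤-<-trans (lim-mono k (≤-trans (d≤Nd d) (m≤m+n _ m))) lt) H
          (λ n l → [ dH n , (λ { refl → z }) ]′ (m≤n⇒m<n∨m≡n l)) cH div
        decide (no nz) = ⊥-elim (absurd k s H Q k<N ks nz dH dQ (TR.trans eq (TR.trans (TR.+-congˡ {H T.⊛ Q} S≋0) (TR.+-identityʳ (H T.⊛ Q)))))
          where
            pd = pseudoDivision k H dH cH s kummer (subst (λ x → TD.Deg≤ x kummer) (sym ks) Deg≤-kummer) CD-kummer
            Q = proj₁ pd
            S = proj₁ (proj₂ pd)
            eq = proj₁ (proj₂ (proj₂ pd))
            dQ = proj₁ (proj₂ (proj₂ (proj₂ pd)))
            dS = proj₁ (proj₂ (proj₂ (proj₂ (proj₂ pd))))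
            cS = proj₂ (proj₂ (proj₂ (proj₂ (proj₂ pd))))
            hs = (T.coef H (suc k) ∷ []) TT.^ suc s
            S≋0 : S T.≋ []
            S≋0 = irreducible k (N ℕ.* d ℕ.+ m) (<-trans (n<1+n k) k<N) lt S dS
              (CD-weak S (+-monoˡ-≤ m (*-monoˡ-≤ d (subst (suc s ≤_) ks (s≤s (m≤n+m s k))))) cS)
              (dvd-rest H Q S (hs T.⊛ kummer) div (PT.∣ᵣ-resp (PR.sym (evY-* hs kummer)) (PT.∣ᵣ-*ˡ (evY hs) X∣kummer)) eq)

    open Eval (Eval.evHom (idHom polyRing) Y) X using () renaming (ev to evX) public

    -- Digits in base `X`: modulo `X` only the first `H` remains, so it is zero, and one factor `X`
    -- can be cancelled from the rest.
    independent : ∀ k d → k < N → lim k d < q → ∀ Hs → All (λ H → TD.Deg≤ k H × CD d H) Hs → evX Hs ≋ [] → All (T._≋ []) Hs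
    independent k d k<N lt []       []               e = []
    independent k d k<N lt (H ∷ Hs) ((dH , cH) ∷ ds) e = H≋0 ∷ independent k d k<N lt Hs ds
      (lin^-cancel0 a₀ q (evX Hs) (PR.trans (PR.sym (PR.+-congʳ {X ⊛ evX Hs} (evY-cong H≋0))) e))
      where
        H≋0 : H T.≋ []
        H≋0 = irreducible k d k<N lt H dH cH (PR.- evX Hs ,
          PR.trans (PS.solve 3 (λ h x t → h PS.:= (h PS.:+ x PS.:* t) PS.:+ x PS.:* (PS.:- t)) PR.refl (evY H) X (evX Hs))
            (PR.+-congʳ {X ⊛ (PR.- evX Hs)} e))

-- Homogeneous linear systems over a finite field

module Kernel {q : ℕ} (F : FiniteField q) where
  open Field F
  open RingSum 𝔽

  1<q : 1 < q
  1<q = lemma length-units (∈-units 1≢0)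
    where
      lemma : ∀ {us : List (Fin q)} {u} → suc (length us) ≡ q → u ∈ us → 1 < q
      lemma {_ ∷ us} e _ = subst (1 <_) e (s≤s (s≤s z≤n))

  private
    sum-diff : ∀ n (f g : Fin n → Fin q) → sum (λ i → f i - g i) ≡ sum f - sum g
    sum-diff zero    f g = sym (-‿inverseʳ 0#)
    sum-diff (suc n) f g = trans (cong (f Fin.zero - g Fin.zero +_) (sum-diff n (f ∘ Fin.suc) (g ∘ Fin.suc)))
      (solve 4 (λ a b c d → (a :- b) :+ (c :- d) := (a :+ c) :- (b :+ d)) refl _ _ _ _)
      where open Solver 𝔽

  -- Pigeonhole in place of elimination: of the q^n vectors two have the same image among q^k, and
  -- their difference is a solution.
  kernel : ∀ {n k} → k < n → (A : Fin n → Fin k → Fin q) →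
    ∃ λ u → (∃ λ i → ¬ u i ≡ 0#) × (∀ j → sum (λ i → u i * A i j) ≡ 0#)
  kernel {n} {k} k<n A = u , nonzero , solves
    where
      image : Fin (q ℕ.^ n) → Fin k → Fin q
      image x j = sum (λ i → Fin.finToFun x i * A i j)
      ph = Finₚ.pigeonhole (ℕₚ.^-monoʳ-< q 1<q k<n) (λ x → Fin.funToFin (image x))
      x = proj₁ ph
      y = proj₁ (proj₂ ph)
      x≢y : x ≢ y
      x≢y = Finₚ.<⇒≢ (proj₁ (proj₂ (proj₂ ph)))
      image≡ : ∀ j → image x j ≡ image y j
      image≡ j = trans (sym (Finₚ.finToFun-funToFin (image x) j))
        (trans (cong (λ z → Fin.finToFun z j) (proj₂ (proj₂ (proj₂ ph)))) (Finₚ.finToFun-funToFin (image y) j))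
      v w u : Fin n → Fin q
      v = Fin.finToFun x
      w = Fin.finToFun y
      u i = v i - w i
      v≢w : ¬ (∀ i → v i ≡ w i)
      v≢w e = x≢y (trans (sym (Finₚ.funToFin-finToFin {n} {q} x)) (trans (funToFin-cong e) (Finₚ.funToFin-finToFin {n} {q} y)))
        where
          funToFin-cong : ∀ {n} {f g : Fin n → Fin q} → (∀ i → f i ≡ g i) → Fin.funToFin f ≡ Fin.funToFin g
          funToFin-cong {zero}  h = refl
          funToFin-cong {suc n} h = cong₂ Fin.combine (h Fin.zero) (funToFin-cong (h ∘ Fin.suc))
      nonzero : ∃ λ i → ¬ u i ≡ 0#
      nonzero with i , ne ← Finₚ.¬∀⟶∃¬ n (λ i → v i ≡ w i) (λ i → v i ≟ w i) v≢w = i , Irreducibility.y-a≢0 F ne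
      solves : ∀ j → sum (λ i → u i * A i j) ≡ 0#
      solves j = trans (sum-cong n _ (λ i → v i * A i j - w i * A i j) (λ i → solve 3 (λ a b c → (a :- b) :* c := a :* c :- b :* c) refl (v i) (w i) (A i j)))
        (trans (sum-diff n _ _) (trans (cong (_- image y j) (image≡ j)) (-‿inverseʳ _)))
        where open Solver 𝔽

-- Stepanov's method

module Stepanov {q : ℕ} (F : FiniteField q) where
  open Field F
  open Irreducibility F
  open PT using (_∣ᵣ_; _,_; Mod; mkMod)
  open Coefficientwise (degFiltration 𝔽) using (CD; CD-weak; CD-⊕; CD-⊛; CD-neg; CD-const; CD-[])
  private
    module FS  = RingSum 𝔽
    module PSm = RingSum polyRing
    module TSm = RingSum T.polyRing
    module κh  = RingHom (constHom 𝔽)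

  -- T.Pol is used here for polynomials in z over F[w]; the substitution w = a,
  -- z = x - a turns an expansion at a point a, with a as an indeterminate, into F[x].
  ι : Fin q → T.Pol
  ι c = κ c ∷ []

  W Z : T.Pol
  W = var ∷ []
  Z = [] ∷ κ 1# ∷ []

  -- At v = w this becomes f(a), at v = w + z it becomes f(x).
  generic : Points → T.Pol → T.Pol
  generic []             v = TR.1#
  generic ((y , ε) ∷ gs) v = (ι y TR.- v) TT.^ ε T.⊛ generic gs v

  module θ (a : Fin q) where
    module E = Eval (constHom 𝔽 ∘ʰ evalAt a) (var PR.- κ a)
    hom : RingHom T.polyRing polyRing
    hom = E.evHom
    open RingHom hom public hiding (cong)
    open HomTools hom public

    θ-ι : ∀ c → fun (ι c) ≋ κ c
    θ-ι c = PR.trans (E.ev-const (κ c)) (κh.cong (Eval.ev-const (idHom 𝔽) a c))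

    θ-W : fun W ≋ κ a
    θ-W = PR.trans (E.ev-const var) (κh.cong (Eval.ev-var (idHom 𝔽) a))

    θ-WZ : fun (W T.⊕ Z) ≋ var
    θ-WZ = PR.trans (+-homo W Z) (PR.trans (PR.+-cong {fun W} θ-W E.ev-var)
      (PS.solve 2 (λ a x → a PS.:+ (x PS.:- a) PS.:= x) PR.refl (κ a) var))

    private
      θ-diff : ∀ y v → fun (ι y TR.- v) ≋ κ y PR.- fun v
      θ-diff y v = PR.trans (+-homo (ι y) (TR.- v)) (PR.+-cong {fun (ι y)} (θ-ι y) (neg-homo v))

    θ-generic-WZ : ∀ gs → fun (generic gs (W T.⊕ Z)) ≋ gpoly gs
    θ-generic-WZ []             = 1-homo
    θ-generic-WZ ((y , ε) ∷ gs) = PR.trans (*-homo ((ι y TR.- (W T.⊕ Z)) TT.^ ε) (generic gs (W T.⊕ Z)))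
      (PR.*-cong {fun ((ι y TR.- (W T.⊕ Z)) TT.^ ε)} (PR.trans (^-homo (ι y TR.- (W T.⊕ Z)) ε)
        (PT.^-congˡ ε (PR.trans (θ-diff y (W T.⊕ Z)) (PR.+-congˡ {κ y} (PR.-‿cong θ-WZ))))) (θ-generic-WZ gs))

    θ-generic-W : ∀ gs → fun (generic gs W) ≋ κ (gval gs a)
    θ-generic-W []             = 1-homo
    θ-generic-W ((y , ε) ∷ gs) = PR.trans (*-homo ((ι y TR.- W) TT.^ ε) (generic gs W))
      (PR.trans (PR.*-cong {fun ((ι y TR.- W) TT.^ ε)} (PR.trans (^-homo (ι y TR.- W) ε)
        (PR.trans (PT.^-congˡ ε (PR.trans (θ-diff y W) (PR.trans (PR.+-congˡ {κ y} (PR.trans (PR.-‿cong θ-W) (PR.sym (κh.neg-homo a)))) (PR.sym (κh.+-homo y (- a))))))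
          (PR.sym (HomTools.^-homo (constHom 𝔽) (y - a) ε)))) (θ-generic-W gs))
        (PR.sym (κh.*-homo ((y - a) ^ ε) (gval gs a))))

    θ-low : ∀ n p → (∀ k → k < n → T.coef p k ≋ []) → lin a ^ₚ n ∣ᵣ fun p
    θ-low n p h = PT.∣ᵣ-trans (PT.∣ᵣ-^ n (PR.- κ 1# ,
      PR.trans (PS.solve 2 (λ x a → x PS.:- a PS.:= PS.:- (a PS.:- x)) PR.refl var (κ a))
        (PR.trans (PR.-‿cong (PR.sym (PR.*-identityʳ (lin a)))) (RingProps.-‿distribʳ-* PR.ring (lin a) (κ 1#)))))
      (EvalSum.ev-low (constHom 𝔽 ∘ʰ evalAt a) (var PR.- κ a) n p h)

  CD-^ : ∀ {d} p n → CD d p → CD (n ℕ.* d) (p TT.^ n)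
  CD-^ p zero    h = CD-const (κ 1#) (Deg≤-const 1#)
  CD-^ p (suc n) h = CD-⊛ p (p TT.^ n) h (CD-^ p n h)

  CD-· : ∀ n → CD 0 (n TT.· TR.1#)
  CD-· zero    = CD-[]
  CD-· (suc n) = CD-⊕ TR.1# (n TT.· TR.1#) (CD-const (κ 1#) (Deg≤-const 1#)) (CD-· n)

  CD-ι : ∀ {d} c → CD d (ι c)
  CD-ι c = CD-const (κ c) (Deg≤-const c)

  CD-W : CD 1 W
  CD-W = CD-const var Deg≤-var

  CD-WZ : CD 1 (W T.⊕ Z)
  CD-WZ = CD-⊕ W Z CD-W λ { zero → Deg≤-[] ; (suc n) → CD-const (κ 1#) (Deg≤-const 1#) n }

  CD-generic : ∀ gs v → CD 1 v → CD (size gs) (generic gs v)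
  CD-generic []             v h = CD-ι 1#
  CD-generic ((y , ε) ∷ gs) v h = CD-⊛ ((ι y TR.- v) TT.^ ε) (generic gs v)
    (subst (λ x → CD x ((ι y TR.- v) TT.^ ε)) (ℕₚ.*-identityʳ ε) (CD-^ (ι y TR.- v) ε (CD-⊕ (ι y) (TR.- v) (CD-ι y) (CD-neg v h))))
    (CD-generic gs v h)

  -- The bound does not involve n. It is applied with n = c i, which may be of the order of q; a
  -- bound that grew with n would give more conditions than there are unknowns.
  CD-trunc : ∀ {d} γ δ m n → CD d γ → CD d δ → CD (m ℕ.* d) (TT.trunc γ δ m n)
  CD-trunc γ δ zero    n hγ hδ = CD-ι 1#
  CD-trunc γ δ (suc m) n hγ hδ = CD-⊕ (γ T.⊛ TT.trunc γ δ m n) ((n C suc m) TT.· TR.1# T.⊛ δ TT.^ suc m)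
    (CD-⊛ γ (TT.trunc γ δ m n) hγ (CD-trunc γ δ m n hγ hδ))
    (CD-⊛ ((n C suc m) TT.· TR.1#) (δ TT.^ suc m) (CD-· (n C suc m)) (CD-^ δ (suc m) hδ))

  module Auxiliary (N c : ℕ) (0<N : 0 < N) (Nc : suc (c ℕ.* N) ≡ q)
           (gs : Points) (distinct : Distinct gs)
           (prim : ∀ k → (∀ {y ε} → (y , ε) ∈ gs → N ∣ k ℕ.* ε) → N ∣ k)
           (a₀ : Fin q) (a₀∉ : All (λ p → ¬ proj₁ p ≡ a₀) gs)
           (J B M′ : ℕ) (t : Fin q) where
    open Kummer N c 0<N Nc gs distinct prim a₀ a₀∉

    -- `M′` is the order of truncation. `L` bounds the degree in w of every expansion: B comes from
    -- the power of x, J from the power of `X`, and `M′ ℕ.* m` from the truncated power of g.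
    M L : ℕ
    M = suc M′
    L = B ℕ.+ (J ℕ.+ M′ ℕ.* m)

    Index : Set
    Index = Fin (J ℕ.* (N ℕ.* B))

    jᵢ : Index → Fin J
    jᵢ s = proj₁ (Fin.remQuot {J} (N ℕ.* B) s)

    iᵢ : Index → Fin N
    iᵢ s = proj₁ (Fin.remQuot {N} B (proj₂ (Fin.remQuot {J} (N ℕ.* B) s)))

    bᵢ : Index → Fin B
    bᵢ s = proj₂ (Fin.remQuot {N} B (proj₂ (Fin.remQuot {J} (N ℕ.* B) s)))

    index : Fin J → Fin N → Fin B → Index
    index j i b = Fin.combine j (Fin.combine i b)

    monomial : Index → Pol
    monomial s = X ^ₚ Fin.toℕ (jᵢ s) ⊛ (Y ^ₚ Fin.toℕ (iᵢ s) ⊛ var ^ₚ Fin.toℕ (bᵢ s))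

    γ δ : T.Pol
    γ = generic gs W
    δ = generic gs (W T.⊕ Z) TR.- γ

    -- What the monomial X^j Y^i x^b, times g(a)^M′, looks like near a point a = w with g(a)^c = t:
    -- X^j becomes (a₀ - a)^j, the factor g(a)^(c i) of the truncated power becomes t^i, and x is w
    -- + z.
    expansion : Index → T.Pol
    expansion s = (ι a₀ TR.- W) TT.^ Fin.toℕ (jᵢ s) T.⊛
      ((ι (t ^ Fin.toℕ (iᵢ s)) T.⊛ TT.trunc γ δ M′ (c ℕ.* Fin.toℕ (iᵢ s))) T.⊛ (W T.⊕ Z) TT.^ Fin.toℕ (bᵢ s))

    CD-expansion : ∀ s → CD L (expansion s)
    CD-expansion s = CD-weak (expansion s) le
      (CD-⊛ ((ι a₀ TR.- W) TT.^ j) _ (CD-^ (ι a₀ TR.- W) j (CD-⊕ (ι a₀) (TR.- W) (CD-ι a₀) (CD-neg W CD-W)))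
        (CD-⊛ (ι (t ^ i) T.⊛ TT.trunc γ δ M′ (c ℕ.* i)) ((W T.⊕ Z) TT.^ b)
          (CD-⊛ {0} (ι (t ^ i)) (TT.trunc γ δ M′ (c ℕ.* i)) (CD-ι (t ^ i)) (CD-trunc γ δ M′ (c ℕ.* i) CDγ
            (CD-⊕ (generic gs (W T.⊕ Z)) (TR.- γ) (CD-generic gs (W T.⊕ Z) CD-WZ) (CD-neg γ CDγ))))
          (CD-^ (W T.⊕ Z) b CD-WZ)))
      where
        j = Fin.toℕ (jᵢ s)
        i = Fin.toℕ (iᵢ s)
        b = Fin.toℕ (bᵢ s)
        CDγ = CD-generic gs W CD-W
        le : j ℕ.* 1 ℕ.+ (M′ ℕ.* m ℕ.+ b ℕ.* 1) ≤ L
        le = subst (_≤ L) (S.solve 3 (λ b j x → b S.:+ (j S.:+ x) S.:= j S.:* S.con 1 S.:+ (x S.:+ b S.:* S.con 1)) refl b j (M′ ℕ.* m))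
          (+-mono-≤ (<⇒≤ (Finₚ.toℕ<n (bᵢ s))) (+-monoˡ-≤ (M′ ℕ.* m) (<⇒≤ (Finₚ.toℕ<n (jᵢ s)))))
          where module S = +-*-Solver

    module _ (M≤q : M ≤ q) (a : Fin q) (ta : gval gs a ^ c ≡ t) where
      private
        γₐ = gval gs a
        d  = lin a ^ₚ M
        open θ a
        δₐ = g PR.- κ γₐ

        lin∣δ : lin a ∣ᵣ δₐ
        lin∣δ = root⇒∣ δₐ a (trans (RingHom.+-homo (evalAt a) g (PR.- κ γₐ)) (trans (cong₂ _+_ (gpoly-eval gs a)
          (trans (RingHom.neg-homo (evalAt a) (κ γₐ)) (cong -_ (Eval.ev-const (idHom 𝔽) a γₐ)))) (-‿inverseʳ γₐ)))

        θ-δ : fun δ ≋ δₐ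
        θ-δ = PR.trans (+-homo (generic gs (W T.⊕ Z)) (TR.- γ)) (PR.+-cong {fun (generic gs (W T.⊕ Z))} (θ-generic-WZ gs)
          (PR.trans (neg-homo γ) (PR.-‿cong (θ-generic-W gs))))

        trunc-cong : ∀ {x x′ y y′} m n → x ≋ x′ → y ≋ y′ → PT.trunc x y m n ≋ PT.trunc x′ y′ m n
        trunc-cong zero    n e f = PR.refl
        trunc-cong {x} {x′} {y} {y′} (suc m) n e f = PR.+-cong {x ⊛ PT.trunc x y m n} (PR.*-cong {x} e (trunc-cong m n e f))
          (PR.*-congˡ {(n C suc m) PT.· PR.1#} (PT.^-congˡ (suc m) f))

        -- Y^i is the (c i)-th power of γₐ + δₐ, and the error of the truncation is divisible by
        -- `δₐ ^ₚ M`, hence by (a - x)^M, since δₐ vanishes at a.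
        power : ∀ i → Mod d (κ γₐ ^ₚ M′ ⊛ Y ^ₚ i) (fun (ι (t ^ i) T.⊛ TT.trunc γ δ M′ (c ℕ.* i)))
        power i = PT.mod-trans (PT.mod-refl (PR.*-congˡ {κ γₐ ^ₚ M′} (PR.trans (PT.^-assocʳ g c i) (PT.^-congˡ (c ℕ.* i)
            (PS.solve 2 (λ x y → x PS.:= y PS.:+ (x PS.:- y)) PR.refl g (κ γₐ))))))
          (PT.mod-trans (PT.mod-weaken (PT.∣ᵣ-^ M lin∣δ) (PT.trunc-mod (κ γₐ) δₐ M′ (c ℕ.* i)))
            (PT.mod-refl (PR.sym (PR.trans (*-homo (ι (t ^ i)) (TT.trunc γ δ M′ (c ℕ.* i)))
              (PR.*-cong {fun (ι (t ^ i))} (PR.trans (θ-ι (t ^ i)) (PR.trans (κh.cong ti) (HomTools.^-homo (constHom 𝔽) γₐ (c ℕ.* i))))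
                (PR.trans (trunc-homo γ δ M′ (c ℕ.* i)) (trunc-cong M′ (c ℕ.* i) (θ-generic-W gs) θ-δ)))))))
          where
            ti : t ^ i ≡ γₐ ^ (c ℕ.* i)
            ti = trans (cong (_^ i) (sym ta)) (^-assocʳ γₐ c i)

        θ-a₀ : fun (ι a₀ TR.- W) ≋ κ (a₀ - a)
        θ-a₀ = PR.trans (+-homo (ι a₀) (TR.- W)) (PR.trans (PR.+-cong {fun (ι a₀)} (θ-ι a₀)
          (PR.trans (neg-homo W) (PR.trans (PR.-‿cong θ-W) (PR.sym (κh.neg-homo a))))) (PR.sym (κh.+-homo a₀ (- a))))

      -- The replacement of `X` by a₀ - a is valid modulo (a - x)^q; `M≤q` weakens it to the modulus
      -- used here.
      expansion-mod : ∀ s → Mod d (κ γₐ ^ₚ M′ ⊛ monomial s) (fun (expansion s))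
      expansion-mod s = PT.mod-trans
        (PT.mod-refl (PS.solve 4 (λ k x y v → k PS.:* (x PS.:* (y PS.:* v)) PS.:= x PS.:* ((k PS.:* y) PS.:* v)) PR.refl (κ γₐ ^ₚ M′) (X ^ₚ j) (Y ^ₚ i) (var ^ₚ b)))
        (PT.mod-trans (PT.mod-* (PT.mod-weaken (PT.∣ᵣ-^-≤ (lin a) M≤q) (PT.mod-^ j (lin^q-mod a₀ a)))
            (PT.mod-* (power i) (PT.mod-refl {a = var ^ₚ b} PR.refl)))
          (PT.mod-refl (PR.sym (PR.trans (*-homo ((ι a₀ TR.- W) TT.^ j) _)
            (PR.*-cong {fun ((ι a₀ TR.- W) TT.^ j)} (PR.trans (^-homo (ι a₀ TR.- W) j) (PT.^-congˡ j θ-a₀))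
              (PR.trans (*-homo tr ((W T.⊕ Z) TT.^ b))
                (PR.*-congˡ {fun tr} (PR.trans (^-homo (W T.⊕ Z) b) (PT.^-congˡ b θ-WZ)))))))))
        where
          j = Fin.toℕ (jᵢ s)
          i = Fin.toℕ (iᵢ s)
          b = Fin.toℕ (bᵢ s)
          tr = ι (t ^ i) T.⊛ TT.trunc γ δ M′ (c ℕ.* i)

    auxiliary : (Index → Fin q) → Pol
    auxiliary u = PSm.sum (λ s → κ (u s) ⊛ monomial s)

    expanded : (Index → Fin q) → T.Pol
    expanded u = TSm.sum (λ s → ι (u s) T.⊛ expansion s)

    -- One condition for each coefficient of z^k w^l with k < M and l ≤ L. The point a does not
    -- occur in them, so one system of conditions serves all points with the same t.
    equation : Index → Fin (M ℕ.* suc L) → Fin q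
    equation s e = coef (T.coef (expansion s) (Fin.toℕ (proj₁ (Fin.remQuot {M} (suc L) e)))) (Fin.toℕ (proj₂ (Fin.remQuot {M} (suc L) e)))

    expanded-low : ∀ u → (∀ e → FS.sum (λ s → u s * equation s e) ≡ 0#) → ∀ k → k < M → T.coef (expanded u) k ≋ []
    expanded-low u h k k<M = mk≋ λ l → go l (l ℕ.≤? L)
      where
        coefs : ∀ l → coef (T.coef (expanded u) k) l ≡ FS.sum (λ s → u s * coef (T.coef (expansion s) k) l)
        coefs l = trans (at (PolySum.coef-sum polyRing _ (λ s → ι (u s) T.⊛ expansion s) k) l)
          (trans (PolySum.coef-sum 𝔽 _ (λ s → T.coef (ι (u s) T.⊛ expansion s) k) l)
            (FS.sum-cong _ _ (λ s → u s * coef (T.coef (expansion s) k) l) (λ s → trans (at (TD.coef-const⊛ (κ (u s)) (expansion s) k) l) (coef-const⊛ (u s) (T.coef (expansion s) k) l))))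
        go : ∀ l → Dec (l ≤ L) → coef (T.coef (expanded u) k) l ≡ 0#
        go l (yes l≤L) = trans (coefs l) (trans (FS.sum-cong _ _ (λ s → u s * equation s e) (λ s → cong (u s *_) (sym (eq s)))) (h e))
          where
            k′ = Fin.fromℕ< k<M
            l′ = Fin.fromℕ< (s≤s l≤L)
            e = Fin.combine k′ l′
            eq : ∀ s → equation s e ≡ coef (T.coef (expansion s) k) l
            eq s = trans (cong (λ p → coef (T.coef (expansion s) (Fin.toℕ (proj₁ p))) (Fin.toℕ (proj₂ p))) (Finₚ.remQuot-combine k′ l′))
              (cong₂ (λ x y → coef (T.coef (expansion s) x) y) (Finₚ.toℕ-fromℕ< k<M) (Finₚ.toℕ-fromℕ< (s≤s l≤L)))
        go l (no l≰L) = FilterCD l (≰⇒> l≰L)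
          where
            FilterCD : Deg≤ L (T.coef (expanded u) k)
            FilterCD = TSm.sum-closed (CD L) CD-[] (λ {p} {r} → CD-⊕ p r) _ _
              (λ s → CD-⊛ {0} (ι (u s)) (expansion s) (CD-ι (u s)) (CD-expansion s)) k

    -- The factor g(a)^M′ introduced by the expansion is a unit, as g(a) is not zero, and can be
    -- removed again.
    vanishing : ∀ u → (∀ e → FS.sum (λ s → u s * equation s e) ≡ 0#) → M ≤ q → ∀ a → ¬ gval gs a ≡ 0# → gval gs a ^ c ≡ t →
      lin a ^ₚ M ∣ᵣ auxiliary u
    vanishing u h M≤q a nz ta = PT.∣ᵣ-resp
        (PR.trans (PR.sym (PR.*-assoc inv (κ γₐ ^ₚ M′) (auxiliary u))) (PR.trans (PR.*-congʳ {auxiliary u} unit) (PR.*-identityˡ (auxiliary u))))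
        (PT.∣ᵣ-*ˡ inv (PT.mod-∣ (PT.mod-trans (PT.mod-refl (PSm.*-sumˡ (κ γₐ ^ₚ M′) _ (λ s → κ (u s) ⊛ monomial s)))
          (PT.mod-trans (PSm.sum-mod _ _ (λ s → fun (ι (u s) T.⊛ expansion s)) term)
            (PT.mod-refl (PR.sym (HomSum.sum-homo hom _ (λ s → ι (u s) T.⊛ expansion s))))))
          (θ-low M (expanded u) (expanded-low u h))))
      where
        open θ a
        γₐ = gval gs a
        iv = inverse (γₐ ^ M′) (^-nonzero M′ nz)
        inv = κ (proj₁ iv)
        unit : inv ⊛ κ γₐ ^ₚ M′ ≋ κ 1#
        unit = PR.trans (PR.*-congˡ {inv} (PR.sym (HomTools.^-homo (constHom 𝔽) γₐ M′))) (PR.trans (PR.sym (κh.*-homo (proj₁ iv) (γₐ ^ M′)))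
          (κh.cong (trans (*-comm _ _) (proj₂ iv))))
        term : ∀ s → Mod (lin a ^ₚ M) (κ γₐ ^ₚ M′ ⊛ (κ (u s) ⊛ monomial s)) (fun (ι (u s) T.⊛ expansion s))
        term s = PT.mod-trans (PT.mod-refl (PS.solve 3 (λ x y z → x PS.:* (y PS.:* z) PS.:= y PS.:* (x PS.:* z)) PR.refl (κ γₐ ^ₚ M′) (κ (u s)) (monomial s)))
          (PT.mod-trans (PT.mod-* (PT.mod-refl {a = κ (u s)} PR.refl) (expansion-mod M≤q a ta s))
            (PT.mod-refl (PR.sym (PR.trans (*-homo (ι (u s)) (expansion s)) (PR.*-congʳ {fun (expansion s)} (θ-ι (u s)))))))

    -- The unknowns regrouped as a polynomial in `X` over F[x][T], the shape to which `independent`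
    -- applies.
    rows : (Index → Fin q) → List T.Pol
    rows u = tabulate λ j → tabulate λ i → tabulate λ b → u (index j i b)

    private
      self : ∀ p → p ≋ Eval.ev (constHom 𝔽) var p
      self []      = PR.refl
      self (x ∷ p) = PR.trans (cons≋ x p) (PR.+-congˡ {κ x} (PR.*-congˡ {var} (self p)))

      decode : ∀ j i b → jᵢ (index j i b) ≡ j × iᵢ (index j i b) ≡ i × bᵢ (index j i b) ≡ b
      decode j i b = cong proj₁ e
        , trans (cong (λ p → proj₁ (Fin.remQuot {N} B (proj₂ p))) e) (cong proj₁ (Finₚ.remQuot-combine i b))
        , trans (cong (λ p → proj₂ (Fin.remQuot {N} B (proj₂ p))) e) (cong proj₂ (Finₚ.remQuot-combine i b))
        where e = Finₚ.remQuot-combine j (Fin.combine i b)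

      monomial-index : ∀ j i b → monomial (index j i b) ≡ X ^ₚ Fin.toℕ j ⊛ (Y ^ₚ Fin.toℕ i ⊛ var ^ₚ Fin.toℕ b)
      monomial-index j i b = let ej , ei , eb = decode j i b in
        trans (cong (λ x → X ^ₚ Fin.toℕ x ⊛ (Y ^ₚ Fin.toℕ (iᵢ (index j i b)) ⊛ var ^ₚ Fin.toℕ (bᵢ (index j i b)))) ej)
          (cong₂ (λ x y → X ^ₚ Fin.toℕ j ⊛ (Y ^ₚ Fin.toℕ x ⊛ var ^ₚ Fin.toℕ y)) ei eb)

    auxiliary-rows : ∀ u → auxiliary u ≋ evX (rows u)
    auxiliary-rows u = PR.trans (PSm.sum-combine J (N ℕ.* B) (λ s → κ (u s) ⊛ monomial s))
      (PR.trans (PSm.sum-cong J _ (λ j → X ^ₚ Fin.toℕ j ⊛ evY (row j)) block)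
        (PR.sym (EvalSum.ev-tabulate (Eval.evHom (idHom polyRing) Y) X J row)))
      where
        cell : Fin J → Fin N → Pol
        cell j i = tabulate λ b → u (index j i b)
        row : Fin J → T.Pol
        row j = tabulate (cell j)
        term : ∀ j i b → κ (u (index j i b)) ⊛ monomial (index j i b) ≋
          X ^ₚ Fin.toℕ j ⊛ (Y ^ₚ Fin.toℕ i ⊛ (var ^ₚ Fin.toℕ b ⊛ κ (u (index j i b))))
        term j i b = PR.trans (PR.*-congˡ {κ (u (index j i b))} (PR.reflexive (monomial-index j i b)))
          (PS.solve 4 (λ k x y v → k PS.:* (x PS.:* (y PS.:* v)) PS.:= x PS.:* (y PS.:* (v PS.:* k))) PR.refl (κ (u (index j i b))) (X ^ₚ Fin.toℕ j) (Y ^ₚ Fin.toℕ i) (var ^ₚ Fin.toℕ b))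
        cells : ∀ j i → PSm.sum (λ b → κ (u (index j i b)) ⊛ monomial (index j i b)) ≋ X ^ₚ Fin.toℕ j ⊛ (Y ^ₚ Fin.toℕ i ⊛ cell j i)
        cells j i = PR.trans (PSm.sum-cong B _ (λ b → X ^ₚ Fin.toℕ j ⊛ (Y ^ₚ Fin.toℕ i ⊛ (var ^ₚ Fin.toℕ b ⊛ κ (u (index j i b))))) (term j i))
          (PR.trans (PR.sym (PSm.*-sumˡ (X ^ₚ Fin.toℕ j) B (λ b → Y ^ₚ Fin.toℕ i ⊛ (var ^ₚ Fin.toℕ b ⊛ κ (u (index j i b))))))
          (PR.*-congˡ {X ^ₚ Fin.toℕ j} (PR.trans (PR.sym (PSm.*-sumˡ (Y ^ₚ Fin.toℕ i) B (λ b → var ^ₚ Fin.toℕ b ⊛ κ (u (index j i b)))))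
          (PR.*-congˡ {Y ^ₚ Fin.toℕ i} (PR.trans (PR.sym (EvalSum.ev-tabulate (constHom 𝔽) var B (λ b → u (index j i b)))) (PR.sym (self (cell j i))))))))
        block : ∀ j → PSm.sum (λ r → κ (u (Fin.combine j r)) ⊛ monomial (Fin.combine j r)) ≋ X ^ₚ Fin.toℕ j ⊛ evY (row j)
        block j = PR.trans (PSm.sum-combine N B (λ r → κ (u (Fin.combine j r)) ⊛ monomial (Fin.combine j r)))
          (PR.trans (PSm.sum-cong N _ (λ i → X ^ₚ Fin.toℕ j ⊛ (Y ^ₚ Fin.toℕ i ⊛ cell j i)) (cells j))
          (PR.trans (PR.sym (PSm.*-sumˡ (X ^ₚ Fin.toℕ j) N (λ i → Y ^ₚ Fin.toℕ i ⊛ cell j i)))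
          (PR.*-congˡ {X ^ₚ Fin.toℕ j} (PR.sym (EvalSum.ev-tabulate (idHom polyRing) Y N (cell j))))))

    auxiliary-nonzero : lim (N ℕ.∸ 1) B < q → ∀ u s → ¬ u s ≡ 0# → ¬ auxiliary u ≋ []
    auxiliary-nonzero lt u s nz e = nz (trans (cong u (sym s≡)) (entry (jᵢ s) (iᵢ s) (bᵢ s)))
      where
        s≡ : index (jᵢ s) (iᵢ s) (bᵢ s) ≡ s
        s≡ = trans (cong (Fin.combine (jᵢ s)) (Finₚ.combine-remQuot {N} B (proj₂ (Fin.remQuot {J} (N ℕ.* B) s)))) (Finₚ.combine-remQuot {J} (N ℕ.* B) s)
        deg-row : ∀ j → TD.Deg≤ (N ℕ.∸ 1) (tabulate λ i → tabulate λ b → u (index j i b))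
        deg-row j n l = T.coef-length (tabulate λ i → tabulate λ b → u (index j i b)) n (subst (_≤ n) (sym (length-tabulate {n = N} (λ i → tabulate λ b → u (index j i b))))
          (subst (_≤ n) (m+[n∸m]≡n 0<N) l))
        cd : ∀ n (f : Fin n → Fin B → Fin q) → CD B (tabulate (λ i → tabulate (f i)))
        cd zero    f = CD-[]
        cd (suc n) f zero    k l = coef-length (tabulate (f Fin.zero)) k (subst (_≤ k) (sym (length-tabulate (f Fin.zero))) (<⇒≤ l))
        cd (suc n) f (suc k) = cd n (f ∘ Fin.suc) k
        allZero : All (T._≋ []) (rows u)
        allZero = independent (N ℕ.∸ 1) B (subst (N ℕ.∸ 1 <_) (m+[n∸m]≡n 0<N) (n<1+n _)) lt (rows u)
          (Allₚ.tabulate⁺ (λ j → deg-row j , cd N (λ i b → u (index j i b)))) (PR.trans (PR.sym (auxiliary-rows u)) e)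
        entry : ∀ j i b → u (index j i b) ≡ 0#
        entry j i b = trans (sym (trans (cong (λ p → coef p (Fin.toℕ b)) (PolySum.coef-tabulate polyRing (λ i → tabulate λ b → u (index j i b)) i))
            (PolySum.coef-tabulate 𝔽 (λ b → u (index j i b)) b)))
          (at (T.at (Allₚ.tabulate⁻ allZero j) (Fin.toℕ i)) (Fin.toℕ b))

    -- Here N c = q - 1 bounds the degree of Y^i by q m.
    Deg≤-auxiliary : ∀ u → Deg≤ (J ℕ.* q ℕ.+ (q ℕ.* m ℕ.+ B)) (auxiliary u)
    Deg≤-auxiliary u = PSm.sum-closed (Deg≤ _) Deg≤-[] (λ {p} {r} → Deg≤-⊕ p r) _ _
      (λ s → Deg≤-mono {p = κ (u s) ⊛ monomial s} (le s) (Deg≤-⊛ {0} (κ (u s)) (monomial s) (Deg≤-const (u s))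
        (Deg≤-⊛ (X ^ₚ Fin.toℕ (jᵢ s)) (Y ^ₚ Fin.toℕ (iᵢ s) ⊛ var ^ₚ Fin.toℕ (bᵢ s)) (Deg≤-^ X (Fin.toℕ (jᵢ s)) (Deg≤-^ (lin a₀) q (Deg≤-lin a₀)))
          (Deg≤-⊛ (Y ^ₚ Fin.toℕ (iᵢ s)) (var ^ₚ Fin.toℕ (bᵢ s)) (Deg≤-^ Y (Fin.toℕ (iᵢ s)) (Deg≤-^ g c (Deg≤-gpoly gs))) (Deg≤-^ var (Fin.toℕ (bᵢ s)) Deg≤-var)))))
      where
        le : ∀ s → Fin.toℕ (jᵢ s) ℕ.* (q ℕ.* 1) ℕ.+ (Fin.toℕ (iᵢ s) ℕ.* (c ℕ.* m) ℕ.+ Fin.toℕ (bᵢ s) ℕ.* 1) ≤ J ℕ.* q ℕ.+ (q ℕ.* m ℕ.+ B)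
        le s = +-mono-≤ (*-mono-≤ (<⇒≤ (Finₚ.toℕ<n (jᵢ s))) (≤-reflexive (ℕₚ.*-identityʳ q)))
          (+-mono-≤
            (≤-trans (*-monoˡ-≤ (c ℕ.* m) (<⇒≤ (Finₚ.toℕ<n (iᵢ s))))
              (≤-trans (≤-reflexive (trans (sym (ℕₚ.*-assoc N c m)) (cong (ℕ._* m) (ℕₚ.*-comm N c))))
                (*-monoˡ-≤ m (subst (c ℕ.* N ≤_) Nc (ℕₚ.n≤1+n _)))))
            (subst (_≤ B) (sym (ℕₚ.*-identityʳ (Fin.toℕ (bᵢ s)))) (<⇒≤ (Finₚ.toℕ<n (bᵢ s)))))

    -- `many` compares the M (L + 1) conditions with the J N B unknowns, and `lt` keeps the
    -- resulting polynomial from being zero; its zeros of multiplicity M are then counted against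
    -- its degree.
    stepanov : M ≤ q → M ℕ.* suc L < J ℕ.* (N ℕ.* B) → lim (N ℕ.∸ 1) B < q →
      ∀ S → Unique S → (∀ {a} → a ∈ S → ¬ gval gs a ≡ 0# × gval gs a ^ c ≡ t) →
      length S ℕ.* M ≤ J ℕ.* q ℕ.+ (q ℕ.* m ℕ.+ B)
    stepanov M≤q many lt S uniq mem =
      let u , (s , nz) , sol = Kernel.kernel F many equation
      in root-count M S uniq (auxiliary u) (auxiliary-nonzero lt u s nz) (Deg≤-auxiliary u)
           (All.tabulate (λ {a} k → vanishing u sol M≤q a (proj₁ (mem k)) (proj₂ (mem k))))

-- Roots of unity

prime∤! : ∀ {p} → Prime p → ∀ n → n < p → ¬ p ∣ n !
prime∤! pr zero    n<p d = <⇒≱ (ℕ.nonTrivial⇒n>1 _ {{prime⇒nonTrivial pr}}) (∣⇒≤ d)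
prime∤! pr (suc n) n<p d = [ (λ e → <⇒≱ n<p (∣⇒≤ e)) , prime∤! pr n (<-trans (n<1+n n) n<p) ]′ (euclidsLemma (suc n) (n !) pr d)

module RootsOfUnity {q : ℕ} (F : FiniteField q) where
  open Field F

  ^-∣ : ∀ {ω m n} → ω ^ m ≡ 1# → m ∣ n → ω ^ n ≡ 1#
  ^-∣ {ω} {m} e (divides k refl) = trans (cong (ω ^_) (ℕₚ.*-comm k m))
    (trans (sym (^-assocʳ ω m k)) (trans (cong (_^ k) e) (1^ k)))

  ^-+-root : ∀ {ω} m k n → ω ^ n ≡ 1# → ω ^ (m ℕ.+ k ℕ.* n) ≡ ω ^ m
  ^-+-root {ω} m k n e = trans (^-homo-* ω m (k ℕ.* n)) (trans (cong (ω ^ m *_) (^-∣ e (divides k refl))) (*-identityʳ _))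

  private
    bezout-root : ∀ {ω m n} → Bézout.Identity 1 m n → ω ^ m ≡ 1# → ω ^ n ≡ 1# → ω ≡ 1#
    bezout-root {ω} {m} {n} (Bézout.+- x y eq) em en = trans (sym (*-identityʳ ω))
      (trans (sym (^-+-root 1 y n en)) (trans (cong (ω ^_) eq) (^-∣ em (divides x refl))))
    bezout-root {ω} {m} {n} (Bézout.-+ x y eq) em en = trans (sym (*-identityʳ ω))
      (trans (sym (^-+-root 1 x m em)) (trans (cong (ω ^_) eq) (^-∣ en (divides y refl))))

  order-prime : ∀ {ω p} → Prime p → ω ^ p ≡ 1# → ¬ ω ≡ 1# → ∀ n → ω ^ n ≡ 1# → p ∣ n
  order-prime {ω} {p} pr ep ne n en = go (n % p) refl
    where
      instance _ = prime⇒nonZero pr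
      split = m≡m%n+[m/n]*n n p
      go : ∀ k → n % p ≡ k → p ∣ n
      go zero    e = divides (n / p) (trans split (cong (ℕ._+ n / p ℕ.* p) e))
      go (suc k) e = ⊥-elim (ne (bezout-root (coprime-Bézout (prime⇒coprime pr (subst (_< p) e (m%n<n n p)))) ep
        (trans (cong (ω ^_) (sym e)) (trans (sym (^-+-root (n % p) (n / p) p ep)) (trans (cong (ω ^_) (sym split)) en)))))

  μ : ℕ → List (Fin q)
  μ d = filter (λ x → x ^ d ≟ 1#) (allFin q)

  μ-unique : ∀ d → Unique (μ d)
  μ-unique d = Uniqueₚ.filter⁺ _ (Uniqueₚ.allFin⁺ q)

  ∈-μ : ∀ {x} d → x ^ d ≡ 1# → x ∈ μ d
  ∈-μ d e = ∈-filter⁺ _ (∈-allFin _) e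

  μ-∈ : ∀ {x} d → x ∈ μ d → x ^ d ≡ 1#
  μ-∈ d m = proj₂ (∈-filter⁻ (λ x → x ^ d ≟ 1#) {xs = allFin q} m)

  length-μ : ∀ d → 0 < d → length (μ d) ≤ d
  length-μ d 0<d = roots-of-unity-count d 0<d (μ d) (μ-unique d) (μ-∈ d)

  -- A permutation rather than an equality of sets, because `powers` repeats its entries when the
  -- order of t is less than r.
  Invariant : ℕ → List (Fin q) → Set
  Invariant p Cs = ∀ ω → ω ^ p ≡ 1# → map (ω *_) Cs ↭ Cs

  μ-invariant : ∀ {p d} → 0 < d → p ∣ d → Invariant p (μ d)
  μ-invariant {p} {d} 0<d p∣d ω ωp = unique-↭ (Uniqueₚ.map⁺ (*-cancelˡ nz) (μ-unique d)) (μ-unique d) fwd back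
    where
      ωd : ω ^ d ≡ 1#
      ωd = ^-∣ ωp p∣d
      nz = ^-root⇒nonzero d 0<d ωd
      i = proj₁ (inverse ω nz)
      ωi = proj₂ (inverse ω nz)
      mul : ∀ x y → x ^ d ≡ 1# → y ^ d ≡ 1# → (x * y) ^ d ≡ 1#
      mul x y ex ey = trans (^-distrib-* x y d) (trans (cong₂ _*_ ex ey) (*-identityˡ 1#))
      i^d : i ^ d ≡ 1#
      i^d = trans (sym (*-identityˡ _)) (trans (cong (_* i ^ d) (sym ωd)) (trans (sym (^-distrib-* ω i d)) (trans (cong (_^ d) ωi) (1^ d))))
      fwd : ∀ {z} → z ∈ map (ω *_) (μ d) → z ∈ μ d
      fwd m with x , mx , refl ← ∈-map⁻ (ω *_) m = ∈-μ d (mul ω x ωd (μ-∈ d mx))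
      back : ∀ {z} → z ∈ μ d → z ∈ map (ω *_) (μ d)
      back {z} m = subst (_∈ map (ω *_) (μ d)) (trans (sym (*-assoc ω i z)) (trans (cong (_* z) ωi) (*-identityˡ z)))
        (∈-map⁺ (ω *_) (∈-μ d (mul i z i^d (μ-∈ d m))))

  powers : Fin q → ℕ → List (Fin q)
  powers t r = applyUpTo (t ^_) r

  private
    rotate : ∀ t r → t ^ r ≡ 1# → map (t *_) (powers t r) ↭ powers t r
    rotate t zero    e = Perm.refl
    rotate t (suc r) e = subst₂ _↭_
      (trans (applyUpTo-∷ʳ (λ i → t ^ suc i) r) (sym (map-applyUpTo (t ^_) (t *_) (suc r)))) refl
      (Perm.trans (Perm.↭-sym (∷↭∷ʳ (t ^ suc r) (applyUpTo (λ i → t ^ suc i) r))) (Perm.↭-reflexive (cong (_∷ applyUpTo (λ i → t ^ suc i) r) e)))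

    rotate^ : ∀ t r → t ^ r ≡ 1# → ∀ l → map ((t ^ l) *_) (powers t r) ↭ powers t r
    rotate^ t r e zero    = Perm.↭-reflexive (trans (map-cong *-identityˡ (powers t r)) (map-id (powers t r)))
    rotate^ t r e (suc l) = Perm.trans (Perm.↭-reflexive (trans (map-cong (*-assoc t (t ^ l)) (powers t r)) (map-∘ (powers t r))))
      (Perm.trans (map⁺ (t *_) (rotate^ t r e l)) (rotate t r e))

    -- Primes are stripped from the exponent while the power of t stays 1; where this first fails,
    -- the power has exact order p.
    descend : ∀ t ps → All Prime ps → t ^ ℕL.product ps ≡ 1# → ¬ t ≡ 1# →
      ∃ λ p → Prime p × p ∣ ℕL.product ps × (∃ λ l → ¬ t ^ l ≡ 1# × (t ^ l) ^ p ≡ 1#)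
    descend t []       []         e ne = ⊥-elim (ne (trans (sym (*-identityʳ t)) e))
    descend t (p ∷ ps) (pr ∷ prs) e ne with t ^ ℕL.product ps ≟ 1#
    ... | no ne′ = p , pr , m∣m*n (ℕL.product ps) , ℕL.product ps , ne′ , trans (^-assocʳ t (ℕL.product ps) p) (trans (cong (t ^_) (ℕₚ.*-comm (ℕL.product ps) p)) e)
    ... | yes e′ with descend t ps prs e′ ne
    ... | p′ , pr′ , d , rest = p′ , pr′ , ∣-trans d (n∣m*n p) , rest

    -- u has p distinct powers, and there are at most p roots of unity of order p.
    generate : ∀ {p u} → Prime p → ¬ u ≡ 1# → u ^ p ≡ 1# → ∀ ω → ω ^ p ≡ 1# → ∃ λ k → ω ≡ u ^ k
    generate {p} {u} pr ne up ω ωp with any? (ω ≟_) (powers u p)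
    ... | yes m = let k , _ , e = ∈-applyUpTo⁻ (u ^_) m in k , e
    ... | no nm = ⊥-elim (ℕₚ.<-irrefl refl (subst (λ x → suc x ≤ p) (length-applyUpTo (u ^_) p)
        (roots-of-unity-count p 0<p (ω ∷ powers u p) (Allₚ.¬Any⇒All¬ _ nm ∷ Uniqueₚ.applyUpTo⁺₁ (u ^_) p distinct) roots)))
      where
        0<p : 0 < p
        0<p = ℕ.>-nonZero⁻¹ p {{prime⇒nonZero pr}}
        distinct : ∀ {i j} → i < j → j < p → u ^ i ≢ u ^ j
        distinct {i} {j} i<j j<p e = <⇒≱ (≤-<-trans (m∸n≤m j i) j<p) (∣⇒≤ {{ℕ.>-nonZero (ℕₚ.m<n⇒0<n∸m i<j)}}
          (order-prime pr up ne (j ℕ.∸ i) (*-cancelˡ (^-nonzero i (^-root⇒nonzero p 0<p up))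
            (trans (sym (^-homo-* u i (j ℕ.∸ i))) (trans (cong (u ^_) (m+[n∸m]≡n (<⇒≤ i<j))) (trans (sym e) (sym (*-identityʳ _))))))))
        roots : ∀ {x} → x ∈ ω ∷ powers u p → x ^ p ≡ 1#
        roots (here refl) = ωp
        roots (there m) with k , _ , refl ← ∈-applyUpTo⁻ (u ^_) m =
          trans (^-assocʳ u k p) (trans (cong (u ^_) (ℕₚ.*-comm k p)) (trans (sym (^-assocʳ u p k)) (trans (cong (_^ k) up) (1^ k))))

  -- Some power of t has prime order p and therefore generates all p-th roots of unity, and
  -- multiplication by t merely rotates the list.
  powers-invariant : ∀ t r → 0 < r → t ^ r ≡ 1# → ¬ t ≡ 1# → ∃ λ p → Prime p × p ∣ r × Invariant p (powers t r)
  powers-invariant t r 0<r e ne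
    with descend t (PrimeFactorisation.factors fac) (PrimeFactorisation.factorsPrime fac)
           (trans (cong (t ^_) (sym (PrimeFactorisation.isFactorisation fac))) e) ne
    where fac = factorise r {{ℕ.>-nonZero 0<r}}
  ... | p , pr , d , l , ne′ , ep = p , pr , subst (p ∣_) (sym (PrimeFactorisation.isFactorisation (factorise r {{ℕ.>-nonZero 0<r}}))) d
    , λ ω ωp → let k , eq = generate pr ne′ ep ω ωp in
        subst (λ x → map (x *_) (powers t r) ↭ powers t r) (sym (trans eq (^-assocʳ t l k))) (rotate^ t r e (l ℕ.* k))

  prime-divisor : ∀ n → 1 < n → ∃ λ p → Prime p × p ∣ n
  prime-divisor n 1<n = go (PrimeFactorisation.factors fac) (PrimeFactorisation.factorsPrime fac) (PrimeFactorisation.isFactorisation fac)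
    where
      fac = factorise n {{ℕ.>-nonZero (<-trans (s≤s z≤n) 1<n)}}
      go : ∀ ps → All Prime ps → n ≡ ℕL.product ps → ∃ λ p → Prime p × p ∣ n
      go []       []       e = ⊥-elim (<⇒≢ 1<n (sym e))
      go (p ∷ ps) (pr ∷ _) e = p , pr , subst (p ∣_) (sym e) (m∣m*n (ℕL.product ps))

  module _ (r c : ℕ) (0<r : 0 < r) (rc : c ℕ.* r ≡ length units) where

    private
      0<units : 0 < length units
      0<units = nonempty (∈-units 1≢0)
        where
          nonempty : ∀ {x} {xs : List (Fin q)} → x ∈ xs → 0 < length xs
          nonempty {xs = _ ∷ _} _ = s≤s z≤n

      positive : ∀ {n} k → n ℕ.* k ≡ length units → 0 < n
      positive {zero}  k e = ⊥-elim (<⇒≢ 0<units e)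
      positive {suc n} k e = s≤s z≤n

    -- If x^((q-1)/p) = 1 held for all units x, this equation would have more solutions than its
    -- degree.
    nontrivial-root : ∀ p → Prime p → p ∣ r → ∃ λ ω → ω ^ p ≡ 1# × ¬ ω ≡ 1#
    nontrivial-root p pr (divides d refl) with Finₚ.any? (λ x → ¬? (x ≟ 0#) ×-dec ¬? (x ^ (c ℕ.* d) ≟ 1#))
    ... | yes (x , nz , ne) = x ^ (c ℕ.* d) , trans (^-assocʳ x (c ℕ.* d) p) (trans (cong (x ^_) (trans (ℕₚ.*-assoc c d p) rc)) (fermat nz)) , ne
    ... | no none = ⊥-elim (<⇒≱ (<-≤-trans lt (≤-reflexive eq))
        (roots-of-unity-count (c ℕ.* d) pos units units-unique
          (λ {x} m → decidable-stable (x ^ (c ℕ.* d) ≟ 1#) (λ ne → none (x , units-∈ m , ne)))))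
      where
        eq : c ℕ.* d ℕ.* p ≡ length units
        eq = trans (ℕₚ.*-assoc c d p) rc
        pos = positive p eq
        lt : c ℕ.* d < c ℕ.* d ℕ.* p
        lt = subst (_< c ℕ.* d ℕ.* p) (ℕₚ.*-identityʳ (c ℕ.* d)) (ℕₚ.*-monoʳ-< (c ℕ.* d) {{ℕ.>-nonZero pos}} (ℕ.nonTrivial⇒n>1 p {{prime⇒nonTrivial pr}}))

    -- Counting replaces a generator of the group: if z were missed, x ↦ x^r would send the c r
    -- units to fewer than c values, with at most r units over each.
    rth-power : ∀ {z} → z ^ c ≡ 1# → ∃ λ w → ¬ w ≡ 0# × w ^ r ≡ z
    rth-power {z} zc with Finₚ.any? (λ w → ¬? (w ≟ 0#) ×-dec (w ^ r ≟ z))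
    ... | yes found = found
    ... | no none = ⊥-elim (ℕₚ.<-irrefl refl (<-≤-trans (≤-<-trans upper (ℕₚ.*-monoˡ-< r {{ℕ.>-nonZero 0<r}} short)) (≤-reflexive rc)))
      where
        open Fibres (_^ r)
        0<c = positive r rc
        ts = filter (λ t → ¬? (t ≟ z)) (μ c)
        image : ∀ x → x ∈ units → x ^ r ∈ ts
        image x m = ∈-filter⁺ _ (∈-μ c (trans (^-assocʳ x r c) (trans (cong (x ^_) (trans (ℕₚ.*-comm r c) rc)) (fermat (units-∈ m)))))
          (λ e → none (x , units-∈ m , e))
        short : length ts < c
        short = <-≤-trans (filter-notAll (λ t → ¬? (t ≟ z)) (μ c) (lose (∈-μ c zc) (λ n → n refl))) (length-μ c 0<c)
        small : ∀ t → t ∈ ts → length (fibre units t) ≤ r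
        small t _ = bound (fibre units t) (Uniqueₚ.filter⁺ _ units-unique) (λ m → ∈-filter⁻ (λ x → x ^ r ≟ t) {xs = units} m)
          where
            bound : ∀ xs → Unique xs → (∀ {x} → x ∈ xs → x ∈ units × x ^ r ≡ t) → length xs ≤ r
            bound []       _ _ = z≤n
            bound (x ∷ xs) u h = subst (_≤ r) (length-map (i *_) (x ∷ xs))
              (roots-of-unity-count r 0<r (map (i *_) (x ∷ xs)) (Uniqueₚ.map⁺ (*-cancelˡ i≢0) u) roots)
              where
                x≢0 = units-∈ (proj₁ (h (here refl)))
                i = proj₁ (inverse x x≢0)
                xi = proj₂ (inverse x x≢0)
                i≢0 : ¬ i ≡ 0#
                i≢0 e = 0≢1 (trans (sym (zeroʳ x)) (trans (cong (x *_) (sym e)) xi))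
                roots : ∀ {y} → y ∈ map (i *_) (x ∷ xs) → y ^ r ≡ 1#
                roots m with y , my , refl ← ∈-map⁻ (i *_) m = trans (^-distrib-* i y r)
                  (trans (cong (i ^ r *_) (trans (proj₂ (h my)) (sym (proj₂ (h (here refl))))))
                    (trans (sym (^-distrib-* i x r)) (trans (cong (_^ r) (trans (*-comm i x) xi)) (1^ r))))
        upper : length units ≤ length ts ℕ.* r
        upper = begin
          length units ≡⟨ trans (ℕₚ.*-identityʳ _) refl ⟨
          length units ℕ.* 1 ≡⟨ ∑-const units 1 ⟨
          ∑ units (λ _ → 1) ≡⟨ ∑-fibres (λ _ → 1) units ts (Uniqueₚ.filter⁺ _ (μ-unique c)) image ⟩
          ∑ ts (λ t → length (fibre units t) ℕ.* 1) ≤⟨ ∑-mono ts (λ t m → subst (_≤ r) (sym (ℕₚ.*-identityʳ _)) (small t m)) ⟩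
          ∑ ts (λ _ → r) ≡⟨ ∑-const ts r ⟩
          length ts ℕ.* r ∎
          where open ℕₚ.≤-Reasoning

∑-applyUpTo : ∀ {A : Set} (f : ℕ → A) n (g : A → ℕ) → ∑ (applyUpTo f n) g ≡ ∑ (upTo n) (g ∘ f)
∑-applyUpTo f n g = trans (cong (λ xs → ∑ xs g) (sym (map-applyUpTo id f n))) (∑-map f (upTo n) g)

-- Integral weights in place of complex characters

module Weights {q : ℕ} (F : FiniteField q) (r c : ℕ) (1<r : 1 < r) (rc : c ℕ.* r ≡ length (Field.units F)) where
  open Field F
  open RootsOfUnity F

  0<r : 0 < r
  0<r = <-trans (s≤s z≤n) 1<r

  root : ∀ p → Prime p → p ∣ r → ∃ λ ω → ω ^ p ≡ 1# × ¬ ω ≡ 1#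
  root = nontrivial-root r c 0<r rc

  -- 2ⁿ - ν n arises from the indicator of 1 by applying f ↦ (s ↦ f(s) - f(sω)) with one
  -- p-th root of unity ω ≢ 1 for each prime p ≤ n dividing r, so it sums to 0 over every
  -- list that is invariant under p-th roots of unity.  Stating this for ν keeps it in ℕ.
  step : ∀ {p} → Dec (Prime p × p ∣ r) → (Fin q → ℕ) → ℕ → Fin q → ℕ
  step {p} (yes (pr , d)) f k s = f s ℕ.+ (2 ℕ.* k ℕ.∸ f (s * proj₁ (root p pr d)))
  step     (no _)         f k s = f s ℕ.+ k

  usable? : ∀ p → Dec (Prime p × p ∣ r)
  usable? p = prime? p ×-dec (p ∣? r)

  ν : ℕ → Fin q → ℕ
  ν zero    s with s ≟ 1#
  ... | yes _ = 0
  ... | no _  = 1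
  ν (suc n) = step (usable? (suc n)) (ν n) (2 ℕ.^ n)

  -- Makes the truncated subtraction in `step` exact.
  ν≤ : ∀ n s → ν n s ≤ 2 ℕ.* 2 ℕ.^ n
  ν≤ zero    s with s ≟ 1#
  ... | yes _ = z≤n
  ... | no _  = s≤s z≤n
  ν≤ (suc n) s with usable? (suc n)
  ... | yes (pr , d) = ≤-trans (+-mono-≤ (ν≤ n s) (m∸n≤m _ (ν n (s * proj₁ (root (suc n) pr d)))))
    (≤-reflexive (cong (2 ℕ.* 2 ℕ.^ n ℕ.+_) (sym (ℕₚ.+-identityʳ _))))
  ... | no _ = ≤-trans (+-mono-≤ (ν≤ n s) (m≤m+n (2 ℕ.^ n) (2 ℕ.^ n ℕ.+ 0)))
    (≤-reflexive (cong (2 ℕ.* 2 ℕ.^ n ℕ.+_) (sym (ℕₚ.+-identityʳ _))))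

  private
    2k∸k : ∀ k → 2 ℕ.* k ℕ.∸ k ≡ k
    2k∸k k = trans (ℕₚ.m+n∸m≡n k (k ℕ.+ 0)) (ℕₚ.+-identityʳ k)

    k+k : ∀ k → k ℕ.+ k ≡ 2 ℕ.* k
    k+k k = cong (k ℕ.+_) (sym (ℕₚ.+-identityʳ k))

  -- The function 2ⁿ - ν n is supported where s^(n!) = 1, since its shifts use only roots of unity
  -- of prime order at most n.
  ν-off : ∀ n s → ¬ s ^ (n !) ≡ 1# → ν n s ≡ 2 ℕ.^ n
  ν-off zero    s ne with s ≟ 1#
  ... | yes e = ⊥-elim (ne (trans (*-identityʳ s) e))
  ... | no _  = refl
  ν-off (suc n) s ne with usable? (suc n)
  ... | yes (pr , d) = trans (cong₂ (λ x y → x ℕ.+ (2 ℕ.* 2 ℕ.^ n ℕ.∸ y))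
      (ν-off n s (λ e → ne (^-∣ {m = n !} e (n∣m*n (suc n)))))
      (ν-off n (s * ω) (λ e → ne (trans (sym (*-identityʳ _)) (trans (cong (s ^ (suc n !) *_) (sym (^-∣ {m = suc n} (proj₁ (proj₂ (root (suc n) pr d))) (m∣m*n (n !)))))
        (trans (sym (^-distrib-* s ω (suc n !))) (^-∣ {m = n !} e (n∣m*n (suc n)))))))))
      (trans (cong (2 ℕ.^ n ℕ.+_) (2k∸k (2 ℕ.^ n))) (k+k (2 ℕ.^ n)))
    where ω = proj₁ (root (suc n) pr d)
  ... | no _ = trans (cong (ℕ._+ 2 ℕ.^ n) (ν-off n s (λ e → ne (^-∣ {m = n !} e (n∣m*n (suc n)))))) (k+k (2 ℕ.^ n))

  -- A prime n + 1 does not divide n!, so its ω lies where `ν-off` applies, and the difference taken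
  -- at this step does not change the value 1 of 2ⁿ - ν n at 1.
  ν-one : ∀ n → suc (ν n 1#) ≡ 2 ℕ.^ n
  ν-one zero with 1# ≟ 1#
  ... | yes _ = refl
  ... | no ne = ⊥-elim (ne refl)
  ν-one (suc n) with usable? (suc n)
  ... | yes (pr , d) = trans (cong (λ y → suc (ν n 1#) ℕ.+ (2 ℕ.* 2 ℕ.^ n ℕ.∸ y))
      (trans (cong (ν n) (*-identityˡ ω)) (ν-off n ω (λ e → prime∤! pr n (n<1+n n) (order-prime pr ωp ω≢1 (n !) e)))))
      (trans (cong₂ ℕ._+_ (ν-one n) (2k∸k (2 ℕ.^ n))) (k+k (2 ℕ.^ n)))
    where ω = proj₁ (root (suc n) pr d)
          ωp = proj₁ (proj₂ (root (suc n) pr d))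
          ω≢1 = proj₂ (proj₂ (root (suc n) pr d))
  ... | no _ = trans (cong (ℕ._+ 2 ℕ.^ n) (ν-one n)) (k+k (2 ℕ.^ n))

  -- If p is the prime of the last step, invariance gives the two terms of the difference equal
  -- sums; otherwise both have the right mean already by induction.
  ν-mean : ∀ n {p} → Prime p → p ∣ r → p ≤ n → ∀ Cs → Invariant p Cs → ∀ s → ∑ Cs (λ x → ν n (s * x)) ≡ length Cs ℕ.* 2 ℕ.^ n
  ν-mean zero {p} pr d p≤0 Cs inv s = ⊥-elim (<⇒≱ (ℕ.>-nonZero⁻¹ p {{prime⇒nonZero pr}}) p≤0)
  ν-mean (suc n) {p} pr d p≤n Cs inv s with usable? (suc n) | m≤n⇒m<n∨m≡n p≤n
  ... | no nu | inj₂ refl = ⊥-elim (nu (pr , d))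
  ... | no nu | inj₁ (s≤s l) = trans (∑-+ Cs _ (λ _ → k)) (trans (cong₂ ℕ._+_ (ν-mean n pr d l Cs inv s) (∑-const Cs k))
      (trans (sym (ℕₚ.*-distribˡ-+ (length Cs) k k)) (cong (length Cs ℕ.*_) (k+k k))))
    where k = 2 ℕ.^ n
  ... | yes (pr′ , d′) | cmp = trans (∑-+ Cs (λ x → ν n (s * x)) rest) (trans (cong (ℕ._+ ∑ Cs rest) (sym (same cmp)))
      (trans (sym (∑-+ Cs (λ x → ν n (s * x * ω)) rest))
        (trans (∑-cong Cs (λ x _ → m+[n∸m]≡n (ν≤ n (s * x * ω)))) (∑-const Cs (2 ℕ.* k)))))
    where
      open Solver 𝔽
      k = 2 ℕ.^ n
      ω = proj₁ (root (suc n) pr′ d′)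
      rest : Fin q → ℕ
      rest x = 2 ℕ.* k ℕ.∸ ν n (s * x * ω)
      same : suc p ≤ suc n ⊎ p ≡ suc n → ∑ Cs (λ x → ν n (s * x * ω)) ≡ ∑ Cs (λ x → ν n (s * x))
      same (inj₁ (s≤s l)) = trans (∑-cong Cs (λ x _ → cong (ν n) (solve 3 (λ s x w → s :* x :* w := (s :* w) :* x) refl s x ω)))
        (trans (ν-mean n pr d l Cs inv (s * ω)) (sym (ν-mean n pr d l Cs inv s)))
      same (inj₂ refl) = trans (∑-cong Cs (λ x _ → cong (ν n) (solve 3 (λ s x w → s :* x :* w := s :* (w :* x)) refl s x ω)))
        (trans (sym (∑-map (ω *_) Cs (λ x → ν n (s * x)))) (∑-↭ (λ x → ν n (s * x)) (inv ω (proj₁ (proj₂ (root (suc n) pr′ d′))))))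

  K : ℕ
  K = 2 ℕ.^ r

  w : Fin q → ℕ
  w = ν r

  w-one : suc (w 1#) ≡ K
  w-one = ν-one r

  w-powers : ∀ t → t ^ r ≡ 1# → ¬ t ≡ 1# → ∀ s → ∑ (powers t r) (λ x → w (s * x)) ≡ r ℕ.* K
  w-powers t e ne s = let p , pr , d , inv = powers-invariant t r 0<r e ne in
    trans (ν-mean r pr d (∣⇒≤ {{ℕ.>-nonZero 0<r}} d) (powers t r) inv s) (cong (ℕ._* K) (length-applyUpTo (t ^_) r))

  w-μ : ∀ N → 1 < N → N ∣ r → ∀ s → ∑ (μ N) (λ x → w (s * x)) ≡ length (μ N) ℕ.* K
  w-μ N 1<N N∣r s = let p , pr , d = prime-divisor N 1<N in
    ν-mean r pr (∣-trans d N∣r) (∣⇒≤ {{ℕ.>-nonZero 0<r}} (∣-trans d N∣r)) (μ N) (μ-invariant (<-trans (s≤s z≤n) 1<N) d) s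

  -- Unfolded, the sum of w(s ∏ tᵢ^eᵢ) over all exponent vectors e, which is what the character
  -- expansion of an indicator becomes.
  tree : List (Fin q) → Fin q → ℕ
  tree []       s = w s
  tree (t ∷ ts) s = ∑ (powers t r) (λ x → tree ts (s * x))

  private
    tree-mean : ∀ Cs → (∀ s → ∑ Cs (λ x → w (s * x)) ≡ length Cs ℕ.* K) → ∀ ts s →
      ∑ Cs (λ x → tree ts (s * x)) ≡ length Cs ℕ.* (r ℕ.^ length ts ℕ.* K)
    tree-mean Cs h []       s = trans (h s) (cong (length Cs ℕ.*_) (sym (ℕₚ.+-identityʳ K)))
    tree-mean Cs h (t ∷ ts) s = begin
      ∑ Cs (λ x → ∑ (powers t r) (λ y → tree ts (s * x * y)))
        ≡⟨ ∑-swap Cs (powers t r) (λ x y → tree ts (s * x * y)) ⟩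
      ∑ (powers t r) (λ y → ∑ Cs (λ x → tree ts (s * x * y)))
        ≡⟨ ∑-cong (powers t r) (λ y _ → trans (∑-cong Cs (λ x _ → cong (tree ts) (solve 3 (λ s x y → s :* x :* y := (s :* y) :* x) refl s x y))) (tree-mean Cs h ts (s * y))) ⟩
      ∑ (powers t r) (λ _ → length Cs ℕ.* (R ℕ.* K))
        ≡⟨ trans (∑-const (powers t r) _) (cong (ℕ._* (length Cs ℕ.* (R ℕ.* K))) (length-applyUpTo (t ^_) r)) ⟩
      r ℕ.* (length Cs ℕ.* (R ℕ.* K))
        ≡⟨ N.solve 4 (λ r l R K → r N.:* (l N.:* (R N.:* K)) N.:= l N.:* ((r N.:* R) N.:* K)) refl r (length Cs) R K ⟩
      length Cs ℕ.* (r ℕ.^ suc (length ts) ℕ.* K) ∎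
      where
        open ≡.≡-Reasoning
        open Solver 𝔽
        module N = +-*-Solver
        R = r ℕ.^ length ts

  -- One t different from 1 is enough: the sum over its powers already averages `w`, whatever the
  -- other exponents are.
  tree-nontrivial : ∀ ts → All (λ t → t ^ r ≡ 1#) ts → ¬ All (_≡ 1#) ts → ∀ s → tree ts s ≡ r ℕ.^ length ts ℕ.* K
  tree-nontrivial []       []       ne s = ⊥-elim (ne [])
  tree-nontrivial (t ∷ ts) (e ∷ es) ne s with t ≟ 1#
  ... | no t≢1 = trans (tree-mean (powers t r) (λ s → trans (w-powers t e t≢1 s) (cong (ℕ._* K) (sym (length-applyUpTo (t ^_) r)))) ts s)
      (trans (cong (ℕ._* (r ℕ.^ length ts ℕ.* K)) (length-applyUpTo (t ^_) r)) (sym (ℕₚ.*-assoc r _ K)))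
  ... | yes t≡1 = trans (∑-cong (powers t r) (λ x _ → tree-nontrivial ts es (λ h → ne (t≡1 ∷ h)) (s * x)))
      (trans (∑-const (powers t r) _) (trans (cong (ℕ._* (r ℕ.^ length ts ℕ.* K)) (length-applyUpTo (t ^_) r)) (sym (ℕₚ.*-assoc r _ K))))

-- Character sums

module CharacterSums {q : ℕ} (F : FiniteField q) (r c : ℕ) (1<r : 1 < r) (rc : c ℕ.* r ≡ length (Field.units F)) where
  open Field F
  open RootsOfUnity F
  open Irreducibility F using (Points; gval; size; Distinct; gval-nonzero)
  open Weights F r c 1<r rc

  -- The outcome of Stepanov's method as a property of Δ, which separates the counting below from
  -- the choice of J, B and M. The factor N on the left avoids q / N.
  StepanovBound : ℕ → ℕ → Set
  StepanovBound n Δ = ∀ N c′ → 0 < N → N ≤ r → suc (c′ ℕ.* N) ≡ q → ∀ gs → Distinct gs →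
    (∀ k → (∀ {y ε} → (y , ε) ∈ gs → N ∣ k ℕ.* ε) → N ∣ k) → size gs ≤ r ℕ.* n →
    ∀ a₀ → All (λ p → ¬ proj₁ p ≡ a₀) gs → ∀ t S → Unique S →
    (∀ {a} → a ∈ S → ¬ gval gs a ≡ 0# × gval gs a ^ c′ ≡ t) → N ℕ.* length S ≤ q ℕ.+ Δ

  -- Starting from r makes the gcd a divisor of r; the quotient is the N of the reduced data.
  gcdAll : Points → ℕ
  gcdAll []             = r
  gcdAll ((_ , e) ∷ es) = gcd e (gcdAll es)

  gcdAll∣r : ∀ es → gcdAll es ∣ r
  gcdAll∣r []             = ∣-refl
  gcdAll∣r ((_ , e) ∷ es) = ∣-trans (gcd[m,n]∣n e (gcdAll es)) (gcdAll∣r es)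

  gcdAll∣ : ∀ {es y e} → (y , e) ∈ es → gcdAll es ∣ e
  gcdAll∣ {(_ , e) ∷ es} (here refl) = gcd[m,n]∣m e (gcdAll es)
  gcdAll∣ {(_ , e) ∷ es} (there m)     = ∣-trans (gcd[m,n]∣n e (gcdAll es)) (gcdAll∣ m)

  ∣k*gcdAll : ∀ k es → (∀ {y e} → (y , e) ∈ es → r ∣ k ℕ.* e) → r ∣ k ℕ.* gcdAll es
  ∣k*gcdAll k []             h = n∣m*n k
  ∣k*gcdAll k ((_ , e) ∷ es) h = subst (r ∣_) (sym (c*gcd[m,n]≡gcd[cm,cn] k e (gcdAll es)))
    (gcd-greatest (h (here refl)) (∣k*gcdAll k es (h ∘ there)))

  module _ (d : ℕ) {{_ : ℕ.NonZero d}} where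
    reduce : Points → Points
    reduce = map (λ p → proj₁ p , proj₂ p / d)

    gval-reduce : ∀ es → (∀ {y e} → (y , e) ∈ es → d ∣ e) → ∀ x → gval es x ≡ gval (reduce es) x ^ d
    gval-reduce []             h x = sym (1^ d)
    gval-reduce ((y , e) ∷ es) h x = trans (cong₂ _*_
        (trans (cong ((y - x) ^_) (sym (m/n*n≡m (h (here refl))))) (sym (^-assocʳ (y - x) (e / d) d))) (gval-reduce es (h ∘ there) x))
      (sym (^-distrib-* ((y - x) ^ (e / d)) (gval (reduce es) x) d))

    size-reduce : ∀ es → size (reduce es) ≤ size es
    size-reduce []             = z≤n
    size-reduce ((y , e) ∷ es) = +-mono-≤ (m/n≤m e d) (size-reduce es)

  size≤ : ∀ es → All (λ p → proj₂ p < r) es → size es ≤ r ℕ.* length es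
  size≤ []             []       = z≤n
  size≤ ((y , e) ∷ es) (l ∷ ls) = ≤-trans (+-mono-≤ (<⇒≤ l) (size≤ es ls)) (≤-reflexive (sym (ℕₚ.*-suc r (length es))))

  module _ (ys : List (Fin q)) (unique : Unique ys) (a₀ : Fin q) (a₀∉ys : a₀ ∉ ys)
           (Δ : ℕ) (bound : StepanovBound (length ys) Δ) where

    n : ℕ
    n = length ys

    outside : List (Fin q)
    outside = filter (λ x → ¬? (∈? _≟_ x ys)) (allFin q)

    outside-∉ : ∀ {x} → x ∈ outside → x ∉ ys
    outside-∉ m = proj₂ (∈-filter⁻ (λ x → ¬? (∈? _≟_ x ys)) {xs = allFin q} m)

    outside-unique : Unique outside
    outside-unique = Uniqueₚ.filter⁺ _ (Uniqueₚ.allFin⁺ q)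

    length-outside : length outside ℕ.+ n ≡ q
    length-outside = trans (sym (length-++ outside)) (trans (↭-length {xs = outside ++ ys} {allFin q}
        (unique-↭ (Uniqueₚ.++⁺ outside-unique unique (λ { (m , m′) → outside-∉ m m′ })) (Uniqueₚ.allFin⁺ q) (λ _ → ∈-allFin _) (λ {z} _ → mem z))) length-allFin)
      where
        mem : ∀ z → z ∈ outside ++ ys
        mem z with ∈? _≟_ z ys
        ... | yes m = ∈-++⁺ʳ outside m
        ... | no nm = ∈-++⁺ˡ (∈-filter⁺ _ (∈-allFin z) nm)

    record Exponents (es : Points) : Set where
      field
        distinct : Distinct es
        inside   : All (λ p → proj₁ p ∈ ys) es
        small    : All (λ p → proj₂ p < r) es
        short    : length es ≤ n

    avoid : ∀ {es : Points} {x} → All (λ p → proj₁ p ∈ ys) es → x ∉ ys → All (λ p → ¬ proj₁ p ≡ x) es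
    avoid h nx = All.map (λ {p} m e → nx (subst (_∈ ys) e m)) h

    -- The substitute for the Weil bound on the sum of χ(∏ (y - x)^e): the mean of w over
    -- the values of the character is K, so the left side would be q K if these were equidistributed.
    weil : ∀ es → Exponents es → ∀ {y₀ e₀} → (y₀ , e₀) ∈ es → 0 < e₀ → ∀ s →
      ∑ outside (λ x → w (s * gval es x ^ c)) ≤ (q ℕ.+ Δ) ℕ.* K
    weil es ex {y₀} {e₀} mem₀ 0<e₀ s = ℕₚ.*-cancelˡ-≤ N {{ℕ.>-nonZero 0<N}} (begin
      N ℕ.* ∑ outside (λ x → w (s * gval es x ^ c))
        ≡⟨ cong (N ℕ.*_) (trans (∑-cong outside (λ x _ → cong (λ z → w (s * z)) (χ≡ x))) (∑-fibres (λ t → w (s * t)) outside (μ N) (μ-unique N) image)) ⟩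
      N ℕ.* ∑ (μ N) (λ t → length (fibre outside t) ℕ.* w (s * t))
        ≡⟨ ∑-*ˡ (μ N) N _ ⟨
      ∑ (μ N) (λ t → N ℕ.* (length (fibre outside t) ℕ.* w (s * t)))
        ≤⟨ ∑-mono (μ N) (λ t _ → subst (_≤ (q ℕ.+ Δ) ℕ.* w (s * t)) (ℕₚ.*-assoc N _ (w (s * t))) (*-monoˡ-≤ (w (s * t)) (fibre≤ t))) ⟩
      ∑ (μ N) (λ t → (q ℕ.+ Δ) ℕ.* w (s * t))
        ≡⟨ trans (∑-*ˡ (μ N) (q ℕ.+ Δ) _) (cong ((q ℕ.+ Δ) ℕ.*_) (w-μ N 1<N N∣r s)) ⟩
      (q ℕ.+ Δ) ℕ.* (length (μ N) ℕ.* K)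
        ≤⟨ *-monoʳ-≤ (q ℕ.+ Δ) (*-monoˡ-≤ K (length-μ N 0<N)) ⟩
      (q ℕ.+ Δ) ℕ.* (N ℕ.* K)
        ≡⟨ S.solve 3 (λ a n k → a S.:* (n S.:* k) S.:= n S.:* (a S.:* k)) refl (q ℕ.+ Δ) N K ⟩
      N ℕ.* ((q ℕ.+ Δ) ℕ.* K) ∎)
      where
        open ℕₚ.≤-Reasoning
        module S = +-*-Solver
        open Exponents ex
        d = gcdAll es
        d∣r = gcdAll∣r es
        N = _∣_.quotient d∣r
        r≡ : r ≡ N ℕ.* d
        r≡ = _∣_.equality d∣r
        0<d : 0 < d
        0<d = ℕₚ.n≢0⇒n>0 (λ e → <⇒≢ 0<r (sym (trans r≡ (trans (cong (N ℕ.*_) e) (ℕₚ.*-zeroʳ N)))))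
        instance
          d≢0 : ℕ.NonZero d
          d≢0 = ℕ.>-nonZero 0<d
        -- d divides e₀ and 0 < e₀ < r, so the character is nontrivial.
        d<r : d < r
        d<r = ≤-<-trans (∣⇒≤ {{ℕ.>-nonZero 0<e₀}} (gcdAll∣ mem₀)) (All.lookup small mem₀)
        1<N : 1 < N
        1<N = ℕₚ.*-cancelʳ-< d 1 N (subst₂ _<_ (sym (ℕₚ.*-identityˡ d)) r≡ d<r)
        0<N : 0 < N
        0<N = <-trans (s≤s z≤n) 1<N
        N∣r : N ∣ r
        N∣r = divides d (trans r≡ (ℕₚ.*-comm N d))
        gs = reduce d es
        c′ = d ℕ.* c
        c′N : c′ ℕ.* N ≡ length units
        c′N = trans (S.solve 3 (λ d c N → d S.:* c S.:* N S.:= c S.:* (N S.:* d)) refl d c N) (trans (cong (c ℕ.*_) (sym r≡)) rc)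
        χ : Fin q → Fin q
        χ x = gval gs x ^ c′
        open Fibres χ
        χ≡ : ∀ x → gval es x ^ c ≡ χ x
        χ≡ x = trans (cong (_^ c) (gval-reduce d es gcdAll∣ x)) (^-assocʳ (gval gs x) d c)
        inside-gs : All (λ p → proj₁ p ∈ ys) gs
        inside-gs = Allₚ.map⁺ inside
        nonzero : ∀ {x} → x ∈ outside → ¬ gval gs x ≡ 0#
        nonzero {x} m = gval-nonzero gs x (avoid inside-gs (outside-∉ m))
        image : ∀ x → x ∈ outside → χ x ∈ μ N
        image x m = ∈-μ N (trans (^-assocʳ (gval gs x) c′ N) (trans (cong (gval gs x ^_) c′N) (fermat (nonzero m))))
        -- N | k (e/d) for all e means r | k e for all e, hence r | k d by the gcd property, and d
        -- cancels.
        prim : ∀ k → (∀ {y ε} → (y , ε) ∈ gs → N ∣ k ℕ.* ε) → N ∣ k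
        prim k h = *-cancelʳ-∣ d (subst (_∣ k ℕ.* d) r≡ (∣k*gcdAll k es (λ {y} {e} m → subst₂ _∣_ (sym r≡)
          (trans (ℕₚ.*-assoc k (e / d) d) (cong (k ℕ.*_) (m/n*n≡m (gcdAll∣ m)))) (*-monoˡ-∣ d (h (∈-map⁺ (λ p → proj₁ p , proj₂ p / d) m))))))
        fibre≤ : ∀ t → N ℕ.* length (fibre outside t) ≤ q ℕ.+ Δ
        fibre≤ t = bound N c′ 0<N (∣⇒≤ {{ℕ.>-nonZero 0<r}} N∣r) (trans (cong suc c′N) length-units) gs
          (AllPairsₚ.map⁺ distinct) prim
          (≤-trans (size-reduce d es) (≤-trans (size≤ es small) (*-monoʳ-≤ r short))) a₀ (avoid inside-gs a₀∉ys)
          t (fibre outside t) (Uniqueₚ.filter⁺ _ outside-unique)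
          (λ m → let m′ , e = ∈-filter⁻ (λ x → χ x ≟ t) {xs = outside} m in nonzero m′ , e)

    module _ (v : Fin q → Fin q) (v^r : ∀ y → v y ^ r ≡ 1#) where

      -- `v y` is the inverse of the prescribed value of (y - x)^c; the pattern holds at x when all
      -- values are 1.
      value : Fin q → Fin q → Fin q
      value y x = (y - x) ^ c * v y

      leaf : Points → Fin q → Fin q
      leaf []             x = 1#
      leaf ((y , e) ∷ es) x = leaf es x * value y x ^ e

      private
        vprod : Points → Fin q
        vprod []             = 1#
        vprod ((y , e) ∷ es) = v y ^ e * vprod es

        leaf≡ : ∀ es x → leaf es x ≡ vprod es * gval es x ^ c
        leaf≡ []             x = sym (trans (*-identityˡ _) (1^ c))
        leaf≡ ((y , e) ∷ es) x = trans (cong₂ _*_ (leaf≡ es x) (trans (^-distrib-* ((y - x) ^ c) (v y) e)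
            (cong (_* v y ^ e) (trans (^-assocʳ (y - x) c e) (trans (cong ((y - x) ^_) (ℕₚ.*-comm c e)) (sym (^-assocʳ (y - x) e c)))))))
          (trans (solve 4 (λ p g a b → (p :* g) :* (a :* b) := (b :* p) :* (a :* g)) refl (vprod es) (gval es x ^ c) (((y - x) ^ e) ^ c) (v y ^ e))
            (cong ((v y ^ e * vprod es) *_) (sym (^-distrib-* ((y - x) ^ e) (gval es x) c))))
          where open Solver 𝔽

      -- The expansion with the exponents in `es` already chosen and those of `zs` still summed
      -- over, so that induction on `zs` can set the term e = 0 apart.
      total : List (Fin q) → Points → ℕ
      total zs es = ∑ outside (λ x → tree (map (λ y → value y x) zs) (leaf es x))

      total-step : ∀ y zs es → total (y ∷ zs) es ≡ ∑ (upTo r) (λ k → total zs ((y , k) ∷ es))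
      total-step y zs es = trans
        (∑-cong outside (λ x _ → ∑-applyUpTo (value y x ^_) r (λ z → tree (map (λ y → value y x) zs) (leaf es x * z))))
        (∑-swap outside (upTo r) (λ x k → tree (map (λ y → value y x) zs) (leaf ((y , k) ∷ es) x)))

      record Remaining (zs : List (Fin q)) (es : Points) : Set where
        field
          exps  : Exponents es
          fresh : Unique zs
          apart : All (λ z → All (λ p → ¬ z ≡ proj₁ p) es) zs
          mem   : All (_∈ ys) zs
          short : length zs ℕ.+ length es ≤ n

      next : ∀ {y zs es} k → k < r → Remaining (y ∷ zs) es → Remaining zs ((y , k) ∷ es)
      next {y} {zs} {es} k k<r rem = record
        { exps = record { distinct = All.head R.apart ∷ E.distinct ; inside = All.head R.mem ∷ E.inside ; small = k<r ∷ E.small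
                        ; short = ≤-trans (s≤s (m≤n+m (length es) (length zs))) R.short }
        ; fresh = AllPairs.tail R.fresh
        ; apart = All.zipWith (λ (n , a) → (n ∘ sym) ∷ a) (AllPairs.head R.fresh , All.tail R.apart)
        ; mem = All.tail R.mem
        ; short = subst (_≤ n) (sym (ℕₚ.+-suc (length zs) (length es))) R.short }
        where module R = Remaining rem
              module E = Exponents R.exps

      Q : ℕ
      Q = (q ℕ.+ Δ) ℕ.* K

      -- A positive exponent, once chosen, stays in the list, so `weil` applies to every choice of
      -- the remaining ones.
      total-nontrivial : ∀ zs es → Remaining zs es → ∀ {y₀ e₀} → (y₀ , e₀) ∈ es → 0 < e₀ → total zs es ≤ r ℕ.^ length zs ℕ.* Q
      total-nontrivial []       es rem m pos = subst₂ _≤_ (sym (∑-cong outside (λ x _ → cong w (leaf≡ es x)))) (sym (ℕₚ.+-identityʳ Q))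
        (weil es (Remaining.exps rem) m pos (vprod es))
      total-nontrivial (z ∷ zs) es rem m pos = begin
        total (z ∷ zs) es ≡⟨ total-step z zs es ⟩
        ∑ (upTo r) (λ k → total zs ((z , k) ∷ es)) ≤⟨ ∑-mono (upTo r) (λ k mk → total-nontrivial zs ((z , k) ∷ es) (next k (∈-upTo⁻ mk) rem) (there m) pos) ⟩
        ∑ (upTo r) (λ _ → r ℕ.^ length zs ℕ.* Q) ≡⟨ trans (∑-const (upTo r) _) (trans (cong (ℕ._* (r ℕ.^ length zs ℕ.* Q)) (length-applyUpTo id r)) (sym (ℕₚ.*-assoc r _ Q))) ⟩
        r ℕ.^ suc (length zs) ℕ.* Q ∎
        where open ℕₚ.≤-Reasoning

      -- Among the remaining choices only e = 0 is trivial; each of the others costs at most `Q`.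
      -- Adding `Q` on the left avoids the subtraction in r^|zs| - 1.
      total-trivial : ∀ zs es → Remaining zs es → All (λ p → proj₂ p ≡ 0) es →
        total zs es ℕ.+ Q ≤ length outside ℕ.* w 1# ℕ.+ r ℕ.^ length zs ℕ.* Q
      total-trivial []       es rem zeros = ≤-reflexive (cong₂ ℕ._+_
        (trans (∑-cong outside (λ x _ → cong w (leaf-one es zeros x))) (∑-const outside (w 1#))) (sym (ℕₚ.+-identityʳ Q)))
        where
          leaf-one : ∀ es → All (λ p → proj₂ p ≡ 0) es → ∀ x → leaf es x ≡ 1#
          leaf-one []             []       x = refl
          leaf-one ((y , .0) ∷ es) (refl ∷ h) x = trans (*-identityʳ _) (leaf-one es h x)
      total-trivial (z ∷ zs) es rem zeros = begin
        total (z ∷ zs) es ℕ.+ Q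
          ≡⟨ cong (ℕ._+ Q) (trans (total-step z zs es) (cong (λ m → ∑ (upTo m) f) (sym sr))) ⟩
        f 0 ℕ.+ ∑ (applyUpTo suc r′) f ℕ.+ Q
          ≤⟨ +-monoˡ-≤ Q (+-monoʳ-≤ (f 0) tail≤) ⟩
        f 0 ℕ.+ r′ ℕ.* (R ℕ.* Q) ℕ.+ Q
          ≡⟨ S.solve 3 (λ a b c → a S.:+ b S.:+ c S.:= (a S.:+ c) S.:+ b) refl (f 0) (r′ ℕ.* (R ℕ.* Q)) Q ⟩
        (f 0 ℕ.+ Q) ℕ.+ r′ ℕ.* (R ℕ.* Q)
          ≤⟨ +-monoˡ-≤ _ (total-trivial zs ((z , 0) ∷ es) (next 0 0<r rem) (refl ∷ zeros)) ⟩
        (length outside ℕ.* w 1# ℕ.+ R ℕ.* Q) ℕ.+ r′ ℕ.* (R ℕ.* Q)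
          ≡⟨ trans (ℕₚ.+-assoc (length outside ℕ.* w 1#) (R ℕ.* Q) _) (cong (length outside ℕ.* w 1# ℕ.+_) (sym (trans (cong (λ m → m ℕ.* R ℕ.* Q) (sym sr)) (ℕₚ.*-assoc (suc r′) R Q)))) ⟩
        length outside ℕ.* w 1# ℕ.+ r ℕ.* R ℕ.* Q ∎
        where
          open ℕₚ.≤-Reasoning
          module S = +-*-Solver
          R = r ℕ.^ length zs
          r′ = r ℕ.∸ 1
          sr : suc r′ ≡ r
          sr = m+[n∸m]≡n 0<r
          f : ℕ → ℕ
          f k = total zs ((z , k) ∷ es)
          tail≤ : ∑ (applyUpTo suc r′) f ≤ r′ ℕ.* (R ℕ.* Q)
          tail≤ = ≤-trans (≤-reflexive (∑-applyUpTo suc r′ f))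
            (≤-trans (∑-mono (upTo r′) (λ k mk → total-nontrivial zs ((z , suc k) ∷ es) (next (suc k) (subst (suc k <_) sr (s≤s (∈-upTo⁻ mk))) rem) (here refl) (s≤s z≤n)))
              (≤-reflexive (trans (∑-const (upTo r′) _) (cong (ℕ._* (R ℕ.* Q)) (length-applyUpTo id r′)))))

      private
        value^r : ∀ {x} → x ∈ outside → All (λ t → t ^ r ≡ 1#) (map (λ y → value y x) ys)
        value^r {x} m = Allₚ.map⁺ (All.tabulate (λ {y} my → trans (^-distrib-* ((y - x) ^ c) (v y) r)
          (trans (cong₂ _*_ (trans (^-assocʳ (y - x) c r) (trans (cong ((y - x) ^_) rc)
            (fermat (Irreducibility.y-a≢0 F (λ e → outside-∉ m (subst (_∈ ys) e my)))))) (v^r y)) (*-identityˡ 1#))))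

      -- If the pattern fails at all `O` points, `tree-nontrivial` makes the total exactly O R K. It
      -- is also at most O (K - 1) + (R - 1)(O K + G). Comparison leaves O ≤ R G.
      pattern-exists : r ℕ.^ n ℕ.* ((n ℕ.+ Δ) ℕ.* K) < length outside → ∃ λ x → x ∉ ys × (∀ {y} → y ∈ ys → (y - x) ^ c * v y ≡ 1#)
      pattern-exists big with any? (λ x → All.all? (λ t → t ≟ 1#) (map (λ y → value y x) ys)) outside
      ... | yes found = let x , m , a = find found in x , outside-∉ m , λ my → All.lookup (Allₚ.map⁻ a) my
      ... | no none = ⊥-elim (<⇒≱ big small′)
        where
          module S = +-*-Solver
          O = length outside
          R = r ℕ.^ n
          G = (n ℕ.+ Δ) ℕ.* K
          all-bad : total ys [] ≡ O ℕ.* (R ℕ.* K)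
          all-bad = trans (∑-cong outside (λ x m → trans (tree-nontrivial _ (value^r m) (λ a → none (lose m a)) 1#)
            (cong (λ l → r ℕ.^ l ℕ.* K) (length-map (λ y → value y x) ys)))) (∑-const outside _)
          initially : Remaining ys []
          initially = record { exps = record { distinct = [] ; inside = [] ; small = [] ; short = z≤n } ; fresh = unique
            ; apart = All.tabulate (λ _ → []) ; mem = All.tabulate id ; short = ≤-reflexive (ℕₚ.+-identityʳ n) }
          Q≡ : Q ≡ O ℕ.* K ℕ.+ G
          Q≡ = trans (cong (λ x → (x ℕ.+ Δ) ℕ.* K) (sym length-outside))
            (S.solve 4 (λ o n d k → (o S.:+ n S.:+ d) S.:* k S.:= o S.:* k S.:+ (n S.:+ d) S.:* k) refl O n Δ K)
          small′ : O ≤ R ℕ.* G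
          small′ = ℕₚ.+-cancelˡ-≤ (O ℕ.* (R ℕ.* K) ℕ.+ O ℕ.* w 1#) _ _ (begin
            O ℕ.* (R ℕ.* K) ℕ.+ O ℕ.* w 1# ℕ.+ O
              ≡⟨ S.solve 3 (λ a o w → a S.:+ o S.:* w S.:+ o S.:= a S.:+ o S.:* (S.con 1 S.:+ w)) refl (O ℕ.* (R ℕ.* K)) O (w 1#) ⟩
            O ℕ.* (R ℕ.* K) ℕ.+ O ℕ.* suc (w 1#)
              ≡⟨ cong (λ x → O ℕ.* (R ℕ.* K) ℕ.+ O ℕ.* x) w-one ⟩
            O ℕ.* (R ℕ.* K) ℕ.+ O ℕ.* K
              ≤⟨ +-monoʳ-≤ (O ℕ.* (R ℕ.* K)) (≤-trans (m≤m+n (O ℕ.* K) G) (≤-reflexive (sym Q≡))) ⟩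
            O ℕ.* (R ℕ.* K) ℕ.+ Q
              ≡⟨ cong (ℕ._+ Q) all-bad ⟨
            total ys [] ℕ.+ Q
              ≤⟨ total-trivial ys [] initially [] ⟩
            O ℕ.* w 1# ℕ.+ R ℕ.* Q
              ≡⟨ cong (λ x → O ℕ.* w 1# ℕ.+ R ℕ.* x) Q≡ ⟩
            O ℕ.* w 1# ℕ.+ R ℕ.* (O ℕ.* K ℕ.+ G)
              ≡⟨ S.solve 5 (λ o w r k g → o S.:* w S.:+ r S.:* (o S.:* k S.:+ g) S.:= o S.:* (r S.:* k) S.:+ o S.:* w S.:+ r S.:* g) refl O (w 1#) R K G ⟩
            O ℕ.* (R ℕ.* K) ℕ.+ O ℕ.* w 1# ℕ.+ R ℕ.* G ∎)
            where open ℕₚ.≤-Reasoning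

-- Choice of the parameters

module Arithmetic where
  open import Data.Nat using (_+_; _*_; _^_; _∸_)
  open +-*-Solver using (solve; con; _:+_; _:*_; _:=_)
  open ℕₚ.≤-Reasoning

  sq-reflect-≤ : ∀ {a b} → a * a < suc b * suc b → a ≤ b
  sq-reflect-≤ {a} {b} l = ℕₚ.≮⇒≥ (λ g → <⇒≱ l (*-mono-≤ g g))

  isqrt : ∀ q → ∃ λ k → k * k ≤ q × q < suc k * suc k
  isqrt zero    = 0 , z≤n , s≤s z≤n
  isqrt (suc q) with isqrt q
  ... | k , l , u with suc k * suc k ℕ.≤? suc q
  ...   | no  g = k , ℕₚ.m≤n⇒m≤1+n l , ≰⇒> g
  ...   | yes g = suc k , g , <-≤-trans (s≤s u) (begin
            suc (suc k * suc k)        ≤⟨ s≤s (*-mono-≤ (ℕₚ.n≤1+n (suc k)) (≤-refl {suc k})) ⟩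
            suc (suc (suc k) * suc k)  ≤⟨ ℕₚ.m<m+n (suc (suc k) * suc k) {suc (suc k)} (s≤s z≤n) ⟩
            suc (suc k) * suc k + suc (suc k) ≡⟨ solve 1 (λ k → (con 2 :+ k) :* (con 1 :+ k) :+ (con 2 :+ k) := (con 2 :+ k) :* (con 2 :+ k)) refl k ⟩
            suc (suc k) * suc (suc k)  ∎)

  n<2^n : ∀ n → suc n ≤ 2 ^ n
  n<2^n zero    = s≤s z≤n
  n<2^n (suc n) = begin
    suc (suc n)         ≡⟨ cong suc (ℕₚ.+-comm 1 n) ⟩
    suc n + 1           ≤⟨ +-mono-≤ (n<2^n n) (≤-trans (s≤s z≤n) (n<2^n n)) ⟩
    2 ^ n + 2 ^ n       ≡⟨ cong (2 ^ n +_) (ℕₚ.+-identityʳ (2 ^ n)) ⟨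
    2 ^ suc n           ∎

  ^-distribʳ-* : ∀ b x y → (x * y) ^ b ≡ x ^ b * y ^ b
  ^-distribʳ-* zero    x y = refl
  ^-distribʳ-* (suc b) x y = trans (cong (x * y *_) (^-distribʳ-* b x y))
    (solve 4 (λ x y u v → (x :* y) :* (u :* v) := (x :* u) :* (y :* v)) refl x y (x ^ b) (y ^ b))

  -- Apply k + 1 ≤ 2ᵏ to k = n / b.
  poly≤exp : ∀ b .{{_ : ℕ.NonZero b}} n → suc n ^ b ≤ b ^ b * 2 ^ n
  poly≤exp b n = begin
    suc n ^ b                       ≤⟨ ^-monoˡ-≤ b le ⟩
    (b * suc (n / b)) ^ b           ≡⟨ ^-distribʳ-* b b (suc (n / b)) ⟩
    b ^ b * suc (n / b) ^ b         ≤⟨ *-monoʳ-≤ (b ^ b) (^-monoˡ-≤ b (n<2^n (n / b))) ⟩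
    b ^ b * (2 ^ (n / b)) ^ b       ≡⟨ cong (b ^ b *_) (ℕₚ.^-*-assoc 2 (n / b) b) ⟩
    b ^ b * 2 ^ (n / b * b)         ≤⟨ *-monoʳ-≤ (b ^ b) (^-monoʳ-≤ 2 (m/n*n≤m n b)) ⟩
    b ^ b * 2 ^ n                   ∎
    where
      le : suc n ≤ b * suc (n / b)
      le = begin
        suc n                     ≡⟨ cong suc (m≡m%n+[m/n]*n n b) ⟩
        suc (n % b) + n / b * b   ≤⟨ +-monoˡ-≤ (n / b * b) (m%n<n n b) ⟩
        b + n / b * b             ≡⟨ solve 2 (λ b k → b :+ k :* b := b :* (con 1 :+ k)) refl b (n / b) ⟩
        b * suc (n / b)           ∎

  module Threshold (r : ℕ) (1<r : 1 < r) where

    -- `β` is chosen so that `lim` started at q / β stays below q. In `Λ`, the second factor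
    -- dominates the coefficients of the linear functions of n that arise from the parameters, and 2
    -- ^ r is the mean weight `K`.
    β Λ : ℕ
    β = 2 * suc r ^ r
    Λ = 2 ^ r * (6 + 4 * r + 8 * β * (r * r) + 32 * β)

    bound : ℕ → ℕ
    bound n = Λ * suc n

    -- (Λ b)^(2b) is the constant that is left of `bound n ^ (2 * b)` once its growth in n has been
    -- absorbed into 4ⁿ.
    q₀ : ℕ → ℕ
    q₀ b = suc ((Λ * b) ^ (2 * b))

    private
      square : ∀ x b → x ^ (2 * b) ≡ x ^ b * x ^ b
      square x b = trans (ℕₚ.^-distribˡ-+-* x b (b + 0)) (cong (λ y → x ^ b * x ^ y) (ℕₚ.+-identityʳ b))

    -- The hypothesis is r^(2n) ≤ q^(1 - 2a/b), which leaves the factor q^(2a/b) for the square of D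
    -- = bound n. Since 4ⁿ ≤ r^(2n) ≤ q, this is enough: D^(2b) ≤ (Λ b)^(2b) 4ⁿ < q² ≤ q^(2a).
    large : ∀ a b → 1 ≤ a → 2 * a < b → ∀ q → q₀ b ≤ q → ∀ n → r ^ (2 * b * n) ≤ q ^ (b ∸ 2 * a) →
      r ^ (2 * n) * (bound n * bound n) < q
    large a b 1≤a 2a<b q q₀≤q n hyp = ≰⇒> contra
      where
        instance
          b≢0 : ℕ.NonZero b
          b≢0 = ℕ.>-nonZero (≤-<-trans z≤n 2a<b)
          q≢0 : ℕ.NonZero q
          q≢0 = ℕ.>-nonZero (<-≤-trans (s≤s z≤n) q₀≤q)
        D = bound n
        e = b ∸ 2 * a
        e+2a : e + 2 * a ≡ b
        e+2a = ℕₚ.m∸n+n≡m (<⇒≤ 2a<b)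
        r2n : (r ^ (2 * n)) ^ b ≡ r ^ (2 * b * n)
        r2n = trans (ℕₚ.^-*-assoc r (2 * n) b) (cong (r ^_) (solve 2 (λ n b → con 2 :* n :* b := con 2 :* b :* n) refl n b))
        4^n≤q : 2 ^ n * 2 ^ n ≤ q
        4^n≤q = ≤-trans (≤-reflexive (sym (square 2 n))) (≤-trans (^-monoˡ-≤ (2 * n) 1<r)
          (ℕₚ.≮⇒≥ (λ g → <⇒≱ (ℕₚ.^-monoˡ-< b g) (begin
            (r ^ (2 * n)) ^ b ≡⟨ r2n ⟩
            r ^ (2 * b * n) ≤⟨ hyp ⟩
            q ^ e ≤⟨ ^-monoʳ-≤ q (m∸n≤m b (2 * a)) ⟩
            q ^ b ∎))))
        D^b : D ^ b ≤ (Λ * b) ^ b * 2 ^ n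
        D^b = begin
          (Λ * suc n) ^ b          ≡⟨ ^-distribʳ-* b Λ (suc n) ⟩
          Λ ^ b * suc n ^ b        ≤⟨ *-monoʳ-≤ (Λ ^ b) (poly≤exp b n) ⟩
          Λ ^ b * (b ^ b * 2 ^ n)  ≡⟨ ℕₚ.*-assoc (Λ ^ b) (b ^ b) (2 ^ n) ⟨
          Λ ^ b * b ^ b * 2 ^ n    ≡⟨ cong (_* 2 ^ n) (^-distribʳ-* b Λ b) ⟨
          (Λ * b) ^ b * 2 ^ n      ∎
        D^2b : D ^ (2 * b) < q ^ (2 * a)
        D^2b = begin-strict
          D ^ (2 * b)                             ≡⟨ square D b ⟩
          D ^ b * D ^ b                           ≤⟨ *-mono-≤ D^b D^b ⟩
          (E * 2 ^ n) * (E * 2 ^ n)               ≡⟨ solve 2 (λ e t → (e :* t) :* (e :* t) := (e :* e) :* (t :* t)) refl E (2 ^ n) ⟩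
          (E * E) * (2 ^ n * 2 ^ n)               ≤⟨ *-monoʳ-≤ (E * E) 4^n≤q ⟩
          (E * E) * q                             <⟨ ℕₚ.*-monoˡ-< q (<-≤-trans (s≤s (≤-reflexive (sym (square (Λ * b) b)))) q₀≤q) ⟩
          q * q                                   ≡⟨ cong (q *_) (ℕₚ.*-identityʳ q) ⟨
          q ^ 2                                   ≤⟨ ^-monoʳ-≤ q (*-monoʳ-≤ 2 1≤a) ⟩
          q ^ (2 * a)                             ∎
          where E = (Λ * b) ^ b
        contra : ¬ q ≤ r ^ (2 * n) * (D * D)
        contra l = <⇒≱ D^2b (ℕₚ.*-cancelˡ-≤ (q ^ e) {{m^n≢0 q e}} (begin
          q ^ e * q ^ (2 * a)            ≡⟨ trans (sym (ℕₚ.^-distribˡ-+-* q e (2 * a))) (cong (q ^_) e+2a) ⟩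
          q ^ b                          ≤⟨ ^-monoˡ-≤ b l ⟩
          (r ^ (2 * n) * (D * D)) ^ b    ≡⟨ trans (^-distribʳ-* b (r ^ (2 * n)) (D * D)) (cong₂ _*_ r2n (trans (^-distribʳ-* b D D) (sym (square D b)))) ⟩
          r ^ (2 * b * n) * D ^ (2 * b)  ≤⟨ *-monoˡ-≤ (D ^ (2 * b)) hyp ⟩
          q ^ e * D ^ (2 * b)            ∎))

    module Parameters (q n : ℕ) (big : r ^ (2 * n) * (bound n * bound n) < q) where

      D : ℕ
      D = bound n

      instance
        r≢0 : ℕ.NonZero r
        r≢0 = ℕ.>-nonZero (<-trans (s≤s z≤n) 1<r)
        β≢0 : ℕ.NonZero β
        β≢0 = ℕₚ.m*n≢0 2 (suc r ^ r) {{_}} {{m^n≢0 (suc r) r}}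
        2^r≢0 : ℕ.NonZero (2 ^ r)
        2^r≢0 = m^n≢0 2 r

      D²<q : D * D < q
      D²<q = ≤-<-trans (subst (_≤ r ^ (2 * n) * (D * D)) (ℕₚ.*-identityˡ (D * D)) (*-monoˡ-≤ (D * D) (ℕ.>-nonZero⁻¹ (r ^ (2 * n)) {{m^n≢0 r (2 * n)}}))) big

      0<q : 0 < q
      0<q = ≤-<-trans z≤n D²<q

      -- k is the integral part of √q. With M = N k and J = k, the main terms of conditions and
      -- unknowns would both be N k B; κ is the excess in J that pays for the lower terms. Division
      -- of the degree by k then leaves Δ, of order n √q for fixed r.
      k κ B J Δ : ℕ
      k = proj₁ (isqrt q)
      κ = 2 * β * (4 + r * r * n)
      B = q / β
      J = k + κ
      Δ = 4 * k * (κ + r * n + 1)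

      k²≤q : k * k ≤ q
      k²≤q = proj₁ (proj₂ (isqrt q))

      q<sk² : q < suc k * suc k
      q<sk² = proj₂ (proj₂ (isqrt q))

      D≤k : D ≤ k
      D≤k = sq-reflect-≤ (<-trans D²<q q<sk²)

      private
        c₁ : ℕ
        c₁ = 6 + 4 * r + 8 * β * (r * r) + 32 * β

        c₁≤D : c₁ * suc n ≤ D
        c₁≤D = *-monoˡ-≤ (suc n) (subst (_≤ Λ) (ℕₚ.*-identityˡ c₁) (*-monoˡ-≤ c₁ (ℕ.>-nonZero⁻¹ (2 ^ r))))

        below : ∀ {x} y → x + y ≡ c₁ * suc n → x ≤ D
        below {x} y e = ≤-trans (subst (x ≤_) e (m≤m+n x y)) c₁≤D

      κ≤k : κ ≤ k
      κ≤k = ≤-trans (below (6 + 4 * r + 24 * β + 8 * β * (r * r) + n * (6 + 4 * r + 6 * β * (r * r) + 32 * β))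
        (solve 3 (λ b r n → con 2 :* b :* (con 4 :+ r :* r :* n) :+ (con 6 :+ con 4 :* r :+ con 24 :* b :+ con 8 :* b :* (r :* r) :+ n :* (con 6 :+ con 4 :* r :+ con 6 :* b :* (r :* r) :+ con 32 :* b))
           := (con 6 :+ con 4 :* r :+ con 8 :* b :* (r :* r) :+ con 32 :* b) :* (con 1 :+ n)) refl β r n)) D≤k

      r≤D : r ≤ D
      r≤D = below (6 + 3 * r + 8 * β * (r * r) + 32 * β + n * c₁)
        (solve 3 (λ b r n → r :+ (con 6 :+ con 3 :* r :+ con 8 :* b :* (r :* r) :+ con 32 :* b :+ n :* (con 6 :+ con 4 :* r :+ con 8 :* b :* (r :* r) :+ con 32 :* b))
           := (con 6 :+ con 4 :* r :+ con 8 :* b :* (r :* r) :+ con 32 :* b) :* (con 1 :+ n)) refl β r n)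

      rn≤D : r * n + 1 ≤ D
      rn≤D = below (5 + 4 * r + 8 * β * (r * r) + 32 * β + n * (6 + 3 * r + 8 * β * (r * r) + 32 * β))
        (solve 3 (λ b r n → (r :* n :+ con 1) :+ (con 5 :+ con 4 :* r :+ con 8 :* b :* (r :* r) :+ con 32 :* b :+ n :* (con 6 :+ con 3 :* r :+ con 8 :* b :* (r :* r) :+ con 32 :* b))
           := (con 6 :+ con 4 :* r :+ con 8 :* b :* (r :* r) :+ con 32 :* b) :* (con 1 :+ n)) refl β r n)

      β≤D : β ≤ D
      β≤D = below (6 + 4 * r + 8 * β * (r * r) + 31 * β + n * c₁)
        (solve 3 (λ b r n → b :+ (con 6 :+ con 4 :* r :+ con 8 :* b :* (r :* r) :+ con 31 :* b :+ n :* (con 6 :+ con 4 :* r :+ con 8 :* b :* (r :* r) :+ con 32 :* b))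
           := (con 6 :+ con 4 :* r :+ con 8 :* b :* (r :* r) :+ con 32 :* b) :* (con 1 :+ n)) refl β r n)

      1≤k : 1 ≤ k
      1≤k = ≤-trans (≤-trans (ℕ.>-nonZero⁻¹ r) r≤D) D≤k

      rn<B : r * n + 1 ≤ B
      rn<B = subst (_≤ B) (m*n/n≡m (r * n + 1) β) (/-monoˡ-≤ β (≤-trans (*-mono-≤ rn≤D β≤D) (<⇒≤ D²<q)))

      1≤B : 1 ≤ B
      1≤B = ≤-trans (m≤n+m 1 (r * n)) rn<B

      q≤2βB : q ≤ 2 * β * B
      q≤2βB = begin
        q                   ≡⟨ m≡m%n+[m/n]*n q β ⟩
        q % β + B * β       ≤⟨ +-monoˡ-≤ (B * β) (<⇒≤ (m%n<n q β)) ⟩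
        β + B * β           ≤⟨ +-monoˡ-≤ (B * β) (subst (_≤ B * β) (ℕₚ.*-identityˡ β) (*-monoˡ-≤ β 1≤B)) ⟩
        B * β + B * β       ≡⟨ solve 2 (λ b β → b :* β :+ b :* β := con 2 :* β :* b) refl B β ⟩
        2 * β * B           ∎

      n<q : n < q
      n<q = ≤-<-trans (≤-trans (≤-trans (ℕₚ.m≤n*m n r) (m≤m+n (r * n) 1)) (≤-trans rn≤D (ℕₚ.m≤m*n D D {{ℕ.>-nonZero (<-≤-trans (ℕ.>-nonZero⁻¹ r) r≤D)}}))) D²<q

      module _ (N m : ℕ) (0<N : 0 < N) (N≤r : N ≤ r) (m≤rn : m ≤ r * n) where

        instance
          N≢0 : ℕ.NonZero N
          N≢0 = ℕ.>-nonZero 0<N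
          k≢0 : ℕ.NonZero k
          k≢0 = ℕ.>-nonZero 1≤k

        M′ : ℕ
        M′ = N * k ∸ 1

        M≡ : suc M′ ≡ N * k
        M≡ = m+[n∸m]≡n (*-mono-≤ 0<N 1≤k)

        M≤q : suc M′ ≤ q
        M≤q = begin
          suc M′ ≡⟨ M≡ ⟩
          N * k  ≤⟨ *-monoˡ-≤ k (≤-trans N≤r (≤-trans r≤D D≤k)) ⟩
          k * k  ≤⟨ k²≤q ⟩
          q      ∎

        -- Once N k B is removed from both sides, k² (3 + r² n) < κ B remains; κ was made for this,
        -- as k² ≤ q ≤ 2 β B.
        many : suc M′ * suc (B + (J + M′ * m)) < J * (N * B)
        many = begin-strict
          suc M′ * suc (B + (J + M′ * m))
            ≡⟨ cong (_* suc (B + (J + M′ * m))) M≡ ⟩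
          N * k * suc (B + (J + M′ * m))
            ≤⟨ *-monoʳ-≤ (N * k) (s≤s (+-monoʳ-≤ B (+-mono-≤ (+-monoʳ-≤ k κ≤k) M′m))) ⟩
          N * k * suc (B + (k + k + r * k * (r * n)))
            ≤⟨ *-monoʳ-≤ (N * k) (+-monoˡ-≤ (B + (k + k + r * k * (r * n))) 1≤k) ⟩
          N * k * (k + (B + (k + k + r * k * (r * n))))
            ≡⟨ solve 5 (λ N k B r n → N :* k :* (k :+ (B :+ (k :+ k :+ r :* k :* (r :* n)))) := N :* (k :* B :+ (k :* k) :* (con 3 :+ r :* r :* n))) refl N k B r n ⟩
          N * (k * B + (k * k) * (3 + r * r * n))
            <⟨ ℕₚ.*-monoʳ-< N (ℕₚ.+-monoʳ-< (k * B) key) ⟩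
          N * (k * B + κ * B)
            ≡⟨ solve 4 (λ N k κ B → N :* (k :* B :+ κ :* B) := (k :+ κ) :* (N :* B)) refl N k κ B ⟩
          J * (N * B) ∎
          where
            M′m : M′ * m ≤ r * k * (r * n)
            M′m = *-mono-≤ (≤-trans (m∸n≤m (N * k) 1) (*-monoˡ-≤ k N≤r)) m≤rn
            key : (k * k) * (3 + r * r * n) < κ * B
            key = begin-strict
              (k * k) * (3 + r * r * n) ≤⟨ *-monoˡ-≤ (3 + r * r * n) k²≤q ⟩
              q * (3 + r * r * n)       <⟨ ℕₚ.*-monoʳ-< q {{ℕ.>-nonZero 0<q}} (n<1+n (3 + r * r * n)) ⟩
              q * (4 + r * r * n)       ≤⟨ *-monoˡ-≤ (4 + r * r * n) q≤2βB ⟩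
              2 * β * B * (4 + r * r * n) ≡⟨ solve 3 (λ b B x → b :* B :* x := b :* x :* B) refl (2 * β) B (4 + r * r * n) ⟩
              κ * B                     ∎

        -- As M = N k, the factor k can be cancelled at the end; q ≤ 4 k² exhibits it in the error
        -- term.
        conclude : ∀ s → s * suc M′ ≤ J * q + (q * m + B) → N * s ≤ q + Δ
        conclude s h = ℕₚ.*-cancelʳ-≤ _ _ k (begin
          N * s * k                          ≡⟨ solve 3 (λ N s k → N :* s :* k := s :* (N :* k)) refl N s k ⟩
          s * (N * k)                        ≡⟨ cong (s *_) M≡ ⟨
          s * suc M′                         ≤⟨ h ⟩
          J * q + (q * m + B)                ≤⟨ +-monoʳ-≤ (J * q) (+-mono-≤ (*-monoʳ-≤ q m≤rn) B≤q) ⟩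
          J * q + (q * (r * n) + q)          ≡⟨ solve 5 (λ q k κ r n → (k :+ κ) :* q :+ (q :* (r :* n) :+ q) := q :* k :+ q :* (κ :+ r :* n :+ con 1)) refl q k κ r n ⟩
          q * k + q * (κ + r * n + 1)        ≤⟨ +-monoʳ-≤ (q * k) (*-monoˡ-≤ (κ + r * n + 1) q≤4k²) ⟩
          q * k + 4 * (k * k) * (κ + r * n + 1) ≡⟨ solve 3 (λ q k x → q :* k :+ con 4 :* (k :* k) :* x := (q :+ con 4 :* k :* x) :* k) refl q k (κ + r * n + 1) ⟩
          (q + Δ) * k                        ∎)
          where
            B≤q : B ≤ q
            B≤q = m/n≤m q β
            q≤4k² : q ≤ 4 * (k * k)
            q≤4k² = begin
              q                     ≤⟨ <⇒≤ q<sk² ⟩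
              suc k * suc k         ≤⟨ *-mono-≤ (+-monoˡ-≤ k 1≤k) (+-monoˡ-≤ k 1≤k) ⟩
              (k + k) * (k + k)     ≡⟨ solve 1 (λ k → (k :+ k) :* (k :+ k) := con 4 :* (k :* k)) refl k ⟩
              4 * (k * k)           ∎

        -- The condition m ≤ d is preserved by d ↦ N d + m, which is then at most (N + 1) d.
        lim-bound : ∀ (lim : ℕ → ℕ → ℕ) → (∀ d → lim 0 d ≡ d) → (∀ j d → lim (suc j) d ≡ lim j (N * d + m)) → lim (N ∸ 1) B < q
        lim-bound lim l0 ls = begin-strict
          lim (N ∸ 1) B          ≤⟨ iterate (N ∸ 1) B (≤-trans m≤rn (≤-trans (m≤m+n (r * n) 1) rn<B)) ⟩
          suc N ^ (N ∸ 1) * B    ≤⟨ *-monoˡ-≤ B (≤-trans (^-monoˡ-≤ (N ∸ 1) (s≤s N≤r)) (^-monoʳ-≤ (suc r) (≤-trans (m∸n≤m N 1) N≤r))) ⟩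
          P * B                  <⟨ ℕₚ.m<m+n (P * B) {P * B} (*-mono-≤ (ℕ.>-nonZero⁻¹ P {{m^n≢0 (suc r) r}}) 1≤B) ⟩
          P * B + P * B          ≡⟨ solve 2 (λ p b → p :* b :+ p :* b := b :* (con 2 :* p)) refl P B ⟩
          B * β                  ≤⟨ m/n*n≤m q β ⟩
          q                      ∎
          where
            P = suc r ^ r
            iterate : ∀ j d → m ≤ d → lim j d ≤ suc N ^ j * d
            iterate zero    d l = ≤-reflexive (trans (l0 d) (sym (ℕₚ.+-identityʳ d)))
            iterate (suc j) d l = begin
              lim (suc j) d             ≡⟨ ls j d ⟩
              lim j (N * d + m)         ≤⟨ iterate j (N * d + m) (m≤n+m m (N * d)) ⟩
              suc N ^ j * (N * d + m)   ≤⟨ *-monoʳ-≤ (suc N ^ j) (≤-trans (+-monoʳ-≤ (N * d) l) (≤-reflexive (ℕₚ.+-comm (N * d) d))) ⟩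
              suc N ^ j * (suc N * d)   ≡⟨ solve 3 (λ x N d → x :* (N :* d) := (N :* x) :* d) refl (suc N ^ j) (suc N) d ⟩
              suc N ^ suc j * d         ∎

      -- The left side is at most r^n k D with k ≤ √q, up to the summand n, and `big` says that r^n
      -- D < √q.
      enough : ∀ o → o + n ≡ q → r ^ n * ((n + Δ) * 2 ^ r) < o
      enough o on = ℕₚ.+-cancelʳ-< n _ _ (subst (r ^ n * ((n + Δ) * 2 ^ r) + n <_) (sym on) (≤-<-trans step₁ step₂))
        where
          R = r ^ n
          T = 2 ^ r
          step₁ : R * ((n + Δ) * T) + n ≤ R * k * D
          step₁ = begin
            R * ((n + Δ) * T) + n
              ≤⟨ +-mono-≤ (*-monoʳ-≤ R (*-monoˡ-≤ T (+-monoˡ-≤ Δ n≤nk))) n≤ ⟩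
            R * ((n * k + Δ) * T) + R * (n * k * T)
              ≡⟨ solve 5 (λ R n k T y → R :* ((n :* k :+ con 4 :* k :* y) :* T) :+ R :* (n :* k :* T) := R :* k :* (T :* (con 2 :* n :+ con 4 :* y))) refl R n k T (κ + r * n + 1) ⟩
            R * k * (T * (2 * n + 4 * (κ + r * n + 1)))
              ≤⟨ *-monoʳ-≤ (R * k) (*-monoʳ-≤ T linear) ⟩
            R * k * (T * (c₁ * suc n))
              ≡⟨ cong (R * k *_) (sym (ℕₚ.*-assoc T c₁ (suc n))) ⟩
            R * k * D ∎
            where
              n≤nk : n ≤ n * k
              n≤nk = ℕₚ.m≤m*n n k {{ℕ.>-nonZero 1≤k}}
              n≤ : n ≤ R * (n * k * T)
              n≤ = ≤-trans n≤nk (≤-trans (ℕₚ.m≤m*n (n * k) T) (ℕₚ.m≤n*m (n * k * T) R {{m^n≢0 r n}}))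
              linear : 2 * n + 4 * (κ + r * n + 1) ≤ c₁ * suc n
              linear = subst (2 * n + 4 * (κ + r * n + 1) ≤_)
                (solve 3 (λ b r n → (con 2 :* n :+ con 4 :* (con 2 :* b :* (con 4 :+ r :* r :* n) :+ r :* n :+ con 1)) :+ (con 2 :+ con 4 :* r :+ con 8 :* b :* (r :* r) :+ n :* (con 4 :+ con 32 :* b))
                   := (con 6 :+ con 4 :* r :+ con 8 :* b :* (r :* r) :+ con 32 :* b) :* (con 1 :+ n)) refl β r n)
                (m≤m+n _ (2 + 4 * r + 8 * β * (r * r) + n * (4 + 32 * β)))
          step₂ : R * k * D < q
          step₂ = ≰⇒> (λ l → <⇒≱ sq (*-mono-≤ l l))
            where
              sq : R * k * D * (R * k * D) < q * q
              sq = begin-strict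
                R * k * D * (R * k * D)         ≡⟨ solve 3 (λ R k D → R :* k :* D :* (R :* k :* D) := (k :* k) :* ((R :* R) :* (D :* D))) refl R k D ⟩
                (k * k) * ((R * R) * (D * D))   ≤⟨ *-monoˡ-≤ ((R * R) * (D * D)) k²≤q ⟩
                q * ((R * R) * (D * D))         ≡⟨ cong (λ x → q * (x * (D * D))) (square r n) ⟨
                q * (r ^ (2 * n) * (D * D))     <⟨ ℕₚ.*-monoʳ-< q {{ℕ.>-nonZero 0<q}} big ⟩
                q * q                           ∎

-- Shattering

elements : ∀ {n} → Subset n → List (Fin n)
elements []ᵥ           = []
elements (true ∷ᵥ Y)  = Fin.zero ∷ map Fin.suc (elements Y)
elements (false ∷ᵥ Y) = map Fin.suc (elements Y)

length-elements : ∀ {n} (Y : Subset n) → length (elements Y) ≡ ∣ Y ∣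
length-elements []ᵥ           = refl
length-elements (true ∷ᵥ Y)  = cong suc (trans (length-map Fin.suc (elements Y)) (length-elements Y))
length-elements (false ∷ᵥ Y) = trans (length-map Fin.suc (elements Y)) (length-elements Y)

∈-elements : ∀ {n} {Y : Subset n} {y} → y ∈ₛ Y → y ∈ elements Y
∈-elements {Y = true ∷ᵥ Y}  here      = here refl
∈-elements {Y = true ∷ᵥ Y}  (there m) = there (∈-map⁺ Fin.suc (∈-elements m))
∈-elements {Y = false ∷ᵥ Y} (there m) = ∈-map⁺ Fin.suc (∈-elements m)

elements-unique : ∀ {n} (Y : Subset n) → Unique (elements Y)
elements-unique []ᵥ           = []
elements-unique (true ∷ᵥ Y)  = Allₚ.map⁺ (All.tabulate (λ _ ())) ∷ Uniqueₚ.map⁺ Finₚ.suc-injective (elements-unique Y)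
elements-unique (false ∷ᵥ Y) = Uniqueₚ.map⁺ Finₚ.suc-injective (elements-unique Y)

module Shattering {q : ℕ} (F : FiniteField q) (r : ℕ) (1<r : 1 < r) (r∣q-1 : r ∣ q ℕ.∸ 1) where
  open Field F
  open Arithmetic.Threshold r 1<r using (bound)

  c : ℕ
  c = _∣_.quotient r∣q-1

  rc : c ℕ.* r ≡ length units
  rc = trans (sym (_∣_.equality r∣q-1)) (cong (ℕ._∸ 1) (sym length-units))

  open CharacterSums F r c 1<r rc
  open Weights F r c 1<r rc using (0<r; root)
  open RootsOfUnity F using (rth-power; prime-divisor; ^-∣)

  module _ (n : ℕ) (big : r ℕ.^ (2 ℕ.* n) ℕ.* (bound n ℕ.* bound n) < q) where
    open Arithmetic.Threshold.Parameters r 1<r q n big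

    stepanovBound : StepanovBound n Δ
    stepanovBound N c′ 0<N N≤r Nc gs distinct prim sz a₀ a₀∉ t S uniq mem =
      conclude N m 0<N N≤r sz (length S)
        (Stepanov.Auxiliary.stepanov F N c′ 0<N Nc gs distinct prim a₀ a₀∉ J B (M′ N m 0<N N≤r sz) t
          (M≤q N m 0<N N≤r sz) (many N m 0<N N≤r sz)
          (lim-bound N m 0<N N≤r sz (Irreducibility.Kummer.lim F N c′ 0<N Nc gs distinct prim a₀ a₀∉) (λ _ → refl) (λ _ _ → refl))
          S uniq mem)
      where m = Irreducibility.size F gs

    fresh : ∀ ys → length ys ≡ n → ∃ λ a → a ∉ ys
    fresh ys e with Finₚ.any? (λ a → ¬? (∈? _≟_ a ys))
    ... | yes found = found
    ... | no none = ⊥-elim (<⇒≱ n<q (subst (q ≤_) e (Finₚ.injective⇒≤ {f = λ a → Any.index (mem a)}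
        (λ {a} {b} eq → trans (lookup-index (mem a)) (trans (cong (lookup ys) eq) (sym (lookup-index (mem b))))))))
      where
        mem : ∀ a → a ∈ ys
        mem a = decidable-stable (∈? _≟_ a ys) (λ na → none (a , na))

  shattered : (Y : Subset q) → r ℕ.^ (2 ℕ.* ∣ Y ∣) ℕ.* (bound ∣ Y ∣ ℕ.* bound ∣ Y ∣) < q → Shattered F r Y
  shattered Y big A A⊆Y = x , (λ m → x∉ (∈-elements m)) , λ y y∈Y → mk⇔ (to y y∈Y) (from y y∈Y)
    where
      open Arithmetic.Threshold.Parameters r 1<r q using (enough; Δ)
      open Solver 𝔽
      ys = elements Y
      n≡ : length ys ≡ ∣ Y ∣
      n≡ = length-elements Y
      big′ : r ℕ.^ (2 ℕ.* length ys) ℕ.* (bound (length ys) ℕ.* bound (length ys)) < q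
      big′ = subst (λ n → r ℕ.^ (2 ℕ.* n) ℕ.* (bound n ℕ.* bound n) < q) (sym n≡) big
      p = prime-divisor r 1<r
      ωp = root (proj₁ p) (proj₁ (proj₂ p)) (proj₂ (proj₂ p))
      ω = proj₁ ωp
      ω≢1 = proj₂ (proj₂ ωp)
      -- For y in A the value of (y - x)^c is forced to be 1, so that y - x is an r-th power; for
      -- the other y it is forced to be the inverse of ω, which is not 1.
      target : ∀ y → Dec (y ∈ₛ A) → Fin q
      target y (yes _) = 1#
      target y (no _)  = ω
      v : Fin q → Fin q
      v y = target y (y Subsetₚ.∈? A)
      v^r : ∀ y → v y ^ r ≡ 1#
      v^r y with y Subsetₚ.∈? A
      ... | yes _ = 1^ r
      ... | no _  = ^-∣ {m = proj₁ p} (proj₁ (proj₂ ωp)) (proj₂ (proj₂ p))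
      a₀ = fresh (length ys) big′ ys refl
      found = pattern-exists ys (elements-unique Y) (proj₁ a₀) (proj₂ a₀) (Δ (length ys) big′) (stepanovBound (length ys) big′) v v^r
        (enough (length ys) big′ _ (length-outside ys (elements-unique Y) (proj₁ a₀) (proj₂ a₀) (Δ (length ys) big′) (stepanovBound (length ys) big′)))
      x = proj₁ found
      x∉ = proj₁ (proj₂ found)
      good : ∀ y → y ∈ₛ Y → (y - x) ^ c * v y ≡ 1#
      good y m = proj₂ (proj₂ found) (∈-elements m)

      to : ∀ y → y ∈ₛ Y → y ∈ₛ A → InΓ+ F r x y
      to y y∈Y y∈A = y - x , (w , w≢0 , trans (pow≡^ w r) wr) , solve 2 (λ y x → y := (y :- x) :+ x) refl y x
        where
          v≡1 : v y ≡ 1#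
          v≡1 with y Subsetₚ.∈? A
          ... | yes _ = refl
          ... | no ¬A = ⊥-elim (¬A y∈A)
          power = rth-power r c 0<r rc (trans (sym (*-identityʳ _)) (trans (cong ((y - x) ^ c *_) (sym v≡1)) (good y y∈Y)))
          w = proj₁ power
          w≢0 = proj₁ (proj₂ power)
          wr = proj₂ (proj₂ power)

      from : ∀ y → y ∈ₛ Y → InΓ+ F r x y → y ∈ₛ A
      from y y∈Y (g , (w , w≢0 , wr) , y≡) = decide (y Subsetₚ.∈? A) refl
        where
          y-x : (y - x) ^ c ≡ 1#
          y-x = trans (cong (_^ c) (trans (cong (_- x) y≡) (trans (solve 2 (λ g x → (g :+ x) :- x := g) refl g x) (trans (sym wr) (pow≡^ w r)))))
            (trans (^-assocʳ w r c) (trans (cong (w ^_) (trans (ℕₚ.*-comm r c) rc)) (fermat w≢0)))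
          decide : (d : Dec (y ∈ₛ A)) → (y Subsetₚ.∈? A) ≡ d → y ∈ₛ A
          decide (yes m) _ = m
          decide (no _)  e = ⊥-elim (ω≢1 (trans (sym (*-identityˡ ω)) (trans (cong₂ _*_ (sym y-x) (sym (cong (target y) e))) (good y y∈Y))))

-- Both statements for rational ε = a / b

open import Data.Nat using (_^_; _*_; _∸_)

theorem1p5 : (r : ℕ) → 2 ≤ r →
    ((a b : ℕ) → 1 ≤ a → 2 * a < b →
    ∃ λ q₀ → (q : ℕ) → q₀ ≤ q → IsPrimePower q → r ∣ (q ∸ 1) →
    (F : FiniteField q) → (Y : Subset q) →
    r ^ (2 * b * ∣ Y ∣) ≤ q ^ (b ∸ 2 * a) → Shattered F r Y)
    ×
    ((a b : ℕ) → 1 ≤ a → 2 * a < b →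
    ∃ λ q₀ → (q : ℕ) → q₀ ≤ q → IsPrimePower q → r ∣ (q ∸ 1) →
    (F : FiniteField q) → (m : ℕ) → IsM F r m →
    q ^ (b ∸ 2 * a) ≤ r ^ (2 * b * m))
theorem1p5 r 2≤r = first , second
  where
    open Arithmetic.Threshold r 2≤r
    first : (a b : ℕ) → 1 ≤ a → 2 * a < b →
      ∃ λ q₀ → (q : ℕ) → q₀ ≤ q → IsPrimePower q → r ∣ (q ∸ 1) →
      (F : FiniteField q) → (Y : Subset q) →
      r ^ (2 * b * ∣ Y ∣) ≤ q ^ (b ∸ 2 * a) → Shattered F r Y
    first a b 1≤a 2a<b = q₀ b , λ q q₀≤q _ r∣ F Y hyp →
      Shattering.shattered F r 2≤r r∣ Y (large a b 1≤a 2a<b q q₀≤q ∣ Y ∣ hyp)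

    -- The loss of passing from m + 1 to m is absorbed by halving ε.
    second : (a b : ℕ) → 1 ≤ a → 2 * a < b →
      ∃ λ q₀ → (q : ℕ) → q₀ ≤ q → IsPrimePower q → r ∣ (q ∸ 1) →
      (F : FiniteField q) → (m : ℕ) → IsM F r m →
      q ^ (b ∸ 2 * a) ≤ r ^ (2 * b * m)
    second a b 1≤a 2a<b = proj₁ part ℕ.+ r ^ (4 * b) , λ q q₀≤q pp r∣ F m (_ , maximal) →
      ℕₚ.≮⇒≥ (λ lt → maximal (λ Y Y≤ → proj₂ part q (≤-trans (m≤m+n _ _) q₀≤q) pp r∣ F Y
        (fits q m ∣ Y ∣ Y≤ (≤-trans (m≤n+m _ (proj₁ part)) q₀≤q) (<⇒≤ lt))))
      where
        open ℕₚ.≤-Reasoning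
        module S = +-*-Solver
        part = first a (2 * b) 1≤a (<-≤-trans 2a<b (ℕₚ.m≤n*m b 2))
        -- The exponent 4 b (m + 1) is twice 2 b m plus 4 b. The last part is paid for by r^(4b) ≤ q
        -- ≤ q^(2a), and 2 (b - 2a) + 2a = 2b - 2a is the exponent for ε / 2.
        fits : ∀ q m y → y ≤ suc m → r ^ (4 * b) ≤ q → r ^ (2 * b * m) ≤ q ^ (b ∸ 2 * a) → r ^ (2 * (2 * b) * y) ≤ q ^ (2 * b ∸ 2 * a)
        fits q m y y≤ r≤q le = begin
          r ^ (2 * (2 * b) * y) ≤⟨ ^-monoʳ-≤ r {{r≢0}} (*-monoʳ-≤ (2 * (2 * b)) y≤) ⟩
          r ^ (2 * (2 * b) * suc m)
            ≡⟨ cong (r ^_) (S.solve 2 (λ b m → S.con 2 S.:* (S.con 2 S.:* b) S.:* (S.con 1 S.:+ m) S.:= (S.con 2 S.:* b S.:* m S.:+ S.con 2 S.:* b S.:* m) S.:+ S.con 4 S.:* b) refl b m) ⟩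
          r ^ ((2 * b * m ℕ.+ 2 * b * m) ℕ.+ 4 * b)
            ≡⟨ trans (ℕₚ.^-distribˡ-+-* r (2 * b * m ℕ.+ 2 * b * m) (4 * b)) (cong (_* r ^ (4 * b)) (ℕₚ.^-distribˡ-+-* r (2 * b * m) (2 * b * m))) ⟩
          r ^ (2 * b * m) * r ^ (2 * b * m) * r ^ (4 * b)
            ≤⟨ *-mono-≤ (*-mono-≤ le le) (≤-trans r≤q (≤-trans (≤-reflexive (sym (ℕₚ.^-identityʳ q))) (^-monoʳ-≤ q {{q≢0}} (*-mono-≤ {1} {2} (s≤s z≤n) 1≤a)))) ⟩
          q ^ e * q ^ e * q ^ (2 * a)
            ≡⟨ trans (cong (_* q ^ (2 * a)) (sym (ℕₚ.^-distribˡ-+-* q e e))) (sym (ℕₚ.^-distribˡ-+-* q (e ℕ.+ e) (2 * a))) ⟩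
          q ^ ((e ℕ.+ e) ℕ.+ 2 * a)
            ≡⟨ cong (q ^_) exponent ⟩
          q ^ (2 * b ∸ 2 * a) ∎
          where
            e = b ∸ 2 * a
            r≢0 = ℕ.>-nonZero (<-trans (s≤s z≤n) 2≤r)
            q≢0 = ℕ.>-nonZero (<-≤-trans (ℕ.>-nonZero⁻¹ (r ^ (4 * b)) {{m^n≢0 r (4 * b) {{r≢0}}}}) r≤q)
            exponent : (e ℕ.+ e) ℕ.+ 2 * a ≡ 2 * b ∸ 2 * a
            exponent = sym (trans (cong (_∸ 2 * a) (trans (cong (2 *_) (sym (ℕₚ.m∸n+n≡m (<⇒≤ 2a<b))))
              (S.solve 2 (λ e x → S.con 2 S.:* (e S.:+ x) S.:= ((e S.:+ e) S.:+ x) S.:+ x) refl e (2 * a)))) (ℕₚ.m+n∸n≡m ((e ℕ.+ e) ℕ.+ 2 * a) (2 * a)))
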